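{- If $\mathcal T$ is an FLD$_1$-theory having a VC$^\sharp$-decomposition, then $\mathcal T$ satisfies VC$^\sharp$, i.e. $I(\mathcal T)\in\{1,\mathfrak c\}$.
   Context: All structures are partial orders in the language $L_b=\langle\le\rangle$; $\mathfrak c=2^{\aleph_0}$. For a complete $L_b$-theory $\mathcal T$, $I(\mathcal T)$ is the number of non-isomorphic countable models; for a partial order $\mathbb X$, $I(\mathbb X):=I(\mathrm{Th}(\mathbb X))$, with $I(\mathbb X)=1$ when $\mathbb X$ is finite; $\mathbb X$ satisfies VC$^\sharp$ iff $I(\mathbb X)\in\{1,\mathfrak c\}$. Lexicographic sum: for a partial order $\mathbb I=\langle I,\le_{\mathbb I}\rangle$ and partial orders $\mathbb X_i$ ($i\in I$) with pairwise disjoint domains, $\sum_{\mathbb I}\mathbb X_i$ is the partial order on $\bigcup_i X_i$ with $x\le x'$ iff either $x,x'\in X_i$ and $x\le_{\mathbb X_i}x'$, or $x\in X_i$, $x'\in X_j$ with $i<_{\mathbb I}j$. A partial order $\mathbb X$ is FLD$_1$ iff $\mathbb X=\sum_{\mathbb I}\mathbb X_i$ for some finite partial order $\mathbb I$ and partition $\{X_i\}_{i\in I}$ of its domain (induced suborders $\mathbb X_i$) with each $\mathbb X_i$ having a largest element; this is an FLD$_1$ decomposition. A complete theory of partial order is an FLD$_1$-theory iff some (equivalently every) model is FLD$_1$. A VC$^\sharp$-decomposition of $\mathcal T$ is an FLD$_1$ decomposition $\sum_{\mathbb I}\mathbb X_i$ of some model of $\mathcal T$ such that every $\mathbb X_i$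 satisfies VC$^\sharp$. -}

module Defs where

open import Level using (0ℓ; suc)
open import Data.Nat using (ℕ)
open import Data.Fin using (Fin; zero; suc)
open import Data.Bool using (Bool)
open import Data.Empty using (⊥)
open import Data.Unit using (⊤)
open import Data.Product using (Σ; _×_; _,_)
open import Data.Sum using (_⊎_)
open import Relation.Nullary using (¬_)
open import Relation.Binary.PropositionalEquality using (_≡_)
open import Relation.Binary.Definitions using (Decidable)
open import Relation.Binary.Structures using (IsPartialOrder)
open import Function.Bundles using (_⇔_; _↣_; _⤖_; Bijection)

record Structure : Set₁ where
  field
    Carrier : Set
    _≤_     : Carrier → Carrier → Set

open Structure public

IsPO : Structure → Set
IsPO X = IsPartialOrder _≡_ (_≤_ X)

data Formula (n : ℕ) : Set where
  le eq  : Fin n → Fin n → Formula n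
  ⊤f ⊥f  : Formula n
  _∧f_ _∨f_ _⇒f_ : Formula n → Formula n → Formula n
  ¬f_    : Formula n → Formula n
  ∀f ∃f  : Formula (ℕ.suc n) → Formula n

Sentence : Set
Sentence = Formula 0

extend : ∀ {n} {A : Set} → A → (Fin n → A) → Fin (ℕ.suc n) → A
extend a ρ zero    = a
extend a ρ (suc i) = ρ i

-- Tarskian satisfaction (read classically)
Sat : (X : Structure) → ∀ {n} → (Fin n → Carrier X) → Formula n → Set
Sat X ρ (le i j) = _≤_ X (ρ i) (ρ j)
Sat X ρ (eq i j) = ρ i ≡ ρ j
Sat X ρ ⊤f = ⊤
Sat X ρ ⊥f = ⊥
Sat X ρ (φ ∧f ψ) = Sat X ρ φ × Sat X ρ ψ
Sat X ρ (φ ∨f ψ) = Sat X ρ φ ⊎ Sat X ρ ψ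
Sat X ρ (φ ⇒f ψ) = Sat X ρ φ → Sat X ρ ψ
Sat X ρ (¬f φ) = ¬ Sat X ρ φ
Sat X ρ (∀f φ) = (a : Carrier X) → Sat X (extend a ρ) φ
Sat X ρ (∃f φ) = Σ (Carrier X) λ a → Sat X (extend a ρ) φ

noVars : {A : Set} → Fin 0 → A
noVars ()

_⊨_ : Structure → Sentence → Set
X ⊨ φ = Sat X noVars φ

-- Y is a model of Th(X)  (Th(X) is complete, so this is elementary equivalence)
ModelOfTh : Structure → Structure → Set
ModelOfTh X Y = (φ : Sentence) → (Y ⊨ φ) ⇔ (X ⊨ φ)

_≅_ : Structure → Structure → Set
Y ≅ Z = Σ (Carrier Y ⤖ Carrier Z) λ f →
  ∀ x y → _≤_ Y x y ⇔ _≤_ Z (Bijection.to f x) (Bijection.to f y)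

CountableModel : Structure → Set₁
CountableModel X = Σ Structure λ Y → (Carrier Y ↣ ℕ) × ModelOfTh X Y

model : ∀ {X} → CountableModel X → Structure
model (Y , _) = Y

I≡1 : Structure → Set₁
I≡1 X = CountableModel X × ((M N : CountableModel X) → model M ≅ model N)

-- I(X) = 𝔠 : continuum many pairwise non-isomorphic countable models
-- (I(X) ≤ 𝔠 always holds, countable models living on subsets of ℕ)
I≡𝔠 : Structure → Set₁
I≡𝔠 X = Σ ((ℕ → Bool) → CountableModel X) λ F →
  ∀ f g → model (F f) ≅ model (F g) → f ≡ g

VC♯ : Structure → Set₁
VC♯ X = I≡1 X ⊎ I≡𝔠 X

record FinPO : Set₁ where
  field
    size : ℕ
    _≤I_ : Fin size → Fin size → Set
    isPO : IsPartialOrder _≡_ _≤I_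

open FinPO public

Block : (X : Structure) {k : ℕ} → (Carrier X → Fin k) → Fin k → Structure
Block X p i = record
  { Carrier = Σ (Carrier X) λ x → p x ≡ i
  ; _≤_ = λ a b → _≤_ X (Data.Product.proj₁ a) (Data.Product.proj₁ b) }

HasLargest : Structure → Set
HasLargest Y = Σ (Carrier Y) λ t → ∀ y → _≤_ Y y t

-- X = Σ_𝕀 X_i, where X_i is the block of the partition map p
IsLexSum : (X : Structure) (𝕀 : FinPO) → (Carrier X → Fin (size 𝕀)) → Set
IsLexSum X 𝕀 p = ∀ x y → _≤_ X x y ⇔
  ((p x ≡ p y × _≤_ X x y) ⊎ (_≤I_ 𝕀 (p x) (p y) × ¬ (p x ≡ p y)))

VC♯Decomposition : Structure → Set₁
VC♯Decomposition X = Σ FinPO λ 𝕀 → Σ (Carrier X → Fin (size 𝕀)) λ p →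
  IsLexSum X 𝕀 p × ((i : Fin (size 𝕀)) → HasLargest (Block X p i) × VC♯ (Block X p i))

{-# OPTIONS --safe #-}

-- If all blocks are ℵ₀-categorical, then by Ryll-Nardzewski their countable models realise
-- finitely many n-types for each n; by Feferman–Vaught (via games) so does the sum of these
-- models, which is therefore the unique countable model.
--
-- Otherwise let F f (f : ℕ → Bool) be pairwise non-isomorphic models of one block, and let
-- M f be the sum with that block replaced by F f.  The blocks of a sum are definable from
-- their largest elements, so F f can be read off from M f together with the tuple of these
-- elements; hence only countably many M g are isomorphic to a given M f.  To conclude one
-- must pick continuum many non-isomorphic M f.  Excluded middle for all types provides choice
-- functions, but as there is no function extensionality they need not respect isomorphism,
-- so isomorphism classes have no representatives for free.  Instead, as in Morley's theorem,
-- consider types of tuples along a Scott hierarchy of length ω₁.  If at some level a nonempty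
-- set of types has no isolated point, a fusion of Henkin constructions gives a perfect set of
-- models.  If not, a class can be singled out in every nonempty set of types by the least
-- name of a condition isolating a point in it, which does respect isomorphism.  Indexing the
-- M g isomorphic to M f by a canonical copy splits ℕ → Bool into countably many sets on which
-- M is injective up to isomorphism, and by König's argument one of them has full size.
module Submission where

open import Defs
open import Axiom.ExcludedMiddle using (ExcludedMiddle)
open import Data.Bool as Bool using (Bool; true; false)
open import Data.Empty using (⊥; ⊥-elim)
open import Data.Fin as Fin using (Fin; toℕ)
open import Data.Fin.Properties using (toℕ-injective)
open import Data.List using (List; []; _∷_; map; tabulate; _++_; cartesianProductWith; allFin; lookup; length; cartesianProduct; upTo; applyUpTo)
open import Data.List.Membership.Propositional using (_∈_)
open import Data.List.Membership.Propositional.Properties using (∈-++⁺ˡ; ∈-++⁺ʳ; ∈-map⁺; ∈-map⁻; ∈-cartesianProductWith⁺; ∈-allFin; ∈-tabulate⁻; ∈-cartesianProduct⁺)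
open import Data.List.Properties using (tabulate-lookup; map-tabulate; map-∘; map-cong; map-applyUpTo; map-id; length-map; map-injective; ∷-injectiveˡ; ∷-injectiveʳ; length-upTo; length-tabulate)
open import Data.List.Relation.Unary.Any using (here; there)
open import Data.Maybe using (Maybe; just; nothing; fromMaybe)
open import Data.Maybe.Properties using (just-injective)
open import Data.Nat using (ℕ; zero; suc; _+_; s≤s; z≤n; _⊔_; _≟_) renaming (_≤_ to _≤ℕ_; _<_ to _<ℕ_)
open import Data.Nat.Properties using (+-identityʳ; ≤-refl; ≤-trans; m≤n⇒m≤1+n; m≤m⊔n; m≤n⊔m; +-suc; suc-injective; ≤-total; m≤n⇒m<n∨m≡n; <⇒≱; ≮⇒≥; ≤-antisym; n≤1+n)
open import Data.Product using (Σ; _×_; _,_; proj₁; proj₂)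
open import Data.Sum using (_⊎_; inj₁; inj₂)
open import Data.Unit using (⊤; tt)
open import Data.Vec as Vec using (Vec; []; _∷_; toList; fromList)
open import Data.Vec.Properties using (toList∘fromList) renaming (≡-dec to Vec-≡-dec)
open import Function.Base using (_∘_; id)
open import Function.Bundles using (_⇔_; _↣_; mk⇔; mk↣; mk⤖; Equivalence; Injection; Bijection)
open import Induction.WellFounded using (Acc; acc)
open import Level using (0ℓ)
open import Relation.Binary.PropositionalEquality using (_≡_; _≢_; refl; sym; trans; cong; cong₂; subst)
open import Relation.Binary.Structures using (IsPartialOrder)
open import Relation.Nullary using (¬_; Dec; yes; no)

open Equivalence using () renaming (to to fwd; from to bwd) public

-- `I≡𝔠` asks for `f ≡ g` as functions, while a perfect set of models only separates branches
-- pointwise. Each `f` is therefore coded by a real `c f`, the diagram of the countable model `F f`: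
-- reals agreeing at every argument come from isomorphic models, and the injectivity of `F` turns
-- this into `f ≡ g`. The same reals are what König's argument plants in a column of `g`.
--
-- Two more constraints shape the construction. Excluded middle is applied to small types, so models
-- are replaced by codes on subsets of ℕ, and a class of tuples is named by a point of a coded
-- model. Moreover an ordinal has many notations and accessibility proofs, and a class many
-- representatives. Hence every selection is a predicate satisfied by a whole class, accompanied by
-- a proof of invariance under all these changes; in this form it can be iterated along the
-- ordinals. Only at the end, where `A` is injective up to isomorphism of pointed structures, does
-- it become an equality `r f ≡ r f'`.

⇔-refl : {A : Set} → A ⇔ A
⇔-refl = mk⇔ id id

⇔-sym : {A B : Set} → A ⇔ B → B ⇔ A
⇔-sym e = mk⇔ (bwd e) (fwd e)

⇔-trans : {A B C : Set} → A ⇔ B → B ⇔ C → A ⇔ C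
⇔-trans e f = mk⇔ (λ a → fwd f (fwd e a)) (λ c → bwd e (bwd f c))

¬-cong : {A B : Set} → A ⇔ B → (¬ A) ⇔ (¬ B)
¬-cong e = mk⇔ (λ na b → na (bwd e b)) (λ nb a → nb (fwd e a))

×-cong : {A B C D : Set} → A ⇔ B → C ⇔ D → (A × C) ⇔ (B × D)
×-cong e f = mk⇔ (λ (a , c) → fwd e a , fwd f c) (λ (b , d) → bwd e b , bwd f d)

-- Countable enumerations

next : ℕ × ℕ → ℕ × ℕ
next (zero  , b) = suc b , zero
next (suc a , b) = a , suc b

unpair : ℕ → ℕ × ℕ
unpair zero    = zero , zero
unpair (suc n) = next (unpair n)

-- `next` walks along the antidiagonals. The recursion is on `s` and then on `b`: `(suc a , 0)` is
-- reached from `(0 , a)`, the last point of the preceding antidiagonal.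
unpair-surjective : ∀ s a b → a + b ≡ s → Σ ℕ λ n → unpair n ≡ (a , b)
unpair-surjective s zero zero e = 0 , refl
unpair-surjective (suc s) (suc a) zero e =
  let n , ≡e = unpair-surjective s zero a (trans (sym (+-identityʳ a)) (suc-injective e)) in
  suc n , cong next ≡e
unpair-surjective s a (suc b) e =
  let n , ≡e = unpair-surjective s (suc a) b (trans (sym (+-suc a b)) e) in
  suc n , cong next ≡e

pair : ℕ → ℕ → ℕ
pair a b = proj₁ (unpair-surjective (a + b) a b refl)

unpair-pair : ∀ a b → unpair (pair a b) ≡ (a , b)
unpair-pair a b = proj₂ (unpair-surjective (a + b) a b refl)

unpair-bound : ∀ n → (proj₁ (unpair n) ≤ℕ n) × (proj₂ (unpair n) ≤ℕ n)
unpair-bound zero = z≤n , z≤n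
unpair-bound (suc n) with unpair n | unpair-bound n
... | zero  , b | p , q = s≤s q , z≤n
... | suc a , b | p , q = ≤-trans (m≤n⇒m≤1+n ≤-refl) (m≤n⇒m≤1+n p) , s≤s q

pair-≥ : ∀ a b → b ≤ℕ pair a b
pair-≥ a b = subst (λ z → proj₂ z ≤ℕ pair a b) (unpair-pair a b) (proj₂ (unpair-bound (pair a b)))

pair-injective : ∀ {a b c d} → pair a b ≡ pair c d → (a ≡ c) × (b ≡ d)
pair-injective {a} {b} {c} {d} e =
  let h = trans (sym (unpair-pair a b)) (trans (cong unpair e) (unpair-pair c d)) in
  cong proj₁ h , cong proj₂ h

Enum : Set → Set
Enum A = Σ (ℕ → A) λ f → ∀ a → Σ ℕ λ n → f n ≡ a

abstract
  enum-× : {A B : Set} → Enum A → Enum B → Enum (A × B)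
  enum-× (f , f-onto) (g , g-onto) = (λ n → f (proj₁ (unpair n)) , g (proj₂ (unpair n))) , onto
    where
    onto : ∀ p → Σ ℕ λ n → (f (proj₁ (unpair n)) , g (proj₂ (unpair n))) ≡ p
    onto (a , b) with f-onto a | g-onto b
    ... | i , refl | j , refl = pair i j , cong (λ z → f (proj₁ z) , g (proj₂ z)) (unpair-pair i j)

enum-ℕ : Enum ℕ
enum-ℕ = id , λ n → n , refl

listOf : {A : Set} → (ℕ → A) → ℕ → ℕ → List A
listOf f zero    k = []
listOf f (suc n) k = f (proj₁ (unpair k)) ∷ listOf f n (proj₂ (unpair k))

listOf-onto : {A : Set} (e : Enum A) (l : List A) → Σ ℕ λ n → Σ ℕ λ k → listOf (proj₁ e) n k ≡ l
listOf-onto e []      = 0 , 0 , refl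
listOf-onto e (a ∷ l) with proj₂ e a | listOf-onto e l
... | i , refl | n , k , refl =
  suc n , pair i k , cong (λ z → proj₁ e (proj₁ z) ∷ listOf (proj₁ e) n (proj₂ z)) (unpair-pair i k)

abstract
  enum-List : {A : Set} → Enum A → Enum (List A)
  enum-List e = (λ n → listOf (proj₁ e) (proj₁ (unpair n)) (proj₂ (unpair n))) , onto
    where
    onto : ∀ l → Σ ℕ λ n → listOf (proj₁ e) (proj₁ (unpair n)) (proj₂ (unpair n)) ≡ l
    onto l with listOf-onto e l
    ... | n , k , refl = pair n k , cong (λ z → listOf (proj₁ e) (proj₁ z) (proj₂ z)) (unpair-pair n k)

-- Formulas with one extra predicate symbol

-- De Bruijn variables refer to positions in a list; an atom mentioning a position beyond
-- the end of the list is false.  labF is applied to the whole list.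
data Fm : Set where
  leF eqF : ℕ → ℕ → Fm
  labF    : Fm
  andF    : Fm → Fm → Fm
  notF    : Fm → Fm
  exF     : Fm → Fm

decodeFm : ℕ → ℕ → Fm
decodeFm zero _ = labF
decodeFm (suc d) c with unpair c
... | 0 , k = leF (proj₁ (unpair k)) (proj₂ (unpair k))
... | 1 , k = eqF (proj₁ (unpair k)) (proj₂ (unpair k))
... | 2 , k = andF (decodeFm d (proj₁ (unpair k))) (decodeFm d (proj₂ (unpair k)))
... | 3 , k = notF (decodeFm d k)
... | 4 , k = exF (decodeFm d k)
... | suc (suc (suc (suc (suc _)))) , k = labF

-- Asking for all larger amounts of fuel lets the bounds of two conjuncts be joined to their
-- maximum.
decodeFm-onto : ∀ φ → Σ ℕ λ c → Σ ℕ λ d → ∀ d' → d ≤ℕ d' → decodeFm d' c ≡ φ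
decodeFm-onto (leF i j) = pair 0 (pair i j) , 1 , λ where
    (suc d') _ → go d'
  where
  go : ∀ d' → decodeFm (suc d') (pair 0 (pair i j)) ≡ leF i j
  go d' rewrite unpair-pair 0 (pair i j) | unpair-pair i j = refl
decodeFm-onto (eqF i j) = pair 1 (pair i j) , 1 , λ where
    (suc d') _ → go d'
  where
  go : ∀ d' → decodeFm (suc d') (pair 1 (pair i j)) ≡ eqF i j
  go d' rewrite unpair-pair 1 (pair i j) | unpair-pair i j = refl
decodeFm-onto labF = pair 5 0 , 1 , λ where
    (suc d') _ → go d'
  where
  go : ∀ d' → decodeFm (suc d') (pair 5 0) ≡ labF
  go d' rewrite unpair-pair 5 0 = refl
decodeFm-onto (andF φ ψ) with decodeFm-onto φ | decodeFm-onto ψ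
... | c₁ , d₁ , h₁ | c₂ , d₂ , h₂ = pair 2 (pair c₁ c₂) , suc (d₁ Data.Nat.⊔ d₂) , λ where
    (suc d') (s≤s ≤e) → go d' ≤e
  where
  go : ∀ d' → d₁ Data.Nat.⊔ d₂ ≤ℕ d' → decodeFm (suc d') (pair 2 (pair c₁ c₂)) ≡ andF φ ψ
  go d' ≤e rewrite unpair-pair 2 (pair c₁ c₂) | unpair-pair c₁ c₂ =
    cong₂ andF (h₁ d' (≤-trans (m≤m⊔n d₁ d₂) ≤e)) (h₂ d' (≤-trans (m≤n⊔m d₁ d₂) ≤e))
decodeFm-onto (notF φ) with decodeFm-onto φ
... | c , d , h = pair 3 c , suc d , λ where
    (suc d') (s≤s ≤e) → go d' ≤e
  where
  go : ∀ d' → d ≤ℕ d' → decodeFm (suc d') (pair 3 c) ≡ notF φ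
  go d' ≤e rewrite unpair-pair 3 c = cong notF (h d' ≤e)
decodeFm-onto (exF φ) with decodeFm-onto φ
... | c , d , h = pair 4 c , suc d , λ where
    (suc d') (s≤s ≤e) → go d' ≤e
  where
  go : ∀ d' → d ≤ℕ d' → decodeFm (suc d') (pair 4 c) ≡ exF φ
  go d' ≤e rewrite unpair-pair 4 c = cong exF (h d' ≤e)

abstract
  enum-Fm : Enum Fm
  enum-Fm = (λ n → decodeFm (proj₁ (unpair n)) (proj₂ (unpair n))) , onto
    where
    onto : ∀ φ → Σ ℕ λ n → decodeFm (proj₁ (unpair n)) (proj₂ (unpair n)) ≡ φ
    onto φ with decodeFm-onto φ
    ... | c , d , h = pair d c , trans (cong (λ z → decodeFm (proj₁ z) (proj₂ z)) (unpair-pair d c)) (h d ≤-refl)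

nth : {A : Set} → List A → ℕ → Maybe A
nth []      _       = nothing
nth (x ∷ l) zero    = just x
nth (x ∷ l) (suc i) = nth l i

nth-map : {A B : Set} (f : A → B) (l : List A) {i : ℕ} {a : A} → nth l i ≡ just a → nth (map f l) i ≡ just (f a)
nth-map f (x ∷ l) {zero}  e = cong just (cong f (just-injective e))
nth-map f (x ∷ l) {suc i} e = nth-map f l {i} e

nth-map⁻ : {A B : Set} (f : A → B) (l : List A) {i : ℕ} {b : B} → nth (map f l) i ≡ just b →
           Σ A λ a → (nth l i ≡ just a) × (f a ≡ b)
nth-map⁻ f (x ∷ l) {zero}  e = x , refl , just-injective e
nth-map⁻ f (x ∷ l) {suc i} e = nth-map⁻ f l {i} e

nth-tabulate : {A : Set} {n : ℕ} (ρ : Fin n → A) (i : Fin n) → nth (tabulate ρ) (toℕ i) ≡ just (ρ i)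
nth-tabulate ρ Fin.zero    = refl
nth-tabulate ρ (Fin.suc i) = nth-tabulate (ρ ∘ Fin.suc) i

sat : (S : Structure) → (List (Carrier S) → Set) → List (Carrier S) → Fm → Set
sat S K u (leF i j)  = Σ (Carrier S) λ a → Σ (Carrier S) λ b →
                         (nth u i ≡ just a) × (nth u j ≡ just b) × _≤_ S a b
sat S K u (eqF i j)  = Σ (Carrier S) λ a → (nth u i ≡ just a) × (nth u j ≡ just a)
sat S K u labF       = K u
sat S K u (andF φ ψ) = sat S K u φ × sat S K u ψ
sat S K u (notF φ)   = ¬ sat S K u φ
sat S K u (exF φ)    = Σ (Carrier S) λ a → sat S K (a ∷ u) φ

sat-cong : (S : Structure) {K K' : List (Carrier S) → Set} → (∀ u → K u ⇔ K' u) →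
           ∀ φ u → sat S K u φ ⇔ sat S K' u φ
sat-cong S h (leF i j)  u = ⇔-refl
sat-cong S h (eqF i j)  u = ⇔-refl
sat-cong S h labF       u = h u
sat-cong S h (andF φ ψ) u = ×-cong (sat-cong S h φ u) (sat-cong S h ψ u)
sat-cong S h (notF φ)   u = ¬-cong (sat-cong S h φ u)
sat-cong S h (exF φ)    u = mk⇔ (λ (a , p) → a , fwd (sat-cong S h φ (a ∷ u)) p)
                                (λ (a , p) → a , bwd (sat-cong S h φ (a ∷ u)) p)

orF impF : Fm → Fm → Fm
orF φ ψ  = notF (andF (notF φ) (notF ψ))
impF φ ψ = notF (andF φ (notF ψ))

-- `Fm` has no truth constants, so a tautology and a contradiction are built from `labF`, whatever
-- its meaning.
translate : ∀ {n} → Formula n → Fm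
translate (le i j) = leF (toℕ i) (toℕ j)
translate (eq i j) = eqF (toℕ i) (toℕ j)
translate ⊤f       = notF (andF (notF labF) labF)
translate ⊥f       = andF (notF labF) labF
translate (φ ∧f ψ) = andF (translate φ) (translate ψ)
translate (φ ∨f ψ) = orF (translate φ) (translate ψ)
translate (φ ⇒f ψ) = impF (translate φ) (translate ψ)
translate (¬f φ)   = notF (translate φ)
translate (∀f φ)   = notF (exF (notF (translate φ)))
translate (∃f φ)   = exF (translate φ)

-- Isomorphisms

infix 4 _≃_

record _≃_ (S T : Structure) : Set where
  field
    to   : Carrier S → Carrier T
    from : Carrier T → Carrier S
    to∘from : ∀ b → to (from b) ≡ b
    from∘to : ∀ a → from (to a) ≡ a
    mono : ∀ x y → _≤_ S x y ⇔ _≤_ T (to x) (to y)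

open _≃_ public

≃-sym : ∀ {S T} → S ≃ T → T ≃ S
≃-sym {S} {T} e = record
  { to = from e ; from = to e ; to∘from = from∘to e ; from∘to = to∘from e
  ; mono = λ x y → mk⇔
      (λ ≤e → bwd (mono e (from e x) (from e y)) (subst id (sym (same x y)) ≤e))
      (λ ≤e → subst id (same x y) (fwd (mono e (from e x) (from e y)) ≤e)) }
  where
  same : ∀ x y → _≤_ T (to e (from e x)) (to e (from e y)) ≡ _≤_ T x y
  same x y = cong₂ (_≤_ T) (to∘from e x) (to∘from e y)

≃-trans : ∀ {S T U} → S ≃ T → T ≃ U → S ≃ U
≃-trans e f = record
  { to = λ x → to f (to e x) ; from = λ x → from e (from f x)
  ; to∘from = λ b → trans (cong (to f) (to∘from e (from f b))) (to∘from f b)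
  ; from∘to = λ a → trans (cong (from e) (from∘to f (to e a))) (from∘to e a)
  ; mono = λ x y → ⇔-trans (mono e x y) (mono f (to e x) (to e y)) }

≃⇒≅ : ∀ {S T} → S ≃ T → S ≅ T
≃⇒≅ e = mk⤖ ( (λ {x} {y} ≡e → trans (sym (from∘to e x)) (trans (cong (from e) ≡e) (from∘to e y)))
            , (λ y → from e y , λ {z} ≡e → trans (cong (to e) ≡e) (to∘from e y)))
      , mono e

≅⇒≃ : ∀ {S T} → S ≅ T → S ≃ T
≅⇒≃ (f , m) = record
  { to = Bijection.to f
  ; from = λ y → proj₁ (Bijection.surjective f y)
  ; to∘from = λ y → proj₂ (Bijection.surjective f y) refl
  ; from∘to = λ x → Bijection.injective f (proj₂ (Bijection.surjective f (Bijection.to f x)) refl)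
  ; mono = m }

sat-iso : ∀ {S T} (e : S ≃ T) {K : List (Carrier S) → Set} {K' : List (Carrier T) → Set} →
          (∀ u → K u ⇔ K' (map (to e) u)) → ∀ φ u → sat S K u φ ⇔ sat T K' (map (to e) u) φ
sat-iso {S} {T} e h (leF i j) u = mk⇔
  (λ (a , b , p , q , r) → to e a , to e b , nth-map (to e) u {i} p , nth-map (to e) u {j} q , fwd (mono e a b) r)
  (λ (a , b , p , q , r) → go a b (nth-map⁻ (to e) u {i} p) (nth-map⁻ (to e) u {j} q) r)
  where
  go : ∀ a b → Σ (Carrier S) (λ a' → (nth u i ≡ just a') × (to e a' ≡ a)) →
       Σ (Carrier S) (λ b' → (nth u j ≡ just b') × (to e b' ≡ b)) → _≤_ T a b → _
  go _ _ (a' , p , refl) (b' , q , refl) r = a' , b' , p , q , bwd (mono e a' b') r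
sat-iso {S} {T} e h (eqF i j) u = mk⇔
  (λ (a , p , q) → to e a , nth-map (to e) u {i} p , nth-map (to e) u {j} q)
  (λ (a , p , q) → go a (nth-map⁻ (to e) u {i} p) (nth-map⁻ (to e) u {j} q))
  where
  go : ∀ a → Σ (Carrier S) (λ a' → (nth u i ≡ just a') × (to e a' ≡ a)) →
       Σ (Carrier S) (λ b' → (nth u j ≡ just b') × (to e b' ≡ a)) → _
  go _ (a' , p , refl) (b' , q , ≡e) =
    a' , p , trans q (cong just (trans (sym (from∘to e b')) (trans (cong (from e) ≡e) (from∘to e a'))))
sat-iso e h labF u = h u
sat-iso e h (andF φ ψ) u = ×-cong (sat-iso e h φ u) (sat-iso e h ψ u)
sat-iso e h (notF φ) u = ¬-cong (sat-iso e h φ u)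
sat-iso {S} {T} e {K} {K'} h (exF φ) u = mk⇔
  (λ (a , p) → to e a , fwd (sat-iso e h φ (a ∷ u)) p)
  (λ (b , p) → from e b , bwd (sat-iso e h φ (from e b ∷ u))
                 (subst (λ z → sat T K' (z ∷ map (to e) u) φ) (sym (to∘from e b)) p))

-- Structures on subsets of ℕ

-- Codes by Boolean functions form a small type. This allows excluded middle, and the levels `E`
-- below, to quantify over all countable models.
record Cod : Set where
  field
    dom : ℕ → Bool
    rel : ℕ → ℕ → Bool

open Cod public

⟦_⟧ : Cod → Structure
⟦ M ⟧ = record
  { Carrier = Σ ℕ λ n → dom M n ≡ true
  ; _≤_ = λ a b → rel M (proj₁ a) (proj₁ b) ≡ true }

∣_∣ : Cod → Set
∣ M ∣ = Carrier ⟦ M ⟧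

∣∣-≡ : ∀ {M} {a b : ∣ M ∣} → proj₁ a ≡ proj₁ b → a ≡ b
∣∣-≡ {M} {n , p} {.n , q} refl = cong (n ,_) (uip p q)
  where
  uip : ∀ {b : Bool} (p q : b ≡ true) → p ≡ q
  uip refl refl = refl

enum-∣∣ : ∀ M → ∣ M ∣ → Enum ∣ M ∣
enum-∣∣ M d = element , λ (n , e) → n , element-≡ n e
  where
  element : ℕ → ∣ M ∣
  element n with dom M n Bool.≟ true
  ... | yes e = n , e
  ... | no _  = d
  element-≡ : ∀ n e → element n ≡ (n , e)
  element-≡ n e with dom M n Bool.≟ true
  ... | yes _ = ∣∣-≡ {M} refl
  ... | no ne = ⊥-elim (ne e)

-- Classical logic and coded copies of countable structures.

module Classical (em : ExcludedMiddle 0ℓ) where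

  by-contradiction : {A : Set} → ¬ ¬ A → A
  by-contradiction {A} h with em {A}
  ... | yes a = a
  ... | no na = ⊥-elim (h na)

  ¬∀⇒∃¬ : {A : Set} {P : A → Set} → ¬ (∀ a → P a) → Σ A λ a → ¬ P a
  ¬∀⇒∃¬ h = by-contradiction λ nex → h λ a → by-contradiction λ np → nex (a , np)

  ¬⇔ : {A B : Set} → ¬ (A ⇔ B) → (A × ¬ B) ⊎ (¬ A × B)
  ¬⇔ {A} {B} h with em {A} | em {B}
  ... | yes a | yes b = ⊥-elim (h (mk⇔ (λ _ → b) (λ _ → a)))
  ... | yes a | no nb = inj₁ (a , nb)
  ... | no na | yes b = inj₂ (na , b)
  ... | no na | no nb = ⊥-elim (h (mk⇔ (λ a → ⊥-elim (na a)) (λ b → ⊥-elim (nb b))))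

  truth : Set → Bool
  truth A = Dec.does (em {A})

  truth⇔ : (A : Set) → (truth A ≡ true) ⇔ A
  truth⇔ A with em {A}
  ... | yes a = mk⇔ (λ _ → a) (λ _ → refl)
  ... | no na = mk⇔ (λ ()) (λ a → ⊥-elim (na a))

  least : {P : ℕ → Set} → ∀ n → P n → Σ ℕ λ m → P m × (∀ k → P k → m ≤ℕ k)
  least {P} n p = go n p
    where
    go : ∀ {P : ℕ → Set} n → P n → Σ ℕ λ m → P m × (∀ k → P k → m ≤ℕ k)
    go zero p = zero , p , λ _ _ → z≤n
    go {P} (suc n) p with em {P 0}
    ... | yes p0 = zero , p0 , λ _ _ → z≤n
    ... | no np0 with go {λ k → P (suc k)} n p
    ...   | m , q , h = suc m , q , λ where
              zero pk → ⊥-elim (np0 pk)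
              (suc k) pk → s≤s (h k pk)

  translate-sat : (S : Structure) (K : List (Carrier S) → Set) → ∀ {n} (φ : Formula n) (ρ : Fin n → Carrier S) →
                  sat S K (tabulate ρ) (translate φ) ⇔ Sat S ρ φ
  translate-sat S K (le i j) ρ = mk⇔
    (λ (a , b , p , q , r) → subst id (cong₂ (_≤_ S)
        (just-injective (trans (sym p) (nth-tabulate ρ i))) (just-injective (trans (sym q) (nth-tabulate ρ j)))) r)
    (λ r → ρ i , ρ j , nth-tabulate ρ i , nth-tabulate ρ j , r)
  translate-sat S K (eq i j) ρ = mk⇔
    (λ (a , p , q) → just-injective (trans (sym (nth-tabulate ρ i)) (trans (trans p (sym q)) (nth-tabulate ρ j))))
    (λ e → ρ i , nth-tabulate ρ i , trans (nth-tabulate ρ j) (cong just (sym e)))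
  translate-sat S K ⊤f ρ = mk⇔ (λ _ → tt) (λ _ (n , p) → n p)
  translate-sat S K ⊥f ρ = mk⇔ (λ (n , p) → n p) ⊥-elim
  translate-sat S K (φ ∧f ψ) ρ = ×-cong (translate-sat S K φ ρ) (translate-sat S K ψ ρ)
  translate-sat S K (φ ∨f ψ) ρ = mk⇔ one two
    where
    one : _ → _
    one h with em {Sat S ρ φ}
    ... | yes p = inj₁ p
    ... | no np = inj₂ (by-contradiction λ nq →
            h ((λ x → np (fwd (translate-sat S K φ ρ) x)) , (λ x → nq (fwd (translate-sat S K ψ ρ) x))))
    two : _ → _
    two (inj₁ p) (n , _) = n (bwd (translate-sat S K φ ρ) p)
    two (inj₂ q) (_ , n) = n (bwd (translate-sat S K ψ ρ) q)
  translate-sat S K (φ ⇒f ψ) ρ = mk⇔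
    (λ h p → by-contradiction λ nq →
       h (bwd (translate-sat S K φ ρ) p , λ x → nq (fwd (translate-sat S K ψ ρ) x)))
    (λ h (p , nq) → nq (bwd (translate-sat S K ψ ρ) (h (fwd (translate-sat S K φ ρ) p))))
  translate-sat S K (¬f φ) ρ = ¬-cong (translate-sat S K φ ρ)
  translate-sat S K (∀f φ) ρ = mk⇔
    (λ h a → by-contradiction λ n → h (a , λ x → n (fwd (translate-sat S K φ (extend a ρ)) x)))
    (λ h (a , n) → n (bwd (translate-sat S K φ (extend a ρ)) (h a)))
  translate-sat S K (∃f φ) ρ = mk⇔
    (λ (a , p) → a , fwd (translate-sat S K φ (extend a ρ)) p)
    (λ (a , p) → a , bwd (translate-sat S K φ (extend a ρ)) p)

  module _ (Y : Structure) (ι : Carrier Y ↣ ℕ) where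

    private module ι = Injection ι

    private
      Below : ℕ → ℕ → Set
      Below m n = Σ (Carrier Y) λ y → Σ (Carrier Y) λ z → (ι.to y ≡ m) × (ι.to z ≡ n) × _≤_ Y y z

    encode : Cod
    encode = record
      { dom = λ n → truth (Σ (Carrier Y) λ y → ι.to y ≡ n) ; rel = λ m n → truth (Below m n) }

    encode-≃ : ⟦ encode ⟧ ≃ Y
    encode-≃ = record
      { to = λ (n , e) → proj₁ (at n e)
      ; from = λ y → ι.to y , bwd (truth⇔ _) (y , refl)
      ; to∘from = λ y → ι.injective (proj₂ (at (ι.to y) (bwd (truth⇔ _) (y , refl))))
      ; from∘to = λ (n , e) → ∣∣-≡ {encode} (proj₂ (at n e))
      ; mono = λ (m , d) (n , e) → mk⇔
          (λ r → let y , z , p , q , ≤e = fwd (truth⇔ (Below m n)) r in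
                 subst id (cong₂ (_≤_ Y) (ι.injective (trans p (sym (proj₂ (at m d)))))
                                         (ι.injective (trans q (sym (proj₂ (at n e)))))) ≤e)
          (λ ≤e → bwd (truth⇔ (Below m n)) (_ , _ , proj₂ (at m d) , proj₂ (at n e) , ≤e)) }
      where
      at : ∀ n → truth (Σ (Carrier Y) λ y → ι.to y ≡ n) ≡ true → Σ (Carrier Y) λ y → ι.to y ≡ n
      at n e = fwd (truth⇔ _) e

  code-↣ : (M : Cod) → ∣ M ∣ ↣ ℕ
  code-↣ M = mk↣ {to = proj₁} (∣∣-≡ {M})

  ModelOfTh-≃ : ∀ {X S T} → S ≃ T → ModelOfTh X S → ModelOfTh X T
  ModelOfTh-≃ {X} {S} {T} e m φ = ⇔-trans (⇔-sym st) (m φ)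
    where
    K : {A : Set} → List A → Set
    K _ = ⊤
    st : (S ⊨ φ) ⇔ (T ⊨ φ)
    st = ⇔-trans (⇔-sym (translate-sat S K φ noVars))
         (⇔-trans (sat-iso e {K = K} {K' = K} (λ _ → ⇔-refl) (translate φ) []) (translate-sat T K φ noVars))

-- Ehrenfeucht–Fraïssé games

nth-∈ : {A : Set} (l : List A) {i : ℕ} {a : A} → nth l i ≡ just a → a ∈ l
nth-∈ (x ∷ l) {zero}  e = here (sym (just-injective e))
nth-∈ (x ∷ l) {suc i} e = there (nth-∈ l {i} e)

depth : Fm → ℕ
depth (leF _ _)  = 0
depth (eqF _ _)  = 0
depth labF       = 0
depth (andF φ ψ) = depth φ ⊔ depth ψ
depth (notF φ)   = depth φ
depth (exF φ)    = suc (depth φ)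

blank : {A : Set} → A → Set
blank _ = ⊤

SameType : (A B : Structure) → List (Carrier A) → List (Carrier B) → Set
SameType A B u v = ∀ φ → sat A blank u φ ⇔ sat B blank v φ

module _ (A B : Structure) where

  PIso : List (Carrier A × Carrier B) → Set
  PIso l = ∀ {p q} → p ∈ l → q ∈ l →
    (_≤_ A (proj₁ p) (proj₁ q) ⇔ _≤_ B (proj₂ p) (proj₂ q)) × ((proj₁ p ≡ proj₁ q) ⇔ (proj₂ p ≡ proj₂ q))

  BF : ℕ → List (Carrier A × Carrier B) → Set
  BF zero    l = PIso l
  BF (suc r) l = PIso l × (∀ a → Σ (Carrier B) λ b → BF r ((a , b) ∷ l))
                        × (∀ b → Σ (Carrier A) λ a → BF r ((a , b) ∷ l))

module _ {A B : Structure} where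

  BF⇒PIso : ∀ r {l} → BF A B r l → PIso A B l
  BF⇒PIso zero    h = h
  BF⇒PIso (suc r) h = proj₁ h

  BF-pred : ∀ r {l} → BF A B (suc r) l → BF A B r l
  BF-pred zero    h = proj₁ h
  BF-pred (suc r) (p , f , g) = p , (λ a → proj₁ (f a) , BF-pred r (proj₂ (f a)))
                                  , (λ b → proj₁ (g b) , BF-pred r (proj₂ (g b)))

  BF-≤ : ∀ {r s l} → r ≤ℕ s → BF A B s l → BF A B r l
  BF-≤ {r} {zero} z≤n h = h
  BF-≤ {zero} {suc s} z≤n h = proj₁ h
  BF-≤ {suc r} {suc s} (s≤s ≤e) (p , f , g) = p , (λ a → proj₁ (f a) , BF-≤ ≤e (proj₂ (f a)))
                                                , (λ b → proj₁ (g b) , BF-≤ ≤e (proj₂ (g b)))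

  BF-sat : ∀ φ l → BF A B (depth φ) l → sat A blank (map proj₁ l) φ ⇔ sat B blank (map proj₂ l) φ
  BF-sat (leF i j) l h = mk⇔ one two
    where
    one : _ → _
    one (a , b , p , q , r) with nth-map⁻ proj₁ l {i} p | nth-map⁻ proj₁ l {j} q
    ... | x , x∈ , refl | y , y∈ , refl = proj₂ x , proj₂ y , nth-map proj₂ l {i} x∈ , nth-map proj₂ l {j} y∈ ,
      fwd (proj₁ (h (nth-∈ l {i} x∈) (nth-∈ l {j} y∈))) r
    two : _ → _
    two (a , b , p , q , r) with nth-map⁻ proj₂ l {i} p | nth-map⁻ proj₂ l {j} q
    ... | x , x∈ , refl | y , y∈ , refl = proj₁ x , proj₁ y , nth-map proj₁ l {i} x∈ , nth-map proj₁ l {j} y∈ ,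
      bwd (proj₁ (h (nth-∈ l {i} x∈) (nth-∈ l {j} y∈))) r
  BF-sat (eqF i j) l h = mk⇔ one two
    where
    one : _ → _
    one (a , p , q) with nth-map⁻ proj₁ l {i} p | nth-map⁻ proj₁ l {j} q
    ... | x , x∈ , refl | y , y∈ , ≡e = proj₂ x , nth-map proj₂ l {i} x∈ ,
      trans (nth-map proj₂ l {j} y∈) (cong just (fwd (proj₂ (h (nth-∈ l {j} y∈) (nth-∈ l {i} x∈))) ≡e))
    two : _ → _
    two (a , p , q) with nth-map⁻ proj₂ l {i} p | nth-map⁻ proj₂ l {j} q
    ... | x , x∈ , refl | y , y∈ , ≡e = proj₁ x , nth-map proj₁ l {i} x∈ ,
      trans (nth-map proj₁ l {j} y∈) (cong just (bwd (proj₂ (h (nth-∈ l {j} y∈) (nth-∈ l {i} x∈))) ≡e))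
  BF-sat labF l h = ⇔-refl
  BF-sat (andF φ ψ) l h = ×-cong (BF-sat φ l (BF-≤ (m≤m⊔n (depth φ) (depth ψ)) h))
                                 (BF-sat ψ l (BF-≤ (m≤n⊔m (depth φ) (depth ψ)) h))
  BF-sat (notF φ) l h = ¬-cong (BF-sat φ l h)
  BF-sat (exF φ) l (_ , f , g) = mk⇔
    (λ (a , s) → proj₁ (f a) , fwd (BF-sat φ ((a , proj₁ (f a)) ∷ l) (proj₂ (f a))) s)
    (λ (b , s) → proj₁ (g b) , bwd (BF-sat φ ((proj₁ (g b) , b) ∷ l) (proj₂ (g b))) s)

  BF⇒SameType : ∀ l → (∀ r → BF A B r l) → SameType A B (map proj₁ l) (map proj₂ l)
  BF⇒SameType l h φ = BF-sat φ l (h (depth φ))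

  -- Only membership in a position matters, so pairs may be dropped, repeated or reordered.
  BF-⊆ : ∀ r {l l'} → (∀ {p} → p ∈ l' → p ∈ l) → BF A B r l → BF A B r l'
  BF-⊆ zero sub h p∈ q∈ = h (sub p∈) (sub q∈)
  BF-⊆ (suc r) {l} {l'} sub (h , f , g) =
    (λ p∈ q∈ → h (sub p∈) (sub q∈)) , (λ a → proj₁ (f a) , BF-⊆ r cons (proj₂ (f a)))
                                    , (λ b → proj₁ (g b) , BF-⊆ r cons (proj₂ (g b)))
    where
    cons : ∀ {x p} → p ∈ x ∷ l' → p ∈ x ∷ l
    cons (here e)  = here e
    cons (there m) = there (sub m)

-- The minterms over the listed formulas; classically every tuple satisfies one of them.
patterns : ∀ {n} → List (Formula n) → List (Formula n)
patterns []      = ⊤f ∷ []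
patterns (φ ∷ l) = map (φ ∧f_) (patterns l) ++ map ((¬f φ) ∧f_) (patterns l)

-- By finiteness of the language, finitely many formulas decide the game of length r.
hintikka : ∀ n → ℕ → List (Formula n)
hintikka n zero    = cartesianProductWith le (allFin n) (allFin n) ++ cartesianProductWith eq (allFin n) (allFin n)
hintikka n (suc r) = hintikka n zero ++ map ∃f (patterns (hintikka (suc n) r))

module Games (em : ExcludedMiddle 0ℓ) where

  open Classical em public

  Agree : (A B : Structure) → ∀ {n} → (Fin n → Carrier A) → (Fin n → Carrier B) → List (Formula n) → Set
  Agree A B ρ σ l = ∀ φ → φ ∈ l → Sat A ρ φ ⇔ Sat B σ φ

  module _ (A B : Structure) where

    pattern-of : ∀ {n} (ρ : Fin n → Carrier A) (l : List (Formula n)) →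
                 Σ (Formula n) λ π → (π ∈ patterns l) × Sat A ρ π × (∀ σ → Sat B σ π → Agree A B ρ σ l)
    pattern-of ρ [] = ⊤f , here refl , tt , λ _ _ _ ()
    pattern-of ρ (φ ∷ l) with pattern-of ρ l | em {Sat A ρ φ}
    ... | π , π∈ , s , h | yes p = φ ∧f π , ∈-++⁺ˡ (∈-map⁺ (φ ∧f_) π∈) , (p , s) , λ where
        σ (q , _) _ (here refl) → mk⇔ (λ _ → q) (λ _ → p)
        σ (_ , t) ψ (there ψ∈)  → h σ t ψ ψ∈
    ... | π , π∈ , s , h | no np = (¬f φ) ∧f π , ∈-++⁺ʳ _ (∈-map⁺ ((¬f φ) ∧f_) π∈) , (np , s) , λ where
        σ (nq , _) _ (here refl) → mk⇔ (λ p → ⊥-elim (np p)) (λ q → ⊥-elim (nq q))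
        σ (_ , t) ψ (there ψ∈)   → h σ t ψ ψ∈

    agree-PIso : ∀ {n} (ρ : Fin n → Carrier A) (σ : Fin n → Carrier B) → Agree A B ρ σ (hintikka n 0) →
                 PIso A B (tabulate λ i → ρ i , σ i)
    agree-PIso ρ σ h p∈ q∈ with ∈-tabulate⁻ p∈ | ∈-tabulate⁻ q∈
    ... | i , refl | j , refl =
      h (le i j) (∈-++⁺ˡ (∈-cartesianProductWith⁺ le (∈-allFin i) (∈-allFin j))) ,
      h (eq i j) (∈-++⁺ʳ (cartesianProductWith le (allFin _) (allFin _)) (∈-cartesianProductWith⁺ eq (∈-allFin
              i) (∈-allFin j)))

  -- A move is answered by transporting its minterm: for the minterm `π` of the extended tuple,
  -- `∃f π` is in the list, so agreement yields an answer with the same `π`, hence agreement on all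
  -- that the shorter game needs.
  agree⇒BF : ∀ A B r {n} (ρ : Fin n → Carrier A) (σ : Fin n → Carrier B) → Agree A B ρ σ (hintikka n r) →
             BF A B r (tabulate λ i → ρ i , σ i)
  agree⇒BF A B zero ρ σ h = agree-PIso A B ρ σ h
  agree⇒BF A B (suc r) {n} ρ σ h = agree-PIso A B ρ σ (λ φ φ∈ → h φ (∈-++⁺ˡ φ∈)) , forth , back
    where
    forth : ∀ a → Σ (Carrier B) λ b → BF A B r ((a , b) ∷ tabulate λ i → ρ i , σ i)
    forth a with pattern-of A B (extend a ρ) (hintikka (suc n) r)
    ... | π , π∈ , s , k with fwd (h (∃f π) (∈-++⁺ʳ (hintikka n 0) (∈-map⁺ ∃f π∈))) (a , s)
    ...   | b , t = b , agree⇒BF A B r (extend a ρ) (extend b σ) (k (extend b σ) t)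
    back : ∀ b → Σ (Carrier A) λ a → BF A B r ((a , b) ∷ tabulate λ i → ρ i , σ i)
    back b with pattern-of B A (extend b σ) (hintikka (suc n) r)
    ... | π , π∈ , s , k with bwd (h (∃f π) (∈-++⁺ʳ (hintikka n 0) (∈-map⁺ ∃f π∈))) (b , s)
    ...   | a , t = a , agree⇒BF A B r (extend a ρ) (extend b σ) (λ φ φ∈ → ⇔-sym (k (extend a ρ) t φ φ∈))

  tabulate-map : {A B : Set} (f : A → B) (l : List A) → tabulate (λ i → f (lookup l i)) ≡ map f l
  tabulate-map f l = trans (sym (map-tabulate (lookup l) f)) (cong (map f) (tabulate-lookup l))

  -- Equality of types wins the game of each finite length separately, since each length needs only
  -- finitely many formulas.
  SameType⇒BF : ∀ {A B} l → SameType A B (map proj₁ l) (map proj₂ l) → ∀ r → BF A B r l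
  SameType⇒BF {A} {B} l h r = subst (BF A B r) (tabulate-lookup l)
    (agree⇒BF A B r (λ i → proj₁ (lookup l i)) (λ i → proj₂ (lookup l i)) λ φ _ →
      ⇔-trans (⇔-sym (translate-sat A blank φ _)) (⇔-trans (trans⇔ φ) (translate-sat B blank φ _)))
    where
    trans⇔ : ∀ (φ : Formula (length l)) → sat A blank (tabulate (λ i → proj₁ (lookup l i))) (translate φ)
                 ⇔ sat B blank (tabulate (λ i → proj₂ (lookup l i))) (translate φ)
    trans⇔ φ rewrite tabulate-map proj₁ l | tabulate-map proj₂ l = h (translate φ)

  ModelOfTh⇒BF : ∀ {X Y} → ModelOfTh X Y → ∀ r → BF Y X r []
  ModelOfTh⇒BF {X} {Y} m r = agree⇒BF Y X r noVars noVars (λ φ _ → m φ)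

  BF⇒ModelOfTh : ∀ {X Y} → (∀ r → BF Y X r []) → ModelOfTh X Y
  BF⇒ModelOfTh {X} {Y} h φ = ⇔-trans (⇔-sym (translate-sat Y blank φ noVars))
    (⇔-trans (BF⇒SameType [] h (translate φ)) (translate-sat X blank φ noVars))

  ModelOfTh⇒SameType : ∀ {X Y} → ModelOfTh X Y → SameType Y X [] []
  ModelOfTh⇒SameType m = BF⇒SameType [] (ModelOfTh⇒BF m)

  ModelOfTh-trans : ∀ {X Y Z} → ModelOfTh X Y → ModelOfTh Y Z → ModelOfTh X Z
  ModelOfTh-trans m n φ = ⇔-trans (n φ) (m φ)

  ModelOfTh-iso : ∀ {X Y} → X ≃ Y → ModelOfTh X Y
  ModelOfTh-iso e = ModelOfTh-≃ e (λ _ → ⇔-refl)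

-- Lexicographic sums

module _ (𝕀 : FinPO) where

  Lex : (Fin (size 𝕀) → Structure) → Structure
  Lex Y = record
    { Carrier = Σ (Fin (size 𝕀)) λ i → Carrier (Y i)
    ; _≤_ = λ (i , x) (j , y) → (Σ (i ≡ j) λ e → _≤_ (Y j) (subst (λ k → Carrier (Y k)) e x) y)
                                ⊎ (_≤I_ 𝕀 i j × (i ≢ j)) }

  module _ (Y Z : Fin (size 𝕀) → Structure) where

    Parts : Set
    Parts = ∀ i → List (Carrier (Y i) × Carrier (Z i))

    -- A position in the sum is split into positions in the blocks; paired elements lie in blocks of
    -- the same index.
    Fits : Parts → List (Carrier (Lex Y) × Carrier (Lex Z)) → Set
    Fits ps l = ∀ {p} → p ∈ l → Σ (Fin (size 𝕀)) λ i → Σ (Carrier (Y i)) λ x → Σ (Carrier (Z i)) λ x' →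
      (p ≡ ((i , x) , (i , x'))) × ((x , x') ∈ ps i)

    addPart : ∀ i → Carrier (Y i) × Carrier (Z i) → Parts → Parts
    addPart i p ps j with i Fin.≟ j
    ... | yes refl = p ∷ ps j
    ... | no _     = ps j

    addPart-new : ∀ i p ps → p ∈ addPart i p ps i
    addPart-new i p ps with i Fin.≟ i
    ... | yes refl = here refl
    ... | no n     = ⊥-elim (n refl)

    addPart-old : ∀ i p ps j {q} → q ∈ ps j → q ∈ addPart i p ps j
    addPart-old i p ps j q∈ with i Fin.≟ j
    ... | yes refl = there q∈
    ... | no _     = q∈

    addPart-fits : ∀ i x x' {ps l} → Fits ps l → Fits (addPart i (x , x') ps) (((i , x) , (i , x')) ∷ l)
    addPart-fits i x x' {ps} fits (here refl) = i , x , x' , refl , addPart-new i (x , x') ps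
    addPart-fits i x x' {ps} fits (there p∈) with fits p∈
    ... | j , y , y' , ≡e , q∈ = j , y , y' , ≡e , addPart-old i (x , x') ps j q∈

    addPart-BF : ∀ r i p {ps} → BF (Y i) (Z i) r (p ∷ ps i) → (∀ j → BF (Y j) (Z j) r (ps j)) →
                 ∀ j → BF (Y j) (Z j) r (addPart i p ps j)
    addPart-BF r i p new old j with i Fin.≟ j
    ... | yes refl = new
    ... | no _     = old j

    Lex-PIso : ∀ {ps l} → Fits ps l → (∀ i → PIso (Y i) (Z i) (ps i)) → PIso (Lex Y) (Lex Z) l
    Lex-PIso {ps} fits h p∈ q∈ with fits p∈ | fits q∈
    ... | i , x , x' , refl , x∈ | j , y , y' , refl , y∈ with i Fin.≟ j
    ...   | yes refl = mk⇔ (λ { (inj₁ (refl , r)) → inj₁ (refl , fwd (proj₁ (h i x∈ y∈)) r)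
                              ; (inj₂ (_ , n)) → ⊥-elim (n refl) })
                           (λ { (inj₁ (refl , r)) → inj₁ (refl , bwd (proj₁ (h i x∈ y∈)) r)
                              ; (inj₂ (_ , n)) → ⊥-elim (n refl) })
                     , mk⇔ (λ { refl → cong (i ,_) (fwd (proj₂ (h i x∈ y∈)) refl) })
                           (λ { refl → cong (i ,_) (bwd (proj₂ (h i x∈ y∈)) refl) })
    ...   | no n = mk⇔ (λ { (inj₁ (e , _)) → ⊥-elim (n e) ; (inj₂ r) → inj₂ r })
                       (λ { (inj₁ (e , _)) → ⊥-elim (n e) ; (inj₂ r) → inj₂ r })
                 , mk⇔ (λ e → ⊥-elim (n (cong proj₁ e))) (λ e → ⊥-elim (n (cong proj₁ e)))

    -- Strategies combine blockwise: a move is answered by the strategy of its own block, while the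
    -- positions in the other blocks merely lose one round. Across blocks the order is that of `𝕀`
    -- on both sides.
    Lex-BF : ∀ r {ps l} → Fits ps l → (∀ i → BF (Y i) (Z i) r (ps i)) → BF (Lex Y) (Lex Z) r l
    Lex-BF zero fits h = Lex-PIso fits h
    Lex-BF (suc r) {ps} {l} fits h = Lex-PIso fits (λ i → proj₁ (h i)) , forth , back
      where
      lower : ∀ j → BF (Y j) (Z j) r (ps j)
      lower j = BF-pred r (h j)
      forth : ∀ a → Σ (Carrier (Lex Z)) λ b → BF (Lex Y) (Lex Z) r ((a , b) ∷ l)
      forth (i , x) = let x' , k = proj₁ (proj₂ (h i)) x in
        (i , x') , Lex-BF r (addPart-fits i x x' fits) (addPart-BF r i (x , x') k lower)
      back : ∀ b → Σ (Carrier (Lex Y)) λ a → BF (Lex Y) (Lex Z) r ((a , b) ∷ l)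
      back (i , x') = let x , k = proj₂ (proj₂ (h i)) x' in
        (i , x) , Lex-BF r (addPart-fits i x x' fits) (addPart-BF r i (x , x') k lower)

-- Back and forth between countable structures

module BackAndForth (M N : Cod) (R : List (∣ M ∣ × ∣ N ∣) → Set)
  (piso : ∀ {l} → R l → PIso ⟦ M ⟧ ⟦ N ⟧ l)
  (forth : ∀ {l} → R l → ∀ a → Σ ∣ N ∣ λ b → R ((a , b) ∷ l))
  (back : ∀ {l} → R l → ∀ b → Σ ∣ M ∣ λ a → R ((a , b) ∷ l))
  (l₀ : List (∣ M ∣ × ∣ N ∣)) (r₀ : R l₀) where

  private
    State : Set
    State = Σ (List (∣ M ∣ × ∣ N ∣)) R

    addM : ∀ n → Dec (dom M n ≡ true) → State → State
    addM n (yes e) (l , r) = _ , proj₂ (forth r (n , e))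
    addM n (no _)  s       = s

    addN : ∀ n → Dec (dom N n ≡ true) → State → State
    addN n (yes e) (l , r) = _ , proj₂ (back r (n , e))
    addN n (no _)  s       = s

    addM-⊆ : ∀ n d s {p} → p ∈ proj₁ s → p ∈ proj₁ (addM n d s)
    addM-⊆ n (yes e) s p∈ = there p∈
    addM-⊆ n (no _)  s p∈ = p∈

    addN-⊆ : ∀ n d s {p} → p ∈ proj₁ s → p ∈ proj₁ (addN n d s)
    addN-⊆ n (yes e) s p∈ = there p∈
    addN-⊆ n (no _)  s p∈ = p∈

    addM-new : ∀ n (e : dom M n ≡ true) d s → Σ ∣ N ∣ λ b → ((n , e) , b) ∈ proj₁ (addM n d s)
    addM-new n e (yes e') (l , r) = _ , here (cong (_, proj₁ (forth r (n , e'))) (∣∣-≡ {M} refl))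
    addM-new n e (no ne)  s       = ⊥-elim (ne e)

    addN-new : ∀ n (e : dom N n ≡ true) d s → Σ ∣ M ∣ λ a → (a , (n , e)) ∈ proj₁ (addN n d s)
    addN-new n e (yes e') (l , r) = _ , here (cong (proj₁ (back r (n , e')) ,_) (∣∣-≡ {N} refl))
    addN-new n e (no ne)  s       = ⊥-elim (ne e)

    step : ℕ → State → State
    step n s = addN n (dom N n Bool.≟ true) (addM n (dom M n Bool.≟ true) s)

    step-⊆ : ∀ n s {p} → p ∈ proj₁ s → p ∈ proj₁ (step n s)
    step-⊆ n s p∈ = addN-⊆ n (dom N n Bool.≟ true) _ (addM-⊆ n (dom M n Bool.≟ true) s p∈)

    chain : ℕ → State
    chain zero    = l₀ , r₀
    chain (suc n) = step n (chain n)

    chain-≤ : ∀ {m n} → m ≤ℕ n → ∀ {p} → p ∈ proj₁ (chain m) → p ∈ proj₁ (chain n)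
    chain-≤ {zero}  {zero}  z≤n p∈ = p∈
    chain-≤ {zero}  {suc n} z≤n p∈ = step-⊆ n _ (chain-≤ {zero} {n} z≤n p∈)
    chain-≤ {suc m} {suc n} ≤e p∈ with Data.Nat.Properties.m≤n⇒m<n∨m≡n ≤e
    ... | inj₂ refl = p∈
    ... | inj₁ (s≤s <e) = step-⊆ n _ (chain-≤ <e p∈)

    Graph : ∣ M ∣ → ∣ N ∣ → Set
    Graph a b = Σ ℕ λ n → (a , b) ∈ proj₁ (chain n)

    graph-piso : ∀ {a b a' b'} → Graph a b → Graph a' b' →
      (_≤_ ⟦ M ⟧ a a' ⇔ _≤_ ⟦ N ⟧ b b') × ((a ≡ a') ⇔ (b ≡ b'))
    graph-piso (m , p) (n , q) with ≤-total m n
    ... | inj₁ m≤n = piso (proj₂ (chain n)) (chain-≤ m≤n p) q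
    ... | inj₂ n≤m = piso (proj₂ (chain m)) p (chain-≤ n≤m q)

    image : ∀ a → Σ ∣ N ∣ (Graph a)
    image (n , e) = let b , b∈ = addM-new n e (dom M n Bool.≟ true) (chain n) in
      b , suc n , addN-⊆ n (dom N n Bool.≟ true) _ b∈

    preimage : ∀ b → Σ ∣ M ∣ λ a → Graph a b
    preimage (n , e) = let a , a∈ = addN-new n e (dom N n Bool.≟ true) _ in a , suc n , a∈

  isomorphism : ⟦ M ⟧ ≃ ⟦ N ⟧
  isomorphism = record
    { to = λ a → proj₁ (image a)
    ; from = λ b → proj₁ (preimage b)
    ; to∘from = λ b → fwd (proj₂ (graph-piso (proj₂ (image (proj₁ (preimage b)))) (proj₂ (preimage b)))) refl
    ; from∘to = λ a → bwd (proj₂ (graph-piso (proj₂ (preimage (proj₁ (image a)))) (proj₂ (image a)))) refl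
    ; mono = λ a a' → proj₁ (graph-piso (proj₂ (image a)) (proj₂ (image a'))) }

  isomorphism-extends : ∀ {a b} → (a , b) ∈ l₀ → to isomorphism a ≡ b
  isomorphism-extends {a} p∈ = fwd (proj₂ (graph-piso (proj₂ (image a)) (0 , p∈))) refl

-- Fusion: a binary tree of conditions meeting countably many dense requirements

strings : ∀ n → List (Vec Bool n)
strings zero    = [] ∷ []
strings (suc n) = map (true ∷_) (strings n) ++ map (false ∷_) (strings n)

∈-strings : ∀ {n} (s : Vec Bool n) → s ∈ strings n
∈-strings []          = here refl
∈-strings (true ∷ s)  = ∈-++⁺ˡ (∈-map⁺ (true ∷_) (∈-strings s))
∈-strings (false ∷ s) = ∈-++⁺ʳ _ (∈-map⁺ (false ∷_) (∈-strings s))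

-- The latest bit stands first, so `Vec.tail` passes to the predecessor node.
prefix : ∀ n → (ℕ → Bool) → Vec Bool n
prefix zero    x = []
prefix (suc n) x = x n ∷ prefix n x

prefix-≢ : ∀ {x y m n} → x m ≢ y m → m <ℕ n → prefix n x ≢ prefix n y
prefix-≢ {n = suc n} x≢y (s≤s m≤n) e with m≤n⇒m<n∨m≡n m≤n
... | inj₁ m<n  = prefix-≢ x≢y m<n (cong Vec.tail e)
... | inj₂ refl = x≢y (cong Vec.head e)

-- The requirement `U n` concerns single nodes and `V n` pairs of distinct nodes, both on level
-- `suc n`. A level is finite, so finitely many dense extensions take care of it.
module Fusion {Q : Set} (_≼_ : Q → Q → Set)
  (≼-refl : ∀ {p} → p ≼ p) (≼-trans : ∀ {p q r} → p ≼ q → q ≼ r → p ≼ r)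
  (U : ℕ → Q → Set) (U-up : ∀ n p q → p ≼ q → U n p → U n q)
  (U-dense : ∀ n p → Σ Q λ q → (p ≼ q) × U n q)
  (V : ℕ → Q → Q → Set) (V-up : ∀ {n p p' q q'} → p ≼ p' → q ≼ q' → V n p q → V n p' q')
  (V-dense : ∀ n p q → Σ Q λ p' → Σ Q λ q' → (p ≼ p') × (q ≼ q') × V n p' q')
  (q₀ : Q) where

  private
    module _ {m : ℕ} where

      _≟V_ : (s t : Vec Bool m) → Dec (s ≡ t)
      _≟V_ = Vec-≡-dec Bool._≟_

      _⊑_ : (σ τ : Vec Bool m → Q) → Set
      σ ⊑ τ = ∀ s → σ s ≼ τ s

      update : (Vec Bool m → Q) → Vec Bool m → Q → Vec Bool m → Q
      update σ s q t with s ≟V t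
      ... | yes _ = q
      ... | no _  = σ t

      update-≡ : ∀ σ s q → update σ s q s ≡ q
      update-≡ σ s q with s ≟V s
      ... | yes _ = refl
      ... | no n  = ⊥-elim (n refl)

      update-≢ : ∀ σ s q {t} → s ≢ t → update σ s q t ≡ σ t
      update-≢ σ s q {t} n with s ≟V t
      ... | yes e = ⊥-elim (n e)
      ... | no _  = refl

      update-⊑ : ∀ σ s q → σ s ≼ q → σ ⊑ update σ s q
      update-⊑ σ s q h t with s ≟V t
      ... | yes refl = h
      ... | no _     = ≼-refl

      meetU : ∀ n ss σ → Σ (Vec Bool m → Q) λ τ → (σ ⊑ τ) × (∀ {s} → s ∈ ss → U n (τ s))
      meetU n [] σ = σ , (λ _ → ≼-refl) , λ ()
      meetU n (s ∷ ss) σ with meetU n ss σ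
      ... | τ , σ⊑τ , h with U-dense n (τ s)
      ...   | q , τs≼q , u = update τ s q , (λ t → ≼-trans (σ⊑τ t) (ext t)) , λ where
                (here refl) → subst (U n) (sym (update-≡ τ s q)) u
                (there s∈)  → U-up n _ _ (ext _) (h s∈)
        where
        ext = update-⊑ τ s q τs≼q

      meetV : ∀ n ps σ → Σ (Vec Bool m → Q) λ τ → (σ ⊑ τ) ×
              (∀ {s t} → (s , t) ∈ ps → s ≢ t → V n (τ s) (τ t))
      meetV n [] σ = σ , (λ _ → ≼-refl) , λ ()
      meetV n ((s , t) ∷ ps) σ with meetV n ps σ
      ... | τ , σ⊑τ , h with V-dense n (τ s) (τ t) | s ≟V t
      ...   | _ | yes refl = τ , σ⊑τ , λ where
                (here refl) s≢t → ⊥-elim (s≢t refl)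
                (there p∈)  → h p∈
      ...   | p , q , τs≼p , τt≼q , v | no s≢t = τ₂ , (λ r → ≼-trans (σ⊑τ r) (ext r)) , λ where
                (here refl) _ → subst (λ z → V n z (τ₂ t)) (sym (trans (update-≢ τ₁ t q (s≢t ∘ sym)) (update-≡
                        τ s p)))
                                  (subst (V n p) (sym (update-≡ τ₁ t q)) v)
                (there p∈) s'≢t' → V-up (ext _) (ext _) (h p∈ s'≢t')
        where
        τ₁ = update τ s p
        τ₂ = update τ₁ t q
        ext : τ ⊑ τ₂
        ext r = ≼-trans (update-⊑ τ s p τs≼p r)
                  (update-⊑ τ₁ t q (subst (_≼ q) (sym (update-≢ τ s p s≢t)) τt≼q) r)

      abstract
        improve : ∀ n σ → Σ (Vec Bool m → Q) λ τ → (σ ⊑ τ) × (∀ s → U n (τ s)) × (∀ s t → s ≢ t → V n (τ s) (τ t))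
        improve n σ with meetU n (strings m) σ
        ... | τ , σ⊑τ , u with meetV n (cartesianProduct (strings m) (strings m)) τ
        ...   | τ' , τ⊑τ' , v = τ' , (λ s → ≼-trans (σ⊑τ s) (τ⊑τ' s)) , (λ s →
                U-up n _ _ (τ⊑τ' s) (u (∈-strings s))) ,
                  (λ s t → v (∈-cartesianProduct⁺ (∈-strings s) (∈-strings t)))

  stage : ∀ n → Vec Bool n → Q
  stage zero    _ = q₀
  stage (suc n) = proj₁ (improve n (λ s → stage n (Vec.tail s)))

  stage-suc : ∀ n s → stage n (Vec.tail s) ≼ stage (suc n) s
  stage-suc n s = proj₁ (proj₂ (improve n (λ s → stage n (Vec.tail s)))) s

  stage-U : ∀ n s → U n (stage (suc n) s)
  stage-U n = proj₁ (proj₂ (proj₂ (improve n (λ s → stage n (Vec.tail s)))))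

  -- Two branches that first differ at `m` meet `V n` only for `n` at least `m`, so a requirement on
  -- pairs must recur at arbitrarily large indices.
  stage-V : ∀ n s t → s ≢ t → V n (stage (suc n) s) (stage (suc n) t)
  stage-V n = proj₂ (proj₂ (proj₂ (improve n (λ s → stage n (Vec.tail s)))))

  along : (ℕ → Bool) → ℕ → Q
  along x n = stage n (prefix n x)

  along-≤ : ∀ x {m n} → m ≤ℕ n → along x m ≼ along x n
  along-≤ x {m} {zero} z≤n = ≼-refl
  along-≤ x {m} {suc n} m≤n with m≤n⇒m<n∨m≡n m≤n
  ... | inj₁ (s≤s m≤n') = ≼-trans (along-≤ x m≤n') (stage-suc n (prefix (suc n) x))
  ... | inj₂ refl = ≼-refl

-- Henkin sets and their term models

update : {A : Set} → (ℕ → A) → ℕ → A → ℕ → A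
update ρ j a i with i ≟ j
... | yes _ = a
... | no _  = ρ i

update-≡ : {A : Set} (ρ : ℕ → A) (j : ℕ) (a : A) → update ρ j a j ≡ a
update-≡ ρ j a with j ≟ j
... | yes _ = refl
... | no n  = ⊥-elim (n refl)

map-update : {A : Set} (ρ : ℕ → A) (j : ℕ) (a : A) (e : List ℕ) → (∀ {i} → i ∈ e → i <ℕ j) →
             map (update ρ j a) e ≡ map ρ e
map-update ρ j a []      h = refl
map-update ρ j a (i ∷ e) h with i ≟ j
... | yes refl = ⊥-elim (<⇒≱ (h (here refl)) ≤-refl)
... | no _     = cong (ρ i ∷_) (map-update ρ j a e (λ i∈ → h (there i∈)))

fresh : List ℕ → ℕ
fresh []      = 0
fresh (i ∷ e) = suc i ⊔ fresh e

fresh-> : ∀ {i} e → i ∈ e → i <ℕ fresh e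
fresh-> (i ∷ e) (here refl) = m≤m⊔n (suc i) (fresh e)
fresh-> (i ∷ e) (there i∈)  = ≤-trans (fresh-> e i∈) (m≤n⊔m (suc i) (fresh e))

module Henkin (em : ExcludedMiddle 0ℓ) where

  open Games em public

  -- A sentence about Henkin constants: a formula at a list of constants, with `labF` read as one
  -- predicate named by an element of `Lb`.
  Inst : Set → Set
  Inst Lb = Lb × Fm × List ℕ

  abstract
    enum-Inst : {Lb : Set} → Enum Lb → Enum (Inst Lb)
    enum-Inst e = enum-× e (enum-× enum-Fm (enum-List enum-ℕ))

  -- `K k M` interprets in `M` the predicate named `k`. Under `k₀`, which is always true, formulas
  -- speak of the order alone.
  module Theory (X : Structure) {Lb : Set} (K : Lb → (M : Cod) → List ∣ M ∣ → Set)
    (k₀ : Lb) (K₀ : ∀ M u → K k₀ M u) where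

    Mod : Cod → Set
    Mod M = ModelOfTh X ⟦ M ⟧

    holds : (M : Cod) (ρ : ℕ → ∣ M ∣) → Inst Lb → Set
    holds M ρ (k , φ , e) = sat ⟦ M ⟧ (K k M) (map ρ e) φ

    Holds : (M : Cod) (ρ : ℕ → ∣ M ∣) → List (Inst Lb) → Set
    Holds M ρ l = ∀ {i} → i ∈ l → holds M ρ i

    Holds-∷ : ∀ {M ρ i l} → holds M ρ i → Holds M ρ l → Holds M ρ (i ∷ l)
    Holds-∷ h hs (here refl) = h
    Holds-∷ h hs (there i∈)  = hs i∈

    Satisfiable : List (Inst Lb) → Set
    Satisfiable l = Σ Cod λ M → Mod M × Σ (ℕ → ∣ M ∣) λ ρ → Holds M ρ l

    constants : List (Inst Lb) → List ℕ
    constants []                = []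
    constants ((k , φ , e) ∷ l) = e ++ constants l

    constants-∈ : ∀ {i l} → i ∈ l → ∀ {j} → j ∈ proj₂ (proj₂ i) → j ∈ constants l
    constants-∈ (here refl) j∈ = ∈-++⁺ˡ j∈
    constants-∈ {l = (_ , _ , e) ∷ _} (there i∈) j∈ = ∈-++⁺ʳ e (constants-∈ i∈ j∈)

    freshFor : List ℕ → List ℕ → List (Inst Lb) → ℕ
    freshFor cs e l = fresh (cs ++ e ++ constants l)

    -- The constants `cs` keep their values: they name the tuple under study, which later conditions
    -- must not move.
    fresh-witness : ∀ {M ρ l} → Holds M ρ l → ∀ cs k φ e a → sat ⟦ M ⟧ (K k M) (a ∷ map ρ e) φ →
      Σ (ℕ → ∣ M ∣) λ ρ' → Holds M ρ' ((k , φ , freshFor cs e l ∷ e) ∷ l) × (map ρ' cs ≡ map ρ cs)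
    fresh-witness {M} {ρ} {l} hs cs k φ e a s = ρ' , Holds-∷ new old , map-update ρ j a cs (λ i∈ →
            fresh-> _ (∈-++⁺ˡ i∈))
      where
      j = freshFor cs e l
      ρ' = update ρ j a
      new : holds M ρ' (k , φ , j ∷ e)
      new = subst (λ z → sat ⟦ M ⟧ (K k M) z φ) (sym (cong₂ _∷_ (update-≡ ρ j a)
              (map-update ρ j a e (λ i∈ → fresh-> _ (∈-++⁺ʳ cs (∈-++⁺ˡ i∈)))))) s
      old : Holds M ρ' l
      old {k' , φ' , e'} i∈ = subst (λ z → sat ⟦ M ⟧ (K k' M) z φ')
        (sym (map-update ρ j a e' (λ j∈ → fresh-> _ (∈-++⁺ʳ cs (∈-++⁺ʳ e (constants-∈ i∈ j∈)))))) (hs i∈)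

    record HenkinSet (G : Inst Lb → Set) : Set where
      field
        fin : ∀ l → (∀ {i} → i ∈ l → G i) → Satisfiable l
        dec : ∀ k φ e → G (k , φ , e) ⊎ G (k , notF φ , e)
        wit : ∀ k φ e → G (k , notF (exF φ) , e) ⊎ Σ ℕ λ j → G (k , φ , j ∷ e)

    module TermModel {G : Inst Lb → Set} (H : HenkinSet G) where

      open HenkinSet H

      fin₁ : ∀ i → G i → Σ Cod λ M → Mod M × Σ (ℕ → ∣ M ∣) λ ρ → holds M ρ i
      fin₁ i g = let M , mod , ρ , hs = fin (i ∷ []) (λ { (here refl) → g }) in M , mod , ρ , hs (here refl)

      -- Otherwise the negation lies in `G`, and together with `l` it would have to be satisfiable.
      entails : ∀ l → (∀ {i} → i ∈ l → G i) → ∀ k φ e →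
                (∀ M ρ → Mod M → Holds M ρ l → holds M ρ (k , φ , e)) → G (k , φ , e)
      entails l l⊆G k φ e h with dec k φ e
      ... | inj₁ g = g
      ... | inj₂ g with fin ((k , notF φ , e) ∷ l) (λ { (here refl) → g ; (there i∈) → l⊆G i∈ })
      ...   | M , mod , ρ , hs = ⊥-elim (hs (here refl) (h M ρ mod (λ i∈ → hs (there i∈))))

      entails₁ : ∀ i → G i → ∀ k φ e → (∀ M ρ → Mod M → holds M ρ i → holds M ρ (k , φ , e)) → G (k , φ , e)
      entails₁ i g k φ e h = entails (i ∷ []) (λ { (here refl) → g }) k φ e (λ M ρ mod hs →
              h M ρ mod (hs (here refl)))

      equiv : ∀ k φ e k' φ' e' → (∀ M ρ → Mod M → holds M ρ (k , φ , e) ⇔ holds M ρ (k' , φ' , e')) →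
              G (k , φ , e) ⇔ G (k' , φ' , e')
      equiv k φ e k' φ' e' h = mk⇔ (λ g → entails₁ _ g k' φ' e' (λ M ρ mod → fwd (h M ρ mod)))
                                   (λ g → entails₁ _ g k φ e (λ M ρ mod → bwd (h M ρ mod)))

      consistent : ∀ k φ e → G (k , φ , e) → ¬ G (k , notF φ , e)
      consistent k φ e g g' with fin ((k , φ , e) ∷ (k , notF φ , e) ∷ [])
                                     (λ { (here refl) → g ; (there (here refl)) → g' })
      ... | M , _ , ρ , hs = hs (there (here refl)) (hs (here refl))

      EqG LeG : ℕ → ℕ → Set
      EqG i j = G (k₀ , eqF 0 1 , i ∷ j ∷ [])
      LeG i j = G (k₀ , leF 0 1 , i ∷ j ∷ [])

      holds-eq : ∀ M (ρ : ℕ → ∣ M ∣) k {a b} e {i j} → nth e a ≡ just i → nth e b ≡ just j →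
                 holds M ρ (k , eqF a b , e) ⇔ (ρ i ≡ ρ j)
      holds-eq M ρ k {a} {b} e p q = mk⇔
        (λ (x , r , s) → just-injective (trans (sym (nth-map ρ e {a} p)) (trans r (trans (sym s) (nth-map ρ e
                {b} q)))))
        (λ ≡e → _ , nth-map ρ e {a} p , trans (nth-map ρ e {b} q) (cong just (sym ≡e)))

      holds-le : ∀ M (ρ : ℕ → ∣ M ∣) k {a b} e {i j} → nth e a ≡ just i → nth e b ≡ just j →
                 holds M ρ (k , leF a b , e) ⇔ _≤_ ⟦ M ⟧ (ρ i) (ρ j)
      holds-le M ρ k {a} {b} e p q = mk⇔
        (λ (x , y , r , s , t) → subst id (cong₂ (_≤_ ⟦ M ⟧) (just-injective (trans (sym r) (nth-map ρ e {a} p)))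
                                                             (just-injective (trans (sym s) (nth-map ρ e {b} q)))) t)
        (λ t → _ , _ , nth-map ρ e {a} p , nth-map ρ e {b} q , t)

      holds-EqG : ∀ M (ρ : ℕ → ∣ M ∣) i j → holds M ρ (k₀ , eqF 0 1 , i ∷ j ∷ []) ⇔ (ρ i ≡ ρ j)
      holds-EqG M ρ i j = holds-eq M ρ k₀ {0} {1} (i ∷ j ∷ []) refl refl

      holds-LeG : ∀ M (ρ : ℕ → ∣ M ∣) i j → holds M ρ (k₀ , leF 0 1 , i ∷ j ∷ []) ⇔ _≤_ ⟦ M ⟧ (ρ i) (ρ j)
      holds-LeG M ρ i j = holds-le M ρ k₀ {0} {1} (i ∷ j ∷ []) refl refl

      EqG-refl : ∀ i → EqG i i
      EqG-refl i = entails [] (λ ()) k₀ _ _ (λ M ρ _ _ → bwd (holds-EqG M ρ i i) refl)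

      EqG-sym : ∀ {i j} → EqG i j → EqG j i
      EqG-sym {i} {j} g = entails₁ _ g k₀ _ _ (λ M ρ _ h → bwd (holds-EqG M ρ j i) (sym (fwd (holds-EqG M ρ i j) h)))

      EqG-trans : ∀ {i j k} → EqG i j → EqG j k → EqG i k
      EqG-trans {i} {j} {k} g g' = entails (_ ∷ _ ∷ []) (λ { (here refl) → g ; (there (here refl)) → g' }) k₀ _ _
        (λ M ρ _ hs → bwd (holds-EqG M ρ i k) (trans (fwd (holds-EqG M ρ i j) (hs (here refl)))
                                                     (fwd (holds-EqG M ρ j k) (hs (there (here refl))))))

      LeG-resp : ∀ {i i' j j'} → EqG i i' → EqG j j' → LeG i j → LeG i' j'
      LeG-resp {i} {i'} {j} {j'} g g' g'' =
        entails (_ ∷ _ ∷ _ ∷ []) (λ { (here refl) → g ; (there (here refl)) →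
                g' ; (there (there (here refl))) → g'' }) k₀ _ _
        (λ M ρ _ hs → bwd (holds-LeG M ρ i' j')
          (subst id (cong₂ (_≤_ ⟦ M ⟧) (fwd (holds-EqG M ρ i i') (hs (here refl)))
                                       (fwd (holds-EqG M ρ j j') (hs (there (here refl)))))
                    (fwd (holds-LeG M ρ i j) (hs (there (there (here refl)))))))

      -- Each class of constants identified by `G` is represented by its least member, which puts
      -- the quotient on a subset of ℕ.
      Fresh : ℕ → Set
      Fresh i = ∀ j → j <ℕ i → ¬ EqG j i

      abstract
        L : Cod
        L = record { dom = λ i → truth (Fresh i) ; rel = λ i j → truth (LeG i j) }

        leastRep : ∀ i → Σ ℕ λ j → EqG j i × (∀ k → EqG k i → j ≤ℕ k)
        leastRep i = least {P = λ j → EqG j i} i (EqG-refl i)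

        rep : ℕ → ∣ L ∣
        rep i = let j , g , min = leastRep i in
          j , bwd (truth⇔ (Fresh j)) (λ k k<j g' → <⇒≱ k<j (min k (EqG-trans g' g)))

        rep-EqG : ∀ i → EqG (proj₁ (rep i)) i
        rep-EqG i = proj₁ (proj₂ (leastRep i))

        rep-onto : ∀ (a : ∣ L ∣) → rep (proj₁ a) ≡ a
        rep-onto (i , e) = ∣∣-≡ {L} (≤-antisym (proj₂ (proj₂ (leastRep i)) i (EqG-refl i))
          (≮⇒≥ (λ <e → fwd (truth⇔ (Fresh i)) e _ <e (rep-EqG i))))

        rep-≡ : ∀ i j → (rep i ≡ rep j) ⇔ EqG i j
        rep-≡ i j = mk⇔
          (λ e → EqG-trans (EqG-sym (rep-EqG i)) (subst (λ z → EqG z j) (sym (cong proj₁ e)) (rep-EqG j)))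
          (λ g → ∣∣-≡ {L} (≤-antisym (proj₂ (proj₂ (leastRep i)) _ (EqG-trans (rep-EqG j) (EqG-sym g)))
                                     (proj₂ (proj₂ (leastRep j)) _ (EqG-trans (rep-EqG i) g))))

        rep-≤ : ∀ i j → _≤_ ⟦ L ⟧ (rep i) (rep j) ⇔ LeG i j
        rep-≤ i j = ⇔-trans (truth⇔ _) (mk⇔ (LeG-resp (rep-EqG i) (rep-EqG j))
                                            (LeG-resp (EqG-sym (rep-EqG i)) (EqG-sym (rep-EqG j))))

      G-le : ∀ k a b e i j → nth e a ≡ just i → nth e b ≡ just j → G (k , leF a b , e) ⇔ LeG i j
      G-le k a b e i j i∈ j∈ = equiv k (leF a b) e k₀ (leF 0 1) (i ∷ j ∷ [])
        (λ M ρ _ → ⇔-trans (holds-le M ρ k {a} {b} e i∈ j∈) (⇔-sym (holds-LeG M ρ i j)))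

      G-eq : ∀ k a b e i j → nth e a ≡ just i → nth e b ≡ just j → G (k , eqF a b , e) ⇔ EqG i j
      G-eq k a b e i j i∈ j∈ = equiv k (eqF a b) e k₀ (eqF 0 1) (i ∷ j ∷ [])
        (λ M ρ _ → ⇔-trans (holds-eq M ρ k {a} {b} e i∈ j∈) (⇔-sym (holds-EqG M ρ i j)))

      le-positions : ∀ k a b e → G (k , leF a b , e) →
                     Σ ℕ λ i → Σ ℕ λ j → (nth e a ≡ just i) × (nth e b ≡ just j) × LeG i j
      le-positions k a b e g =
        let M , _ , ρ , (x , y , p , q , _) = fin₁ (k , leF a b , e) g
            i , i∈ , _ = nth-map⁻ ρ e {a} p
            j , j∈ , _ = nth-map⁻ ρ e {b} q in
        i , j , i∈ , j∈ , fwd (G-le k a b e i j i∈ j∈) g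

      eq-positions : ∀ k a b e → G (k , eqF a b , e) →
                     Σ ℕ λ i → Σ ℕ λ j → (nth e a ≡ just i) × (nth e b ≡ just j) × EqG i j
      eq-positions k a b e g =
        let M , _ , ρ , (x , p , q) = fin₁ (k , eqF a b , e) g
            i , i∈ , _ = nth-map⁻ ρ e {a} p
            j , j∈ , _ = nth-map⁻ ρ e {b} q in
        i , j , i∈ , j∈ , fwd (G-eq k a b e i j i∈ j∈) g

      module _ (k : Lb) (lab-truth : ∀ e → K k L (map rep e) ⇔ G (k , labF , e)) where

        -- The label clause is a hypothesis because `K k L` is a statement about the finished
        -- structure `L`, not about `G`. For the Scott levels it is verified below by induction on
        -- rank.
        truthLemma : ∀ φ e → sat ⟦ L ⟧ (K k L) (map rep e) φ ⇔ G (k , φ , e)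
        truthLemma (leF a b) e = mk⇔ one (two ∘ le-positions k a b e)
          where
          one : sat ⟦ L ⟧ (K k L) (map rep e) (leF a b) → G (k , leF a b , e)
          one (x , y , p , q , r) with nth-map⁻ rep e {a} p | nth-map⁻ rep e {b} q
          ... | i , i∈ , refl | j , j∈ , refl = bwd (G-le k a b e i j i∈ j∈) (fwd (rep-≤ i j) r)
          two : (Σ ℕ λ i → Σ ℕ λ j → (nth e a ≡ just i) × (nth e b ≡ just j) × LeG i j) →
                sat ⟦ L ⟧ (K k L) (map rep e) (leF a b)
          two (i , j , i∈ , j∈ , g) = rep i , rep j , nth-map rep e {a} i∈ , nth-map rep e {b} j∈ , bwd (rep-≤ i j) g
        truthLemma (eqF a b) e = mk⇔ one (two ∘ eq-positions k a b e)
          where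
          one : sat ⟦ L ⟧ (K k L) (map rep e) (eqF a b) → G (k , eqF a b , e)
          one (x , p , q) with nth-map⁻ rep e {a} p | nth-map⁻ rep e {b} q
          ... | i , i∈ , refl | j , j∈ , ≡e = bwd (G-eq k a b e i j i∈ j∈) (fwd (rep-≡ i j) (sym ≡e))
          two : (Σ ℕ λ i → Σ ℕ λ j → (nth e a ≡ just i) × (nth e b ≡ just j) × EqG i j) →
                sat ⟦ L ⟧ (K k L) (map rep e) (eqF a b)
          two (i , j , i∈ , j∈ , g) = rep i , nth-map rep e {a} i∈ ,
            trans (nth-map rep e {b} j∈) (cong just (sym (bwd (rep-≡ i j) g)))
        truthLemma labF e = lab-truth e
        truthLemma (andF φ ψ) e = ⇔-trans (×-cong (truthLemma φ e) (truthLemma ψ e)) (mk⇔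
          (λ (g , g') → entails (_ ∷ _ ∷ []) (λ { (here refl) → g ; (there (here refl)) → g' }) k _ e
             (λ M ρ _ hs → hs (here refl) , hs (there (here refl))))
          (λ g → entails₁ _ g k φ e (λ M ρ _ → proj₁) , entails₁ _ g k ψ e (λ M ρ _ → proj₂)))
        truthLemma (notF φ) e = ⇔-trans (¬-cong (truthLemma φ e)) (mk⇔ one (λ g' g → consistent k φ e g g'))
          where
          one : ¬ G (k , φ , e) → G (k , notF φ , e)
          one n with dec k φ e
          ... | inj₁ g = ⊥-elim (n g)
          ... | inj₂ g = g
        truthLemma (exF φ) e = mk⇔
          (λ (a , s) → entails₁ _ (fwd (truthLemma φ (proj₁ a ∷ e)) (subst (λ z →
                  sat ⟦ L ⟧ (K k L) (z ∷ map rep e) φ) (sym (rep-onto a)) s))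
                         k (exF φ) e (λ M ρ _ h → ρ (proj₁ a) , h))
          two
          where
          two : G (k , exF φ , e) → sat ⟦ L ⟧ (K k L) (map rep e) (exF φ)
          two g with wit k φ e
          ... | inj₁ g' = ⊥-elim (consistent k (exF φ) e g g')
          ... | inj₂ (j , g') = rep j , bwd (truthLemma φ (j ∷ e)) g'

      k₀-truth : ∀ e → K k₀ L (map rep e) ⇔ G (k₀ , labF , e)
      k₀-truth e = mk⇔ (λ _ → entails [] (λ ()) k₀ labF e (λ M ρ _ _ → K₀ M _)) (λ _ → K₀ L _)

      L-Mod : Mod L
      L-Mod φ = ⇔-trans (⇔-sym (translate-sat ⟦ L ⟧ (K k₀ L) φ noVars))
        (⇔-trans (truthLemma k₀ k₀-truth (translate φ) []) (mk⇔ one two))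
        where
        one : G (k₀ , translate φ , []) → X ⊨ φ
        one g with fin₁ (k₀ , translate φ , []) g
        ... | M , mod , ρ , h = fwd (mod φ) (fwd (translate-sat ⟦ M ⟧ (K k₀ M) φ noVars) h)
        two : X ⊨ φ → G (k₀ , translate φ , [])
        two h = entails [] (λ ()) k₀ _ [] (λ M ρ mod _ → bwd (translate-sat ⟦ M ⟧ (K k₀ M) φ noVars) (bwd (mod φ) h))

    record Consistency (Big : List (Inst Lb) → Set) : Set where
      field
        big-sat : ∀ {l} → Big l → Satisfiable l
        big-dec : ∀ {l} → Big l → ∀ k φ e → Big ((k , φ , e) ∷ l) ⊎ Big ((k , notF φ , e) ∷ l)
        big-wit : ∀ {l} → Big l → ∀ k φ e → Big ((k , notF (exF φ) , e) ∷ l) ⊎ Σ ℕ λ j → Big ((k , φ , j ∷ e) ∷ l)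

    record GenericFamily (T : ℕ → List (Inst Lb) → Set) (V : ℕ → List (Inst Lb) → List (Inst Lb) → Set) : Set₁ where
      field
        Gen        : (ℕ → Bool) → Inst Lb → Set
        Gen-Henkin : ∀ x → HenkinSet (Gen x)
        Gen-T      : ∀ x n → Σ (List (Inst Lb)) λ l → T n l × (∀ {i} → i ∈ l → Gen x i)
        Gen-V      : ∀ x y {m} → x m ≢ y m → ∀ n → m ≤ℕ n → Σ (List (Inst Lb)) λ l → Σ (List (Inst Lb)) λ l' →
                     V n l l' × (∀ {i} → i ∈ l → Gen x i) × (∀ {i} → i ∈ l' → Gen y i)

    module Generic (enumLb : Enum Lb) {Big : List (Inst Lb) → Set} (C : Consistency Big)
      (T : ℕ → List (Inst Lb) → Set)
      (T-up : ∀ {n l l'} → (∀ {i} → i ∈ l → i ∈ l') → T n l → T n l')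
      (T-dense : ∀ n l → Big l → Σ (List (Inst Lb)) λ l' → Big l' × (∀ {i} → i ∈ l → i ∈ l') × T n l')
      (V : ℕ → List (Inst Lb) → List (Inst Lb) → Set)
      (V-up : ∀ {n l l' m m'} → (∀ {i} → i ∈ l → i ∈ l') → (∀ {i} → i ∈ m → i ∈ m') → V n l m → V n l' m')
      (V-dense : ∀ n l m → Big l → Big m → Σ (List (Inst Lb)) λ l' → Σ (List (Inst Lb)) λ m' →
                   Big l' × Big m' × (∀ {i} → i ∈ l → i ∈ l') × (∀ {i} → i ∈ m → i ∈ m') × V n l' m')
      (l₀ : List (Inst Lb)) (big₀ : Big l₀) where

      private
        open Consistency C

        Q : Set
        Q = Σ (List (Inst Lb)) Big

        _≼_ : Q → Q → Set
        p ≼ q = ∀ {i} → i ∈ proj₁ p → i ∈ proj₁ q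

        Decided : Inst Lb → List (Inst Lb) → Set
        Decided (k , φ , e) l = ((k , φ , e) ∈ l ⊎ (k , notF φ , e) ∈ l) ×
                                ((k , notF (exF φ) , e) ∈ l ⊎ Σ ℕ λ j → (k , φ , j ∷ e) ∈ l)

        U : ℕ → Q → Set
        U n q = Decided (proj₁ (enum-Inst enumLb) n) (proj₁ q) × T n (proj₁ q)

        up⊎ : {l l' : List (Inst Lb)} → (∀ {i} → i ∈ l → i ∈ l') → ∀ i → Decided i l → Decided i l'
        up⊎ s i (inj₁ a , inj₁ c) = inj₁ (s a) , inj₁ (s c)
        up⊎ s i (inj₁ a , inj₂ (j , c)) = inj₁ (s a) , inj₂ (j , s c)
        up⊎ s i (inj₂ a , inj₁ c) = inj₂ (s a) , inj₁ (s c)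
        up⊎ s i (inj₂ a , inj₂ (j , c)) = inj₂ (s a) , inj₂ (j , s c)

        decide : ∀ i l → Big l → Σ (List (Inst Lb)) λ l' → Big l' × (∀ {i} → i ∈ l → i ∈ l') × Decided i l'
        decide (k , φ , e) l b with big-dec b k φ e
        ... | inj₁ b₁ with big-wit b₁ k φ e
        ...   | inj₁ b₂ = _ , b₂ , (λ i∈ → there (there i∈)) , inj₁ (there (here refl)) , inj₁ (here refl)
        ...   | inj₂ (j , b₂) = _ , b₂ , (λ i∈ → there (there i∈)) , inj₁ (there (here refl)) , inj₂ (j , here refl)
        decide (k , φ , e) l b | inj₂ b₁ with big-wit b₁ k φ e
        ...   | inj₁ b₂ = _ , b₂ , (λ i∈ → there (there i∈)) , inj₂ (there (here refl)) , inj₁ (here refl)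
        ...   | inj₂ (j , b₂) = _ , b₂ , (λ i∈ → there (there i∈)) , inj₂ (there (here refl)) , inj₂ (j , here refl)

        U-dense : ∀ n p → Σ Q λ q → (p ≼ q) × U n q
        U-dense n (l , b) with decide (proj₁ (enum-Inst enumLb) n) l b
        ... | l₁ , b₁ , s₁ , d with T-dense n l₁ b₁
        ...   | l₂ , b₂ , s₂ , t = (l₂ , b₂) , (λ i∈ → s₂ (s₁ i∈)) , up⊎ s₂ _ d , t

        U-up : ∀ n p q → p ≼ q → U n p → U n q
        U-up n p q s (d , t) = up⊎ s _ d , T-up s t

        VQ : ℕ → Q → Q → Set
        VQ n p q = V n (proj₁ p) (proj₁ q)

        VQ-dense : ∀ n p q → Σ Q λ p' → Σ Q λ q' → (p ≼ p') × (q ≼ q') × VQ n p' q'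
        VQ-dense n (l , b) (m , c) =
          let l' , m' , b' , c' , s , t , v = V-dense n l m b c in (l' , b') , (m' , c') , s , t , v

        module F = Fusion {Q} _≼_ (λ i∈ → i∈) (λ s t i∈ → t (s i∈)) U U-up U-dense
          VQ (λ s t → V-up s t) VQ-dense (l₀ , big₀)

        at : (ℕ → Bool) → ℕ → List (Inst Lb)
        at x n = proj₁ (F.along x n)

        Gen : (ℕ → Bool) → Inst Lb → Set
        Gen x i = Σ ℕ λ n → i ∈ at x n

        collect : ∀ x l → (∀ {i} → i ∈ l → Gen x i) → Σ ℕ λ n → ∀ {i} → i ∈ l → i ∈ at x n
        collect x [] h = 0 , λ ()
        collect x (i ∷ l) h with h (here refl) | collect x l (λ i∈ → h (there i∈))
        ... | m , p | n , s = m ⊔ n , λ where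
            (here refl) → F.along-≤ x (m≤m⊔n m n) p
            (there i∈)  → F.along-≤ x (m≤n⊔m m n) (s i∈)

        when : Inst Lb → ℕ
        when i = suc (proj₁ (proj₂ (enum-Inst enumLb) i))

        decided : ∀ x k φ e → Decided (k , φ , e) (at x (when (k , φ , e)))
        decided x k φ e = let n , ≡e = proj₂ (enum-Inst enumLb) (k , φ , e) in
          subst (λ i → Decided i (at x (suc n))) ≡e (proj₁ (F.stage-U n (prefix (suc n) x)))

        Gen-Henkin : ∀ x → HenkinSet (Gen x)
        Gen-Henkin x = record { fin = fin' ; dec = dec' ; wit = wit' }
          where
          fin' : ∀ l → (∀ {i} → i ∈ l → Gen x i) → Satisfiable l
          fin' l h with collect x l h
          ... | n , s with big-sat (proj₂ (F.along x n))
          ...   | M , mod , ρ , hs = M , mod , ρ , λ i∈ → hs (s i∈)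
          dec' : ∀ k φ e → Gen x (k , φ , e) ⊎ Gen x (k , notF φ , e)
          dec' k φ e with proj₁ (decided x k φ e)
          ... | inj₁ p = inj₁ (when (k , φ , e) , p)
          ... | inj₂ p = inj₂ (when (k , φ , e) , p)
          wit' : ∀ k φ e → Gen x (k , notF (exF φ) , e) ⊎ Σ ℕ λ j → Gen x (k , φ , j ∷ e)
          wit' k φ e with proj₂ (decided x k φ e)
          ... | inj₁ p = inj₁ (when (k , φ , e) , p)
          ... | inj₂ (j , p) = inj₂ (j , when (k , φ , e) , p)

        Gen-T : ∀ x n → Σ (List (Inst Lb)) λ l → T n l × (∀ {i} → i ∈ l → Gen x i)
        Gen-T x n = _ , proj₂ (F.stage-U n (prefix (suc n) x)) , λ i∈ → suc n , i∈

        Gen-V : ∀ x y {m} → x m ≢ y m → ∀ n → m ≤ℕ n → Σ (List (Inst Lb)) λ l → Σ (List (Inst Lb)) λ l' →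
                V n l l' × (∀ {i} → i ∈ l → Gen x i) × (∀ {i} → i ∈ l' → Gen y i)
        Gen-V x y ne n m≤n = _ , _ , F.stage-V n (prefix (suc n) x) (prefix (suc n) y) (prefix-≢ {x} {y} ne
                (s≤s m≤n)) ,
          (λ i∈ → suc n , i∈) , (λ i∈ → suc n , i∈)

      abstract
        family : GenericFamily T V
        family = record { Gen = Gen ; Gen-Henkin = Gen-Henkin ; Gen-T = Gen-T ; Gen-V = Gen-V }

-- Countable ordinals

-- Ordinals are compared by rank; one rank has many notations, and no choice of canonical
-- notations is available, so every construction indexed by them must respect _≈o_.
data Ord : Set where
  zero : Ord
  sup  : (ℕ → Ord) → Ord

infix 4 _≤o_ _<o_ _≈o_

mutual
  -- `sup f` is the least ordinal strictly above all `f k`, so one constructor covers successors and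
  -- limits.
  _≤o_ : Ord → Ord → Set
  zero  ≤o β = ⊤
  sup f ≤o β = ∀ k → f k <o β

  _<o_ : Ord → Ord → Set
  α <o zero  = ⊥
  α <o sup g = Σ ℕ λ k → α ≤o g k

_≈o_ : Ord → Ord → Set
α ≈o β = (α ≤o β) × (β ≤o α)

≤o-refl : ∀ α → α ≤o α
≤o-refl zero    = tt
≤o-refl (sup f) = λ k → k , ≤o-refl (f k)

mutual
  ≤o-trans : ∀ α β γ → α ≤o β → β ≤o γ → α ≤o γ
  ≤o-trans zero    β γ p q = tt
  ≤o-trans (sup f) β γ p q = λ k → <-≤-transo (f k) β γ (p k) q

  <-≤-transo : ∀ α β γ → α <o β → β ≤o γ → α <o γ
  <-≤-transo α (sup g) γ (k , p) q = ≤-<-transo α (g k) γ p (q k)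

  ≤-<-transo : ∀ α β γ → α ≤o β → β <o γ → α <o γ
  ≤-<-transo α β (sup h) p (k , q) = k , ≤o-trans α β (h k) p q

<o⇒≤o : ∀ α β → α <o β → α ≤o β
<o⇒≤o zero    β       p       = tt
<o⇒≤o (sup f) (sup g) (k , p) = λ j → k , <o⇒≤o (f j) (g k) (p j)

≤o⇒Acc : ∀ α β → β ≤o α → Acc _<o_ β
≤o⇒Acc zero    β p = acc λ {γ} γ<β → ⊥-elim (<-≤-transo γ β zero γ<β p)
≤o⇒Acc (sup f) β p = acc λ {γ} γ<β → let k , q = <-≤-transo γ β (sup f) γ<β p in ≤o⇒Acc (f k) γ q

<o-acc : ∀ α → Acc _<o_ α
<o-acc α = ≤o⇒Acc α α (≤o-refl α)

≈o-refl : ∀ α → α ≈o α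
≈o-refl α = ≤o-refl α , ≤o-refl α

≈o-sym : ∀ {α β} → α ≈o β → β ≈o α
≈o-sym (p , q) = q , p

-- The subterms of a notation. Up to rank they exhaust the ordinals at most `α`, which expresses the
-- countability of an initial segment.
names : Ord → ℕ → Ord
names zero    _       = zero
names (sup f) zero    = sup f
names (sup f) (suc n) = names (f (proj₁ (unpair n))) (proj₂ (unpair n))

names-≤ : ∀ α n → names α n ≤o α
names-≤ zero    n       = tt
names-≤ (sup f) zero    = ≤o-refl (sup f)
names-≤ (sup f) (suc n) = <o⇒≤o _ (sup f) (proj₁ (unpair n) , names-≤ (f (proj₁ (unpair n))) (proj₂ (unpair n)))

-- The Scott hierarchy of pointed models.

module Levels (em : ExcludedMiddle 0ℓ) (X : Structure) where

  open Henkin em public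

  mutual
    ≰o⇒> : ∀ α β → ¬ (α ≤o β) → β <o α
    ≰o⇒> zero    β n = ⊥-elim (n tt)
    ≰o⇒> (sup f) β n = let k , m = ¬∀⇒∃¬ n in k , ≮o⇒≥ (f k) β m

    ≮o⇒≥ : ∀ α β → ¬ (α <o β) → β ≤o α
    ≮o⇒≥ α zero    n = tt
    ≮o⇒≥ α (sup g) n = λ k → ≰o⇒> α (g k) (λ p → n (k , p))

  names-onto : ∀ α β → β ≤o α → Σ ℕ λ n → β ≈o names α n
  names-onto zero β p = 0 , p , tt
  names-onto (sup f) β p with em {sup f ≤o β}
  ... | yes q = 0 , p , q
  ... | no nq with ≰o⇒> (sup f) β nq
  ...   | k , r with names-onto (f k) β r
  ...     | n , h = suc (pair k n) , subst (λ z → β ≈o names (f (proj₁ z)) (proj₂ z)) (sym (unpair-pair k n)) h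

  Pt : Set
  Pt = Σ Cod λ M → List ∣ M ∣

  Mod : Cod → Set
  Mod M = ModelOfTh X ⟦ M ⟧

  -- E α is elementary equivalence of pointed structures for formulas that may mention one
  -- class of a lower level E β: a coarse form of the Scott hierarchy.
  mutual
    E : Ord → Pt → Pt → Set
    E zero    v w = ⊤
    E (sup f) v w = ∀ k → E (f k) v w × Agr (f k) v w

    Agr : Ord → Pt → Pt → Set
    Agr β v w = ∀ (c : Pt) → Mod (proj₁ c) → ∀ φ → satL β c v φ ⇔ satL β c w φ

    satL : Ord → Pt → Pt → Fm → Set
    satL β c (M , u) φ = sat ⟦ M ⟧ (λ u' → E β (M , u') c) u φ

  E-refl : ∀ α v → E α v v
  E-refl zero    v = tt
  E-refl (sup f) v = λ k → E-refl (f k) v , λ c _ φ → ⇔-refl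

  E-sym : ∀ α {v w} → E α v w → E α w v
  E-sym zero    h = tt
  E-sym (sup f) h = λ k → E-sym (f k) (proj₁ (h k)) , λ c m φ → ⇔-sym (proj₂ (h k) c m φ)

  E-trans : ∀ α {v w x} → E α v w → E α w x → E α v x
  E-trans zero    h h' = tt
  E-trans (sup f) h h' = λ k → E-trans (f k) (proj₁ (h k)) (proj₁ (h' k)) ,
                               λ c m φ → ⇔-trans (proj₂ (h k) c m φ) (proj₂ (h' k) c m φ)

  satL-cong : ∀ {β β' c c'} → (∀ v → E β v c ⇔ E β' v c') → ∀ v φ → satL β c v φ ⇔ satL β' c' v φ
  satL-cong h (M , u) φ = sat-cong ⟦ M ⟧ (λ u' → h (M , u')) φ u

  E-iso : ∀ α {M N} (e : ⟦ M ⟧ ≃ ⟦ N ⟧) u → E α (M , u) (N , map (to e) u)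
  E-iso zero    e u = tt
  E-iso (sup f) e u = λ k → E-iso (f k) e u , λ c _ φ → sat-iso e (λ u' → mk⇔
    (λ h → E-trans (f k) (E-sym (f k) (E-iso (f k) e u')) h) (λ h → E-trans (f k) (E-iso (f k) e u') h)) φ u

  mutual
    E-≤ : ∀ α β → α ≤o β → ∀ {v w} → E β v w → E α v w
    E-≤ zero    β p h = tt
    E-≤ (sup f) β p h = λ k → E-≤ (f k) β (<o⇒≤o (f k) β (p k)) h , E-<-Agr (f k) β (p k) h

    -- Let `α` be at most `g j`. If the ranks agree, labels at `α` and at `g j` are the same
    -- predicates; if `α` is smaller, `E (g j)` alone already decides the formulas.
    E-<-Agr : ∀ α β → α <o β → ∀ {v w} → E β v w → Agr α v w
    E-<-Agr α (sup g) (j , p) {v} {w} h c m φ with em {g j ≤o α}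
    ... | yes q = ⇔-trans (satL-cong ch v φ) (⇔-trans (proj₂ (h j) c m φ) (⇔-sym (satL-cong ch w φ)))
      where
      ch : ∀ x → E α x c ⇔ E (g j) x c
      ch x = mk⇔ (E-≤ (g j) α q) (E-≤ α (g j) p)
    ... | no nq = E-<-Agr α (g j) (≰o⇒> (g j) α nq) (proj₁ (h j)) c m φ

  E-≈ : ∀ {α β} → α ≈o β → ∀ {v w} → E α v w ⇔ E β v w
  E-≈ {α} {β} (p , q) = mk⇔ (E-≤ β α q) (E-≤ α β p)

  separate : ∀ α {v w} → ¬ E α v w →
             Σ Ord λ β → (β <o α) × Σ Pt λ c → Mod (proj₁ c) × Σ Fm λ φ → ¬ (satL β c v φ ⇔ satL β c w φ)
  separate zero    n = ⊥-elim (n tt)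
  separate (sup f) {v} {w} n with ¬∀⇒∃¬ n
  ... | k , nk with em {E (f k) v w}
  ...   | no ne = let β , p , rest = separate (f k) ne in β , (k , <o⇒≤o β (f k) p) , rest
  ...   | yes e with ¬∀⇒∃¬ (λ a → nk (e , a))
  ...     | c , nc with ¬∀⇒∃¬ nc
  ...       | m , nm with ¬∀⇒∃¬ nm
  ...         | φ , nφ = f k , (k , ≤o-refl (f k)) , c , m , φ , nφ

  -- Distinctness is stated pointwise, the form in which genericity yields it.
  Perfect : Set
  Perfect = Σ ((ℕ → Bool) → Cod) λ p → (∀ x → Mod (p x)) × (∀ x y → ⟦ p x ⟧ ≃ ⟦ p y ⟧ → ∀ n → x n ≡ y n)

  Countable : Ord → Set
  Countable β = Σ (ℕ → Pt) λ enum → (∀ n → Mod (proj₁ (enum n))) × (∀ v → Mod (proj₁ v) → Σ ℕ λ n → E β v (enum n))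

  module Labelled (f : ℕ → Ord) (cnt : ∀ k n → Countable (names (f k) n)) where

    abstract
      -- An index codes a triple: two components select an ordinal `names (f k) n` below `sup f`,
      -- the third a class on that level. Countability of the lower levels is what lets natural
      -- numbers name all predicates.
      level : ℕ → Ord
      level i = let k , r = unpair i ; n , j = unpair r in names (f k) n

      class : ℕ → Pt
      class i = let k , r = unpair i ; n , j = unpair r in proj₁ (cnt k n) j

      class-Mod : ∀ i → Mod (proj₁ (class i))
      class-Mod i = let k , r = unpair i ; n , j = unpair r in proj₁ (proj₂ (cnt k n)) j

      level-< : ∀ i → level i <o sup f
      level-< i = let k , r = unpair i ; n , j = unpair r in k , names-≤ (f k) n

      cover : ∀ β → β <o sup f → ∀ c → Mod (proj₁ c) → Σ ℕ λ i → (β ≈o level i) × E β c (class i)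
      cover β (k , p) c m with names-onto (f k) β p
      ... | n , β≈ with proj₂ (proj₂ (cnt k n)) c m
      ...   | j , e = pair k (pair n j) ,
        subst (λ z → (β ≈o names (f (proj₁ z)) (proj₁ (unpair (proj₂ z)))) ×
                E β c (proj₁ (cnt (proj₁ z) (proj₁ (unpair (proj₂ z)))) (proj₂ (unpair (proj₂ z)))))
          (sym (unpair-pair k (pair n j)))
          (subst (λ z → (β ≈o names (f k) (proj₁ z)) × E β c (proj₁ (cnt k (proj₁ z)) (proj₂ z)))
            (sym (unpair-pair n j)) (β≈ , bwd (E-≈ β≈) e))

    K : ℕ → (M : Cod) → List ∣ M ∣ → Set
    K i M u = E (level i) (M , u) (class i)

    cover-⇔ : ∀ {β c i} → β ≈o level i → E β c (class i) → ∀ v → E β v c ⇔ E (level i) v (class i)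
    cover-⇔ {β} {c} {i} β≈ e v = mk⇔ (λ h → fwd (E-≈ β≈) (E-trans β h e))
                                     (λ h → E-trans β (bwd (E-≈ β≈) h) (E-sym β e))

    module Trivial (v₀ : Pt) (m₀ : Mod (proj₁ v₀)) where

      abstract
        -- `E zero` relates all points, so a class of rank zero supplies the always true predicate
        -- `k₀`.
        trivial : Σ ℕ λ i → ∀ M u → K i M u
        trivial = let i , z≈ , _ = cover zero (0 , tt) v₀ m₀ in i , λ M u → fwd (E-≈ z≈ {M , u} {class i}) tt

      open Theory X K (proj₁ trivial) (proj₂ trivial) public hiding (Mod)

      -- Basic open sets of a topology on tuples: the constants below `n` name the tuple `u`, the
      -- remaining ones act as existentially quantified variables.
      Open : ℕ → List (Inst ℕ) → Pt → Set
      Open n l (M , u) = Σ (ℕ → ∣ M ∣) λ ρ → (map ρ (upTo n) ≡ u) × Holds M ρ l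

  -- Perfect sets of models from sets of points without isolated classes.

  module DenseInItself (f : ℕ → Ord) (cnt : ∀ k n → Countable (names (f k) n))
    (n : ℕ) (W : Pt → Set) (W-Mod : ∀ {v} → W v → Mod (proj₁ v)) (v₀ : Pt) (w₀ : W v₀) where

    open Labelled f cnt
    open Trivial v₀ (W-Mod w₀)

    module _ (open₀ : Open n [] v₀)
      (dense : ∀ v l → W v → Open n l v → Σ Pt λ w → W w × Open n l w × ¬ E (sup f) v w) where

      private
        c̄ : List ℕ
        c̄ = upTo n

        Big : List (Inst ℕ) → Set
        Big l = Σ Pt λ v → W v × Open n l v

        consistency : Consistency Big
        consistency = record
          { big-sat = λ (v , w , ρ , _ , hs) → proj₁ v , W-Mod w , ρ , hs
          ; big-dec = dec' ; big-wit = wit' }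
          where
          dec' : ∀ {l} → Big l → ∀ k φ e → Big ((k , φ , e) ∷ l) ⊎ Big ((k , notF φ , e) ∷ l)
          dec' (v , w , ρ , ≡e , hs) k φ e with em {holds (proj₁ v) ρ (k , φ , e)}
          ... | yes h = inj₁ (v , w , ρ , ≡e , Holds-∷ h hs)
          ... | no nh = inj₂ (v , w , ρ , ≡e , Holds-∷ nh hs)
          wit' : ∀ {l} → Big l → ∀ k φ e → Big ((k , notF (exF φ) , e) ∷ l) ⊎ Σ ℕ λ j → Big ((k , φ , j ∷ e) ∷ l)
          wit' (v , w , ρ , ≡e , hs) k φ e with em {holds (proj₁ v) ρ (k , exF φ , e)}
          ... | no nh = inj₁ (v , w , ρ , ≡e , Holds-∷ nh hs)
          ... | yes (a , s) = let ρ' , hs' , ≡e' = fresh-witness hs c̄ k φ e a s in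
                  inj₂ (_ , v , w , ρ' , trans ≡e' ≡e , hs')

        lists : Enum (List ℕ)
        lists = enum-List enum-ℕ

        atoms : Enum (ℕ × List ℕ)
        atoms = enum-× enum-ℕ lists

        -- On every level each tuple has to be put into a named class. Otherwise a generic set could
        -- deny every class to a tuple, although in the term model the tuple lies in one.
        Labels : ℕ × List ℕ → List (Inst ℕ) → Set
        Labels (i , e) l = Σ ℕ λ i' → (level i ≈o level i') × ((i' , labF , e) ∈ l)

        T : ℕ → List (Inst ℕ) → Set
        T m = Labels (proj₁ atoms m)

        Labels-dense : ∀ a l → Big l → Σ (List (Inst ℕ)) λ l' → Big l' × (∀ {i} → i ∈ l → i ∈ l') × Labels a l'
        Labels-dense (i , e) l (v , w , ρ , ≡e , hs) with cover (level i) (level-< i) (proj₁ v , map ρ e) (W-Mod w)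
        ... | i' , ≈l , h = _ , (v , w , ρ , ≡e , Holds-∷ {i = i' , labF , e} (fwd (E-≈ ≈l) h) hs) , (λ i∈ →
                there i∈) , i' , ≈l , here refl

        -- The formula holds of `e` on the side of `l` and fails for the distinguished tuple on the
        -- side of `l'`, so no isomorphism matches these tuples.
        Separated : List ℕ → List (Inst ℕ) → List (Inst ℕ) → Set
        Separated e l l' = Σ ℕ λ i → Σ Fm λ ψ → ((i , ψ , e) ∈ l) × ((i , notF ψ , c̄) ∈ l')

        -- Only the first component of the index is used, so every tuple recurs at arbitrarily large
        -- indices.
        V : ℕ → List (Inst ℕ) → List (Inst ℕ) → Set
        V m = Separated (proj₁ lists (proj₁ (unpair m)))

        Extension : ℕ → List (Inst ℕ) → List (Inst ℕ) → Set
        Extension m l l' = Σ (List (Inst ℕ)) λ k → Σ (List (Inst ℕ)) λ k' →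
          Big k × Big k' × (∀ {i} → i ∈ l → i ∈ k) × (∀ {i} → i ∈ l' → i ∈ k') × V m k k'

        V-dense : ∀ m l l' → Big l → Big l' → Extension m l l'
        V-dense m l l' (v , w , ρ , ≡e , hs) (v' , w' , o') = pick (other (em {E (sup f) s v'}))
          where
          e = proj₁ lists (proj₁ (unpair m))
          s : Pt
          s = proj₁ v , map ρ e
          -- If `v'` lies in the class of `s`, density provides a point of another class in the same
          -- open set.
          other : Dec (E (sup f) s v') → Σ Pt λ x → W x × Open n l' x × ¬ E (sup f) s x
          other (no ne) = v' , w' , o' , ne
          other (yes h) = let x , wx , ox , nx = dense v' l' w' o' in
            x , wx , ox , λ h' → nx (E-trans (sup f) (E-sym (sup f) h) h')
          pick : (Σ Pt λ x → W x × Open n l' x × ¬ E (sup f) s x) → Extension m l l'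
          pick ((M' , u') , wx , (ρ' , ≡e' , hs') , nx) with separate (sup f) nx
          ... | β , β< , c , mc , φ , nφ with cover β β< c mc
          ...   | i , β≈ , ec with ¬⇔ (λ q → nφ (⇔-trans (satL-cong (cover-⇔ {β} {c} {i} β≈ ec) s φ)
                                        (⇔-trans q (⇔-sym (satL-cong (cover-⇔ {β} {c} {i} β≈ ec) (M' , u') φ)))))
          ...     | inj₁ (y , ny) = _ , _ , (v , w , ρ , ≡e , Holds-∷ {i = i , φ , e} y hs) ,
                    ((M' , u') , wx , ρ' , ≡e' , Holds-∷ {i = i , notF φ , c̄} (subst (λ z →
                            ¬ sat ⟦ M' ⟧ (K i M') z φ) (sym ≡e') ny) hs') ,
                    (λ i∈ → there i∈) , (λ i∈ → there i∈) , i , φ , here refl , here refl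
          ...     | inj₂ (ny , y) = _ , _ , (v , w , ρ , ≡e , Holds-∷ {i = i , notF φ , e} ny hs) ,
                    ((M' , u') , wx , ρ' , ≡e' , Holds-∷ {i = i , notF (notF φ) , c̄} (λ n' → n' (subst (λ z →
                            sat ⟦ M' ⟧ (K i M') z φ) (sym ≡e') y)) hs') ,
                    (λ i∈ → there i∈) , (λ i∈ → there i∈) , i , notF φ , here refl , here refl

        family : GenericFamily T V
        family = Generic.family enum-ℕ consistency T
          (λ s (i , p , m) → i , p , s m) (λ m → Labels-dense (proj₁ atoms m)) V
          (λ s t (i , ψ , p , q) → i , ψ , s p , t q) V-dense [] (v₀ , w₀ , open₀)

        abstract
          Gen : (ℕ → Bool) → Inst ℕ → Set
          Gen = GenericFamily.Gen family

          Gen-Henkin : ∀ x → HenkinSet (Gen x)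
          Gen-Henkin = GenericFamily.Gen-Henkin family

          labelled : ∀ x i e → Σ ℕ λ i' → (level i ≈o level i') × Gen x (i' , labF , e)
          labelled x i e with proj₂ atoms (i , e)
          ... | m , ≡e with GenericFamily.Gen-T family x m
          ...   | l , t , s with subst (λ a → Labels a l) ≡e t
          ...     | i' , ≈l , i∈ = i' , ≈l , s i∈

          separated : ∀ x y {m} → x m ≢ y m → ∀ e → Σ ℕ λ i → Σ Fm λ ψ → Gen x (i , ψ , e) × Gen y (i , notF ψ , c̄)
          separated x y {m} ne e with GenericFamily.Gen-V family x y ne (pair (proj₁ (proj₂ lists e)) m)
                  (pair-≥ (proj₁ (proj₂ lists e)) m)
          ... | l , l' , (i , ψ , p , q) , l⊆ , l'⊆ = i , ψ , subst (λ z → Gen x (i , ψ , z)) idx (l⊆ p) , l'⊆ q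
            where
            idx : proj₁ lists (proj₁ (unpair (pair (proj₁ (proj₂ lists e)) m))) ≡ e
            idx = trans (cong (λ z → proj₁ lists (proj₁ z)) (unpair-pair (proj₁ (proj₂ lists e)) m)) (proj₂
                    (proj₂ lists e))

        module L (x : ℕ → Bool) = TermModel (Gen-Henkin x)

        -- By induction on the rank of `level i`. A class fixes, uniformly in all models, the truth
        -- of every formula whose label has lower rank. A label in `Gen x` therefore forces these
        -- formulas into `Gen x`, and the truth lemma for lower ranks makes them hold in the term
        -- model, which puts the tuple into the class.
        lab-truth : ∀ x i → Acc _<o_ (level i) → ∀ e → K i (L.L x) (map (L.rep x) e) ⇔ Gen x (i , labF , e)
        lab-truth x i (acc rs) e = mk⇔ complete (λ g → sound i (≈o-refl (level i)) g (level i) (≤o-refl (level i)))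
          where
          open L x using (rep; truthLemma; entails₁; consistent) renaming (L to N)
          open HenkinSet (Gen-Henkin x)
          Gx = Gen x
          -- The label `j` stays fixed while `β` descends, since the tuple has to match `class j` at
          -- every rank up to its own.
          sound : ∀ j → level i ≈o level j → Gx (j , labF , e) → ∀ β → β ≤o level j → E β (N , map rep e) (class j)
          sound j i≈j g zero p = tt
          sound j i≈j g (sup h) p k = sound j i≈j g (h k) (<o⇒≤o (h k) (level j) (p k)) , agr
            where
            hk<i : h k <o level i
            hk<i = <-≤-transo (h k) (level j) (level i) (p k) (proj₂ i≈j)
            agr : Agr (h k) (N , map rep e) (class j)
            agr c mc φ with cover (h k) (<-≤-transo (h k) (level j) (sup f) (p k) (<o⇒≤o (level j) (sup f)
                    (level-< j))) c mc
            ... | i' , ≈l , ec = ⇔-trans (satL-cong ch (N , map rep e) φ)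
                  (⇔-trans (truthLemma i' (lab-truth x i' (rs (≤-<-transo (level i') (h k) (level i) (proj₂ ≈l)
                          hk<i))) φ e)
                    (mk⇔ one two))
              where
              ch : ∀ v → E (h k) v c ⇔ E (level i') v (class i')
              ch = cover-⇔ {h k} {c} {i'} ≈l ec
              transfer : ∀ M (ρ : ℕ → ∣ M ∣) → holds M ρ (j , labF , e) → holds M ρ (i' , φ ,
                      e) ⇔ satL (h k) c (class j) φ
              transfer M ρ hl = ⇔-trans (⇔-sym (satL-cong ch (M ,
                      map ρ e) φ)) (E-<-Agr (h k) (level j) (p k) hl c mc φ)
              one : Gx (i' , φ , e) → satL (h k) c (class j) φ
              one g' = let M , _ , ρ , hs = fin ((j , labF , e) ∷ (i' , φ , e) ∷ [])
                                             (λ { (here refl) → g ; (there (here refl)) → g' }) in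
                fwd (transfer M ρ (hs (here refl))) (hs (there (here refl)))
              two : satL (h k) c (class j) φ → Gx (i' , φ , e)
              two s = entails₁ (j , labF , e) g i' φ e (λ M ρ _ hl → bwd (transfer M ρ hl) s)
          -- If the label were denied, some class `j` of the same rank would be asserted. Soundness
          -- makes `class i` and `class j` equivalent, and a model of both conditions is
          -- contradictory.
          complete : K i N (map rep e) → Gx (i , labF , e)
          complete h with dec i labF e
          ... | inj₁ g = g
          ... | inj₂ g' with labelled x i e
          ...   | j , i≈j , g with fin ((j , labF , e) ∷ (i , notF labF , e) ∷ [])
                                   (λ { (here refl) → g ; (there (here refl)) → g' })
          ...     | M , _ , ρ , hs = ⊥-elim (hs (there (here refl))
                    (E-trans (level i) (bwd (E-≈ i≈j) (hs (here refl)))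
                      (E-trans (level i) (E-sym (level i) (bwd (E-≈ i≈j) (sound j i≈j g (level j) (≤o-refl
                              (level j))))) h)))

        L-truth : ∀ x i φ e → sat ⟦ L.L x ⟧ (K i (L.L x)) (map (L.rep x) e) φ ⇔ Gen x (i , φ , e)
        L-truth x i φ e = L.truthLemma x i (lab-truth x i (<o-acc (level i))) φ e

        image : ∀ x y → ⟦ L.L x ⟧ ≃ ⟦ L.L y ⟧ → List ℕ
        image x y h = map (λ j → proj₁ (to h (L.rep x j))) c̄

        image-rep : ∀ x y h → map (L.rep y) (image x y h) ≡ map (to h) (map (L.rep x) c̄)
        image-rep x y h = trans (sym (map-∘ c̄)) (trans (map-cong (λ j →
                L.rep-onto y (to h (L.rep x j))) c̄) (map-∘ c̄))

        K-iso : ∀ i {M N} (h : ⟦ M ⟧ ≃ ⟦ N ⟧) u → K i M u ⇔ K i N (map (to h) u)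
        K-iso i h u = mk⇔ (E-trans (level i) (E-sym (level i) (E-iso (level i) h u))) (E-trans (level i) (E-iso
                (level i) h u))

        not-isomorphic : ∀ x y (h : ⟦ L.L x ⟧ ≃ ⟦ L.L y ⟧) i ψ →
                         Gen y (i , ψ , image x y h) → Gen x (i , notF ψ , c̄) → ⊥
        not-isomorphic x y h i ψ p q = bwd (L-truth x i (notF ψ) c̄) q
          (bwd (sat-iso h (K-iso i h) ψ (map (L.rep x) c̄))
            (subst (λ z → sat ⟦ L.L y ⟧ (K i (L.L y)) z ψ) (image-rep x y h) (bwd (L-truth y i ψ (image x y h)) p)))

        distinct : ∀ x y → ⟦ L.L x ⟧ ≃ ⟦ L.L y ⟧ → ∀ m → x m ≡ y m
        distinct x y h m = by-contradiction λ ne →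
          let i , ψ , p , q = separated y x {m} (ne ∘ sym) (image x y h) in not-isomorphic x y h i ψ p q

      perfect : Perfect
      perfect = L.L , L.L-Mod , distinct

-- Without a perfect set: countable levels and isolated classes.

assign : {A : Set} → A → List A → ℕ → A
assign d u i = fromMaybe d (nth u i)

map-assign : {A : Set} (d : A) (u : List A) → map (assign d u) (upTo (length u)) ≡ u
map-assign d u = trans (map-applyUpTo id (assign d u) (length u)) (go u)
  where
  go : ∀ u → applyUpTo (assign d u) (length u) ≡ u
  go []      = refl
  go (x ∷ u) = cong (x ∷_) (go u)

module Scattered (em : ExcludedMiddle 0ℓ) (X : Structure) (x₀ : Carrier X) where

  open Levels em X public

  Mod-inhabited : ∀ {M} → Mod M → ∣ M ∣
  Mod-inhabited mod = proj₁ (bwd (mod (∃f ⊤f)) (x₀ , tt))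

  -- An index for a class depends on an arbitrary enumeration. An ordinal with a point can instead
  -- be compared up to rank and equivalence, as a canonical choice demands.
  Named : Set
  Named = (Fm × List ℕ) × (Ord × Pt)

  NamedOpen : ℕ → List Named → Pt → Set
  NamedOpen n l (M , u) = Σ (ℕ → ∣ M ∣) λ ρ → (map ρ (upTo n) ≡ u) ×
    (∀ {φ e β c} → ((φ , e) , (β , c)) ∈ l → satL β c (M , map ρ e) φ)

  Below : Ord → Named → Set
  Below α (_ , (β , c)) = (β <o α) × Mod (proj₁ c)

  Isolates : Ord → (Pt → Set) → ℕ → List Named → Set
  Isolates α P n l = (Σ Pt λ v → P v × NamedOpen n l v) ×
                     (∀ v w → P v → NamedOpen n l v → P w → NamedOpen n l w → E α v w)

  module _ (not-perfect : ¬ Perfect) (v₀ : Pt) (m₀ : Mod (proj₁ v₀)) where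

    CountableOn : Ord → (Pt → Set) → Set
    CountableOn α Q = Σ (ℕ → Pt) λ enum → (∀ n → Mod (proj₁ (enum n))) ×
                        (∀ v → Mod (proj₁ v) → Q v → Σ ℕ λ n → E α v (enum n))

    union : ∀ {α} (Q : ℕ → Pt → Set) → (∀ n → CountableOn α (Q n)) → CountableOn α (λ v → Σ ℕ λ n → Q n v)
    union {α} Q c = (λ m → proj₁ (c (proj₁ (unpair m))) (proj₂ (unpair m))) ,
      (λ m → proj₁ (proj₂ (c (proj₁ (unpair m)))) (proj₂ (unpair m))) ,
      λ v mod (n , q) → let j , e = proj₂ (proj₂ (c n)) v mod q in
        pair n j , subst (λ z → E α v (proj₁ (c (proj₁ z)) (proj₂ z))) (sym (unpair-pair n j)) e

    insert : ∀ {α Q} w → Mod (proj₁ w) → CountableOn α Q → CountableOn α (λ v → E α v w ⊎ Q v)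
    insert {α} {Q} w mw (enum , mods , h) = enum' , mods' , h'
      where
      enum' : ℕ → Pt
      enum' zero    = w
      enum' (suc n) = enum n
      mods' : ∀ n → Mod (proj₁ (enum' n))
      mods' zero    = mw
      mods' (suc n) = mods n
      h' : ∀ v → Mod (proj₁ v) → E α v w ⊎ Q v → Σ ℕ λ n → E α v (enum' n)
      h' v mod (inj₁ e) = 0 , e
      h' v mod (inj₂ q) = let n , e = h v mod q in suc n , e

    module Step (f : ℕ → Ord) (cnt : ∀ k n → Countable (names (f k) n)) where

      open Labelled f cnt public
      open Trivial v₀ m₀ public using (Open)

      α = sup f

      open-[] : ∀ v → Mod (proj₁ v) → Open (length (proj₂ v)) [] v
      open-[] (M , u) mod = assign (Mod-inhabited mod) u , map-assign _ u , λ ()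

      dense⇒⊥ : ∀ n (W : Pt → Set) → (∀ {v} → W v → Mod (proj₁ v)) → ∀ v → W v → Open n [] v →
                (∀ v l → W v → Open n l v → Σ Pt λ w → W w × Open n l w × ¬ E α v w) → ⊥
      dense⇒⊥ n W W-Mod v w o dense = not-perfect (DenseInItself.perfect f cnt n W W-Mod v w o dense)

      conditions : Enum (List (Inst ℕ))
      conditions = enum-List (enum-Inst enum-ℕ)

      module _ (n : ℕ) where

        Small : List (Inst ℕ) → Set
        Small l = CountableOn α (Open n l)

        Condensation : Pt → Set
        Condensation v = Mod (proj₁ v) × (∀ l → Open n l v → ¬ Small l)

        smallPart : CountableOn α (λ v → Σ (List (Inst ℕ)) λ l → Open n l v × Small l)
        smallPart = let en , mods , h = union Q each in en , mods , λ v mod (l , o , s) →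
            let m , ≡e = proj₂ conditions l in h v mod (m , subst (λ z → Open n z v × Small z) (sym ≡e) (o , s))
          where
          Q : ℕ → Pt → Set
          Q m v = Open n (proj₁ conditions m) v × Small (proj₁ conditions m)
          each : ∀ m → CountableOn α (Q m)
          each m with em {Small (proj₁ conditions m)}
          ... | yes (en , mods , h) = en , mods , λ v mod (o , _) → h v mod o
          ... | no ns = (λ _ → v₀) , (λ _ → m₀) , λ v mod (_ , s) → ⊥-elim (ns s)

        -- The Cantor-Bendixson argument: if all condensation points of the open set were equivalent
        -- to `w`, the other points would lie in the countable union of small open sets, and the set
        -- would be small. So no class of condensation points is isolated.
        condensation : ∀ l w → Mod (proj₁ w) → ¬ Small l → Σ Pt λ v → Condensation v × Open n l v × ¬ E α w v
        condensation l w mw ns = by-contradiction λ none' → ns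
          (let en , mods , h = insert w mw smallPart in en , mods , λ v mod o → h v mod (classify none' v mod o))
          where
          classify : ¬ (Σ Pt λ v → Condensation v × Open n l v × ¬ E α w v) → ∀ v → Mod (proj₁ v) → Open n l v →
                     E α v w ⊎ Σ (List (Inst ℕ)) λ l → Open n l v × Small l
          classify none' v mod o with em {Σ (List (Inst ℕ)) λ l → Open n l v × Small l}
          ... | yes s = inj₂ s
          ... | no nos = inj₁ (E-sym α (by-contradiction λ ne → none' (v , (mod , λ l' o' s → nos (l' , o' ,
                  s)) , o , ne)))

        length-countable : Small []
        length-countable = by-contradiction λ ns →
          let v , w , o , _ = condensation [] v₀ m₀ ns in
          dense⇒⊥ n Condensation proj₁ v w o (λ v l w o → condensation l v (proj₁ w) (proj₂ w l o))

      step-countable : Countable α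
      step-countable = let en , mods , h = union (λ n → Open n []) length-countable in
        en , mods , λ v mod → h v mod (_ , open-[] v mod)

    countable-acc : ∀ α → Acc _<o_ α → Countable α
    countable-acc zero    _        = (λ _ → v₀) , (λ _ → m₀) , λ _ _ → 0 , tt
    countable-acc (sup f) (acc rs) = Step.step-countable f (λ k n → countable-acc (names (f k) n) (rs (k ,
            names-≤ (f k) n)))

    abstract
      countable : ∀ α → Countable α
      countable α = countable-acc α (<o-acc α)

    -- If no name isolates a class of `P`, then `P` is dense in itself in the sense used above and
    -- yields a perfect set of models.
    isolated : ∀ α (P : Pt → Set) → (∀ {v} → P v → Mod (proj₁ v)) → ∀ v → P v →
               Σ ℕ λ n → Σ (List Named) λ l → (∀ {i} → i ∈ l → Below α i) × Isolates α P n l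
    isolated zero P P-Mod v p = length (proj₂ v) , [] , (λ ()) ,
      (v , p , assign (Mod-inhabited (P-Mod p)) (proj₂ v) , map-assign _ _ , λ ()) , λ _ _ _ _ _ _ → tt
    isolated (sup f) P P-Mod v p = by-contradiction λ none' →
      dense⇒⊥ n P P-Mod v p (open-[] v (P-Mod p)) (dense none')
      where
      n = length (proj₂ v)
      open Step f (λ k n → countable (names (f k) n))
      name : Inst ℕ → Named
      name (i , φ , e) = (φ , e) , (level i , class i)
      named : ∀ {l w} → Open n l w → NamedOpen n (map name l) w
      named {l} (ρ , ≡e , hs) = ρ , ≡e , λ i∈ → go (∈-map⁻ name i∈)
        where
        go : ∀ {φ e β c} → (Σ (Inst ℕ) λ i → (i ∈ l) × (((φ , e) , (β , c)) ≡ name i)) → satL β c (_ , map ρ e) φ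
        go (i , i∈ , refl) = hs i∈
      unnamed : ∀ {l w} → NamedOpen n (map name l) w → Open n l w
      unnamed (ρ , ≡e , hs) = ρ , ≡e , λ i∈ → hs (∈-map⁺ name i∈)
      below : ∀ l {i} → i ∈ map name l → Below (sup f) i
      below l i∈ with ∈-map⁻ name i∈
      ... | (j , _) , _ , refl = level-< j , class-Mod j
      dense : ¬ (Σ ℕ λ n → Σ (List Named) λ l → (∀ {i} → i ∈ l → Below (sup f) i) × Isolates (sup f) P n l) →
              ∀ v l → P v → Open n l v → Σ Pt λ w → P w × Open n l w × ¬ E (sup f) v w
      dense none' v l p o = by-contradiction λ no-other → none' (n , map name l , below l , (v , p , named o) ,
        λ w w' q o' q' o'' → E-trans (sup f) (E-sym (sup f) (near no-other w q (unnamed o'))) (near no-other w'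
                q' (unnamed o'')))
        where
        near : ¬ (Σ Pt λ w → P w × Open n l w × ¬ E (sup f) v w) → ∀ w → P w → Open n l w → E (sup f) v w
        near no-other w q o' = by-contradiction λ ne → no-other (w , q , o' , ne)

-- Extensional choice

-- A raw chooser refines a predicate to one equivalence class of it.  What matters is that
-- the class depends on the predicate only up to logical equivalence (Ext).
Raw : Set → Set₁
Raw A = (A → Set) → A → Set

record Chooser {A : Set} (S : A → Set) (_≈_ : A → A → Set) (γ : Raw A) : Set₁ where
  field
    sub  : ∀ {P a} → γ P a → P a
    pick : ∀ P → (∀ {a} → P a → S a) → ∀ a → P a → Σ A (γ P)
    uniq : ∀ P → (∀ {a} → P a → S a) → ∀ {a b} → γ P a → γ P b → a ≈ b

Ext : {A : Set} → (A → Set) → Raw A → Raw A → Set₁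
Ext S γ γ' = ∀ P P' → (∀ {a} → P a → S a) → (∀ a → P a ⇔ P' a) → ∀ {a} → γ P a → γ' P' a

module _ {A B : Set} where

  fstP : (A × B → Set) → A → Set
  fstP P a = Σ B λ b → P (a , b)

  -- The first coordinate is known only up to its class, so the partners of all members of the
  -- chosen class are gathered.
  sndP : Raw A → (A × B → Set) → B → Set
  sndP γ P b = Σ A λ a → γ (fstP P) a × P (a , b)

  pairγ : Raw A → (A → Raw B) → Raw (A × B)
  pairγ γA γB P (a , b) = P (a , b) × γA (fstP P) a × γB a (sndP γA P) b

  pair-Chooser : ∀ {SA : A → Set} {SB : B → Set} {_≈A_ : A → A → Set} {_≈B_ : A → B → B → Set} {γA γB} →
    Chooser SA _≈A_ γA → (∀ a → SA a → Chooser SB (_≈B_ a) (γB a)) →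
    (∀ a a' → SA a → SA a' → a ≈A a' → Ext SB (γB a) (γB a')) →
    Chooser (λ (a , b) → SA a × SB b) (λ (a , b) (a' , b') → (a ≈A a') × (a ≈B b) b') (pairγ γA γB)
  pair-Chooser {SA} {SB} {_≈A_} {_≈B_} {γA} {γB} CA CB extB = record { sub = proj₁ ; pick = pick' ; uniq = uniq' }
    where
    module CA = Chooser CA
    module _ (P : A × B → Set) (P⊆S : ∀ {p} → P p → SA (proj₁ p) × SB (proj₂ p)) where
      fst⊆ : ∀ {a} → fstP P a → SA a
      fst⊆ (_ , p) = proj₁ (P⊆S p)
      snd⊆ : ∀ {b} → sndP γA P b → SB b
      snd⊆ (_ , _ , p) = proj₂ (P⊆S p)
      Sγ : ∀ {a} → γA (fstP P) a → SA a
      Sγ g = fst⊆ (CA.sub g)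
      pick' : ∀ p → P p → Σ (A × B) (pairγ γA γB P)
      pick' (a , b) p with CA.pick (fstP P) fst⊆ a (b , p)
      ... | a₁ , g₁ with CA.sub g₁
      ...   | b₁ , p₁ with Chooser.pick (CB a₁ (Sγ g₁)) (sndP γA P) snd⊆ b₁ (a₁ , g₁ , p₁)
      ...     | b₂ , h with Chooser.sub (CB a₁ (Sγ g₁)) h
      -- `b₂` may be the partner of another member `a₂` of the chosen class; `extB` carries the
      -- choice over from `a₁`.
      ...       | a₂ , g₂ , p₂ = (a₂ , b₂) , p₂ , g₂ ,
                    extB a₁ a₂ (Sγ g₁) (Sγ g₂) (CA.uniq (fstP P) fst⊆ g₁ g₂) (sndP γA P) (sndP γA P) snd⊆ (λ _
                            → ⇔-refl) h
      uniq' : ∀ {p q} → pairγ γA γB P p → pairγ γA γB P q → (proj₁ p ≈A proj₁ q) × (proj₁ p ≈B proj₂ p) (proj₂ q)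
      uniq' {a , b} {a' , b'} (_ , g , h) (_ , g' , h') = CA.uniq (fstP P) fst⊆ g g' ,
        Chooser.uniq (CB a (Sγ g)) (sndP γA P) snd⊆ h
          (extB a' a (Sγ g') (Sγ g) (CA.uniq (fstP P) fst⊆ g' g) (sndP γA P) (sndP γA P) snd⊆ (λ _ → ⇔-refl) h')

  pair-Ext : ∀ {SA : A → Set} {SB : B → Set} {γA γA' γB γB'} →
    (∀ {P a} → γA P a → P a) → Ext SA γA γA' → Ext SA γA' γA → (∀ a → SA a → Ext SB (γB a) (γB' a)) →
    Ext (λ (a , b) → SA a × SB b) (pairγ γA γB) (pairγ γA' γB')
  pair-Ext {SA} {SB} {γA} {γA'} subA extA extA' extB P P' P⊆S P⇔ {a , b} (p , g , h) =
    fwd (P⇔ (a , b)) p , extA (fstP P) (fstP P') fst⊆ fst⇔ g ,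
    extB a (fst⊆ (subA g)) (sndP γA P) (sndP γA' P') (λ (_ , _ , p) → proj₂ (P⊆S p)) snd⇔ h
    where
    fst⊆ : ∀ {a} → fstP P a → SA a
    fst⊆ (_ , p) = proj₁ (P⊆S p)
    fst⇔ : ∀ a → fstP P a ⇔ fstP P' a
    fst⇔ a = mk⇔ (λ (b , p) → b , fwd (P⇔ (a , b)) p) (λ (b , p) → b , bwd (P⇔ (a , b)) p)
    snd⇔ : ∀ b → sndP γA P b ⇔ sndP γA' P' b
    snd⇔ b = mk⇔ (λ (a , g , p) → a , extA (fstP P) (fstP P') fst⊆ fst⇔ g , fwd (P⇔ (a , b)) p)
                 (λ (a , g , p) → a , extA' (fstP P') (fstP P) (λ {a} q → fst⊆ (bwd (fst⇔ a) q)) (λ a →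
                         ⇔-sym (fst⇔ a)) g , bwd (P⇔ (a , b)) p)

module _ {A : Set} where

  codeγ : (A → ℕ) → Raw A
  codeγ code P a = P a × (∀ b → P b → code a ≤ℕ code b)

  code-Ext : ∀ code S → Ext S (codeγ code) (codeγ code)
  code-Ext code S P P' P⊆S P⇔ {a} (p , h) = fwd (P⇔ a) p , λ b q → h b (bwd (P⇔ b) q)

  AllV : (A → Set) → ∀ n → Vec A n → Set
  AllV S zero    []      = ⊤
  AllV S (suc n) (a ∷ l) = S a × AllV S n l

  EqV : (A → A → Set) → ∀ n → Vec A n → Vec A n → Set
  EqV R zero    []      []      = ⊤
  EqV R (suc n) (a ∷ l) (b ∷ m) = R a b × EqV R n l m

  vecγ : Raw A → ∀ n → Raw (Vec A n)
  vecγ γ zero    P []      = P []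
  vecγ γ (suc n) P (a ∷ l) = pairγ γ (λ _ → vecγ γ n) (λ (a , l) → P (a ∷ l)) (a , l)

  vec-sub : ∀ (γ : Raw A) n P l → vecγ γ n P l → P l
  vec-sub γ zero    P []      p = p
  vec-sub γ (suc n) P (a ∷ l) p = proj₁ p

  vec-Ext : ∀ {S : A → Set} {γ γ'} → (∀ {P a} → γ P a → P a) → Ext S γ γ' → Ext S γ' γ → ∀ n →
          Ext (AllV S n) (vecγ γ n) (vecγ γ' n)
  vec-Ext subγ e e' zero    P P' P⊆S P⇔ {[]} p = fwd (P⇔ []) p
  vec-Ext {S} subγ e e' (suc n) P P' P⊆S P⇔ {a ∷ l} p =
    pair-Ext {SA = S} {SB = AllV S n} subγ e e' (λ _ _ → vec-Ext subγ e e' n)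
      (λ (a , l) → P (a ∷ l)) (λ (a , l) → P' (a ∷ l)) P⊆S (λ (a , l) → P⇔ (a ∷ l)) p

  vec-Chooser : ∀ {S : A → Set} {_≈_ : A → A → Set} {γ} → Chooser S _≈_ γ → Ext S γ γ →
                ∀ n → Chooser (AllV S n) (EqV _≈_ n) (vecγ γ n)
  vec-Chooser {γ = γ} C e zero = record
    { sub = λ {P} {l} → vec-sub γ zero P l
    ; pick = λ { P P⊆S [] p → [] , p }
    ; uniq = λ { P P⊆S {[]} {[]} _ _ → tt } }
  vec-Chooser {S} {_≈_} {γ} C e (suc n) = record
    { sub = λ {P} {l} → vec-sub γ (suc n) P l
    ; pick = pick'
    ; uniq = λ { P P⊆S {a ∷ l} {b ∷ m} p q → Chooser.uniq PC (λ (a , l) → P (a ∷ l)) P⊆S p q } }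
    where
    PC = pair-Chooser {SA = S} {SB = AllV S n} {_≈A_ = _≈_} {_≈B_ = λ _ → EqV _≈_ n} C (λ _ _ → vec-Chooser C e n)
           (λ _ _ _ _ _ → vec-Ext (Chooser.sub C) e e n)
    pick' : ∀ P → (∀ {l} → P l → AllV S (suc n) l) → ∀ l → P l → Σ (Vec A (suc n)) (vecγ γ (suc n) P)
    pick' P P⊆S (a ∷ l) p =
      let (a' , l') , h = Chooser.pick PC (λ (a , l) → P (a ∷ l)) P⊆S (a , l) p in a' ∷ l' , h

  Seq : Set
  Seq = Σ ℕ (Vec A)

  AllS : (A → Set) → Seq → Set
  AllS S (n , l) = AllV S n l

  data EqS (R : A → A → Set) : Seq → Seq → Set where
    eqS : ∀ {n l m} → EqV R n l m → EqS R (n , l) (n , m)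

  seqγ : Raw A → Raw Seq
  seqγ γ P (n , l) = (∀ m k → P (m , k) → n ≤ℕ m) × vecγ γ n (λ l → P (n , l)) l

  seq-sub : ∀ (γ : Raw A) P s → seqγ γ P s → P s
  seq-sub γ P (n , l) (_ , h) = vec-sub γ n (λ l → P (n , l)) l h

  seq-Ext : ∀ {S : A → Set} {γ γ'} → (∀ {P a} → γ P a → P a) → Ext S γ γ' → Ext S γ' γ →
          Ext (AllS S) (seqγ γ) (seqγ γ')
  seq-Ext subγ e e' P P' P⊆S P⇔ {n , l} (min , h) =
    (λ m k p → min m k (bwd (P⇔ (m , k)) p)) ,
    vec-Ext subγ e e' n (λ l → P (n , l)) (λ l → P' (n , l)) P⊆S (λ l → P⇔ (n , l)) h

-- Choosing names and classes level by level.

module Choosing (em : ExcludedMiddle 0ℓ) (X : Structure) (x₀ : Carrier X) where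

  open Scattered em X x₀ public

  code-Chooser : {A : Set} (S : A → Set) (code : A → ℕ) → (∀ {a b} → code a ≡ code b → a ≡ b) →
          Chooser S _≡_ (codeγ code)
  code-Chooser {A} S code inj = record
    { sub = proj₁ ; pick = pick'
    ; uniq = λ P _ {a} {b} (p , h) (q , k) → inj (≤-antisym (h b q) (k a p)) }
    where
    pick' : ∀ P → (∀ {a} → P a → S a) → ∀ a → P a → Σ A (codeγ code P)
    pick' P _ a p with least {P = λ n → Σ A λ b → P b × (code b ≡ n)} (code a) (a , p , refl)
    ... | _ , (b , q , refl) , min = b , q , λ b' q' → min (code b') (b' , q' , refl)

  seq-Chooser : {A : Set} {S : A → Set} {_≈_ : A → A → Set} {γ : Raw A} → Chooser S _≈_ γ → Ext S γ γ →
                Chooser (AllS S) (EqS _≈_) (seqγ γ)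
  seq-Chooser {A} {S} {_≈_} {γ} C e = record { sub = λ {P} {s} → seq-sub γ P s ; pick = pick' ; uniq = uniq' }
    where
    pick' : ∀ P → (∀ {s} → P s → AllS S s) → ∀ s → P s → Σ Seq (seqγ γ P)
    pick' P P⊆S (n , l) p with least {P = λ n → Σ (Vec A n) λ l → P (n , l)} n (l , p)
    ... | m , (k , q) , min with Chooser.pick (vec-Chooser C e m) (λ l → P (m , l)) P⊆S k q
    ...   | k' , h = (m , k') , (λ m' l' p' → min m' (l' , p')) , h
    uniq' : ∀ P → (∀ {s} → P s → AllS S s) → ∀ {s t} → seqγ γ P s → seqγ γ P t → EqS _≈_ s t
    uniq' P P⊆S {n , l} {m , k} (min , h) (min' , h')
      with ≤-antisym (min m k (vec-sub γ m (λ l → P (m , l)) k h')) (min' n l (vec-sub γ n (λ l → P (n , l)) l h))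
    ... | refl = eqS (Chooser.uniq (vec-Chooser C e n) (λ l → P (n , l)) P⊆S h h')

  ordγ : Raw Ord
  ordγ P α = P α × (∀ β → P β → α ≤o β)

  ord-Ext : ∀ S → Ext S ordγ ordγ
  ord-Ext S P P' P⊆S P⇔ {a} (p , h) = fwd (P⇔ a) p , λ b q → h b (bwd (P⇔ b) q)

  ord-least : ∀ (P : Ord → Set) α → P α → Σ Ord (ordγ P)
  ord-least P α p = go α (<o-acc α) p
    where
    go : ∀ α → Acc _<o_ α → P α → Σ Ord (ordγ P)
    go α (acc rs) p with em {Σ Ord λ β → (β <o α) × P β}
    ... | yes (β , β< , q) = go β (rs β<) q
    ... | no n = α , p , λ β q → ≮o⇒≥ β α (λ β< → n (β , β< , q))

  ord-Chooser : ∀ S → Chooser S _≈o_ ordγ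
  ord-Chooser S = record
    { sub = proj₁ ; pick = λ P _ → ord-least P
    ; uniq = λ P _ {a} {b} (p , h) (q , k) → h b q , k a p }

  abstract
    enum-D : Enum (Fm × List ℕ)
    enum-D = enum-× enum-Fm (enum-List enum-ℕ)

  codeD : Fm × List ℕ → ℕ
  codeD d = proj₁ (proj₂ enum-D d)

  codeD-injective : ∀ {a b} → codeD a ≡ codeD b → a ≡ b
  codeD-injective {a} {b} e = trans (sym (proj₂ (proj₂ enum-D a))) (trans (cong (proj₁ enum-D) e) (proj₂ (proj₂
          enum-D b)))

  ModPt : Pt → Set
  ModPt v = Mod (proj₁ v)

  module Choice (not-perfect : ¬ Perfect) (v₀ : Pt) (m₀ : ModPt v₀) where

    Isolating : Ord → (Pt → Set) → ℕ × Seq {Named} → Set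
    Isolating α P (n , (_ , l)) = AllV (Below α) _ l × Isolates α P n (toList l)

    elemγ : (Ord → Raw Pt) → Raw Named
    elemγ g = pairγ (codeγ codeD) (λ _ → pairγ ordγ g)

    nameγ : (Ord → Raw Pt) → Raw (ℕ × Seq {Named})
    nameγ g = pairγ (codeγ id) (λ _ → seqγ (elemγ g))

    -- The name is in turn chosen only up to equivalence: its numbers and formulas by least code,
    -- its ordinals by rank, its classes by `Γ` itself at lower rank. The recursion is well founded
    -- because names isolating at `α` use only ranks below `α`.
    Γ : ∀ α → Acc _<o_ α → Raw Pt
    Γ α (acc rs) P v = P v × Σ (ℕ × Seq) λ s →
      nameγ (λ β Q c → Σ (β <o α) λ p → Γ β (rs p) Q c) (Isolating α P) s ×
              NamedOpen (proj₁ s) (toList (proj₂ (proj₂ s))) v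

    Γ-sub : ∀ α a {P v} → Γ α a P v → P v
    Γ-sub α (acc rs) = proj₁

    SE : Ord → Named → Set
    SE α (d , b , c) = ⊤ × (b <o α) × ModPt c

    AllV-map : ∀ {A : Set} {S S' : A → Set} → (∀ {a} → S a → S' a) → ∀ n {l : Vec A n} → AllV S n l → AllV S' n l
    AllV-map h zero    {[]}    _        = tt
    AllV-map h (suc n) {a ∷ l} (s , ss) = h s , AllV-map h n ss

    Below⇔ : ∀ {α α'} → α ≈o α' → ∀ {i} → Below α i → Below α' i
    Below⇔ {α} {α'} α≈ {_ , (β , c)} (p , m) = <-≤-transo β α α' p (proj₁ α≈) , m

    Isolating⇔ : ∀ {α α' P P'} → α ≈o α' → (∀ v → P v ⇔ P' v) → ∀ s → Isolating α P s → Isolating α' P' s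
    Isolating⇔ {α} {α'} α≈ P⇔ (n , (k , l)) (b , (v , p , o) , h) =
      AllV-map (λ {i} → Below⇔ α≈ {i}) k b , (v , fwd (P⇔ v) p , o) ,
      λ v w p o q o' → fwd (E-≈ α≈) (h v w (bwd (P⇔ v) p) o (bwd (P⇔ w) q) o')

    elem-Ext : ∀ {α} {g g' : Ord → Raw Pt} → (∀ β → β <o α → Ext ModPt (g β) (g' β)) → Ext (SE α) (elemγ g) (elemγ g')
    elem-Ext {α} ext = pair-Ext {SA = λ _ → ⊤} {SB = λ (b , c) → (b <o α) ×
            ModPt c} proj₁ (code-Ext codeD _) (code-Ext codeD _)
      (λ _ _ → pair-Ext {SA = _<o α} {SB = ModPt} proj₁ (ord-Ext _) (ord-Ext _) ext)

    NameS : Ord → ℕ × Seq {Named} → Set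
    NameS α (n , s) = ⊤ × AllS (SE α) s

    name-Ext : ∀ {α} {g g' : Ord → Raw Pt} →
      (∀ β → β <o α → Ext ModPt (g β) (g' β)) → (∀ β → β <o α → Ext ModPt (g' β) (g β)) →
      Ext (NameS α) (nameγ g) (nameγ g')
    name-Ext {α} {g} {g'} ext ext' =
      pair-Ext {SA = λ _ → ⊤} {SB = AllS (SE α)} proj₁ (code-Ext id _) (code-Ext id _)
        (λ _ _ → seq-Ext {S = SE α} {γ = elemγ g} {γ' = elemγ g'} proj₁ (elem-Ext ext) (elem-Ext ext'))

    Isolating⊆ : ∀ {α P} {s : ℕ × Seq} → Isolating α P s → NameS α s
    Isolating⊆ {s = n , (k , l)} (b , _) = tt , AllV-map (λ s → tt , s) k b

    -- Two accessibility proofs for one ordinal are not known to be equal, so independence of them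
    -- is proved together with invariance under rank and under equivalence of predicates.
    Γ-Ext : ∀ α (a : Acc _<o_ α) α' (a' : Acc _<o_ α') → α ≈o α' → Ext ModPt (Γ α a) (Γ α' a')
    Γ-Ext α (acc rs) α' (acc rs') α≈ P P' P⊆S P⇔ {v} (p , s , h , o) = fwd (P⇔ v) p , s ,
      name-Ext {α} there' back'
        (Isolating α P) (Isolating α' P') (λ {s} → Isolating⊆ {α} {P} {s})
        (λ s → mk⇔ (Isolating⇔ α≈ P⇔ s) (Isolating⇔ (≈o-sym α≈) (λ v → ⇔-sym (P⇔ v)) s)) h , o
      where
      there' : ∀ β → β <o α → Ext ModPt (λ Q c → Σ (β <o α) λ p → Γ β (rs p) Q c) (λ Q c → Σ (β <o α') λ p →
              Γ β (rs' p) Q c)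
      there' β β< Q Q' Q⊆S Q⇔ (p , g) = let p' = <-≤-transo β α α' p (proj₁ α≈) in
        p' , Γ-Ext β (rs p) β (rs' p') (≈o-refl β) Q Q' Q⊆S Q⇔ g
      back' : ∀ β → β <o α → Ext ModPt (λ Q c → Σ (β <o α') λ p → Γ β (rs' p) Q c) (λ Q c → Σ (β <o α) λ p →
              Γ β (rs p) Q c)
      back' β p Q Q' Q⊆S Q⇔ (p' , g) = p , Γ-Ext β (rs' p') β (rs p) (≈o-refl β) Q Q' Q⊆S Q⇔ g

    ≈E : Named → Named → Set
    ≈E (d , b , c) (d' , b' , c') = (d ≡ d') × (b ≈o b') × E b c c'

    EqV-∈ : ∀ n {l m : Vec Named n} → EqV ≈E n l m → ∀ {i} → i ∈ toList m → Σ Named λ j → (j ∈ toList l) × ≈E j i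
    EqV-∈ (suc n) {a ∷ l} {b ∷ m} (r , rs) (here refl) = a , here refl , r
    EqV-∈ (suc n) {a ∷ l} {b ∷ m} (r , rs) (there i∈) = let j , j∈ , h = EqV-∈ n rs i∈ in j , there j∈ , h

    -- A label matters only up to rank and class, so equivalent names cut out the same set.
    NamedOpen-resp : ∀ {n k} {l m : Vec Named k} → EqV ≈E k l m → ∀ v → NamedOpen n (toList l) v →
            NamedOpen n (toList m) v
    NamedOpen-resp {k = k} r (M , u) (ρ , ≡e , hs) = ρ , ≡e , λ i∈ → go (EqV-∈ k r i∈)
      where
      go : ∀ {φ e β c} → (Σ Named λ j → (j ∈ toList _) × ≈E j ((φ , e) , (β , c))) → satL β c (M , map ρ e) φ
      go {φ} {e} {β} {c} ((_ , (β' , c')) , j∈ , refl , β≈ , ec) =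
        fwd (satL-cong (λ x → mk⇔ (λ h → fwd (E-≈ β≈) (E-trans β' h ec)) (λ h →
                E-trans β' (bwd (E-≈ β≈) h) (E-sym β' ec)))
              (M , map ρ e) φ) (hs j∈)

    ≈N : ℕ × Seq {Named} → ℕ × Seq {Named} → Set
    ≈N (n , s) (n' , s') = (n ≡ n') × EqS ≈E s s'

    module _ {α : Ord} {g : Ord → Raw Pt} (g-Ext : ∀ β β' → β <o α → β' <o α → β ≈o β' → Ext ModPt (g β) (g β'))
      (g-Chooser : ∀ β → β <o α → Chooser ModPt (E β) (g β)) where

      private
        g-Ext₁ : ∀ β → β <o α → Ext ModPt (g β) (g β)
        g-Ext₁ β p = g-Ext β β p p (≈o-refl β)

      elem-Chooser : Chooser (SE α) ≈E (elemγ g)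
      elem-Chooser = pair-Chooser {SA = λ _ → ⊤} {SB = λ (b , c) → (b <o α) × ModPt c} {_≈A_ = _≡_}
        {_≈B_ = λ _ (b , c) (b' , c') → (b ≈o b') × E b c c'} (code-Chooser _ codeD codeD-injective)
        (λ _ _ → pair-Chooser {SA = _<o α} {SB = ModPt} {_≈A_ = _≈o_} {_≈B_ = E} (ord-Chooser _) g-Chooser g-Ext)
        (λ _ _ _ _ _ → pair-Ext {SA = _<o α} {SB = ModPt} proj₁ (ord-Ext _) (ord-Ext _) g-Ext₁)

      name-Chooser : Chooser (NameS α) ≈N (nameγ g)
      name-Chooser = pair-Chooser {SA = λ _ → ⊤} {SB = AllS (SE α)} {_≈A_ = _≡_} {_≈B_ = λ _ → EqS ≈E}
        (code-Chooser _ id id) (λ _ _ → seq-Chooser elem-Chooser (elem-Ext g-Ext₁))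
        (λ _ _ _ _ _ → seq-Ext {S = SE α} {γ = elemγ g} {γ' = elemγ g} proj₁ (elem-Ext g-Ext₁) (elem-Ext g-Ext₁))

    toAllV : ∀ {S : Named → Set} (l : List Named) → (∀ {i} → i ∈ l → S i) → AllV S (length l) (fromList l)
    toAllV []      h = tt
    toAllV (i ∷ l) h = h (here refl) , toAllV l (λ i∈ → h (there i∈))

    -- A nonempty P has a name isolating a point in it; the chosen class is cut out by the chosen name.
    Γ-Chooser : ∀ α (a : Acc _<o_ α) → Chooser ModPt (E α) (Γ α a)
    Γ-Chooser α (acc rs) = record { sub = proj₁ ; pick = pick' ; uniq = uniq' }
      where
      g : Ord → Raw Pt
      g β Q c = Σ (β <o α) λ p → Γ β (rs p) Q c
      g-Ext : ∀ β β' → β <o α → β' <o α → β ≈o β' → Ext ModPt (g β) (g β')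
      g-Ext β β' _ p' β≈ Q Q' Q⊆S Q⇔ (p , h) = p' , Γ-Ext β (rs p) β' (rs p') β≈ Q Q' Q⊆S Q⇔ h
      g-Chooser : ∀ β → β <o α → Chooser ModPt (E β) (g β)
      g-Chooser β p = record
        { sub = λ (p , h) → Γ-sub β (rs p) h
        ; pick = λ Q Q⊆S c q → let c' , h = Chooser.pick (Γ-Chooser β (rs p)) Q Q⊆S c q in c' , p , h
        ; uniq = λ Q Q⊆S (p , h) (p' , h') → Chooser.uniq (Γ-Chooser β (rs p)) Q Q⊆S h
            (Γ-Ext β (rs p') β (rs p) (≈o-refl β) Q Q Q⊆S (λ _ → ⇔-refl) h') }
      N : Chooser (NameS α) ≈N (nameγ g)
      N = name-Chooser g-Ext g-Chooser
      pick' : ∀ P → (∀ {v} → P v → ModPt v) → ∀ v → P v → Σ Pt (Γ α (acc rs) P)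
      pick' P P⊆S v p =
        let n , l , b , iso = isolated not-perfect v₀ m₀ α P P⊆S v p
            s , h = Chooser.pick N (Isolating α P) (λ {s} → Isolating⊆ {α} {P} {s}) (n , (length l , fromList l))
                      (toAllV l b , subst (Isolates α P n) (sym (toList∘fromList l)) iso)
            _ , (w , q , o) , _ = Chooser.sub N {Isolating α P} {s} h
        in w , q , s , h , o
      conclude : ∀ {P v w} s s' → ≈N s' s → Isolating α P s → P v → P w →
                 NamedOpen (proj₁ s) (toList (proj₂ (proj₂ s))) v →
                         NamedOpen (proj₁ s') (toList (proj₂ (proj₂ s'))) w → E α v w
      conclude {P} {v} {w} (n , _) (.n , _) (refl , eqS r) (_ , _ , same) p q o o' =
              same v w p o q (NamedOpen-resp r w o')
      uniq' : ∀ P → (∀ {v} → P v → ModPt v) → ∀ {v w} → Γ α (acc rs) P v → Γ α (acc rs) P w → E α v w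
      uniq' P P⊆S {v} {w} (p , s , h , o) (q , s' , h' , o') =
        conclude {P} {v} {w} s s' (Chooser.uniq N (Isolating α P) (λ {s} → Isolating⊆ {α} {P} {s}) {s'} {s} h' h)
          (Chooser.sub N {Isolating α P} {s} h) p q o o'

-- From an injective family of pointed models to continuum many models.

∈-nth : {A : Set} {l : List A} {a : A} → a ∈ l → Σ ℕ λ i → nth l i ≡ just a
∈-nth (here refl) = 0 , refl
∈-nth (there a∈)  = let i , e = ∈-nth a∈ in suc i , e

pairs : {A B : Set} (u : List A) (v : List B) → length u ≡ length v →
        Σ (List (A × B)) λ l → (map proj₁ l ≡ u) × (map proj₂ l ≡ v)
pairs []      []      e = [] , refl , refl
pairs (a ∷ u) (b ∷ v) e = let l , p , q = pairs u v (suc-injective e) in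
  (a , b) ∷ l , cong (a ∷_) p , cong (b ∷_) q

module Continuum (em : ExcludedMiddle 0ℓ) (X : Structure) (x₀ : Carrier X) where

  open Choosing em X x₀

  PtIso : Pt → Pt → Set
  PtIso (M , u) (N , w) = Σ (⟦ M ⟧ ≃ ⟦ N ⟧) λ e → map (to e) u ≡ w

  PtIso-sym : ∀ {v w} → PtIso v w → PtIso w v
  PtIso-sym {M , u} (e , refl) = ≃-sym e , trans (sym (map-∘ u)) (trans (map-cong (from∘to e) u) (map-id u))

  PtIso-trans : ∀ {v w x} → PtIso v w → PtIso w x → PtIso v x
  PtIso-trans {M , u} (e , refl) (e' , refl) = ≃-trans e e' , map-∘ u

  PtIso⇒E : ∀ α {v w} → PtIso v w → E α v w
  PtIso⇒E α {M , u} (e , refl) = E-iso α e u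

  module _ {M N : Cod} (M-Mod : Mod M) (N-Mod : Mod N) where

    private
      R : List (∣ M ∣ × ∣ N ∣) → Set
      R l = ∀ α → E α (M , map proj₁ l) (N , map proj₂ l)

      -- Atomic formulas are already decided at rank one, where the label is trivial.
      agree : ∀ {l} → R l → ∀ φ → satL zero (M , []) (M , map proj₁ l) φ ⇔ satL zero (M , []) (N , map proj₂ l) φ
      agree r φ = proj₂ (r (sup λ _ → zero) 0) (M , []) M-Mod φ

      piso : ∀ {l} → R l → PIso ⟦ M ⟧ ⟦ N ⟧ l
      piso {l} r {p} {q} p∈ q∈ with ∈-nth p∈ | ∈-nth q∈
      ... | i , pi | j , qj = mk⇔ le₁ le₂ , mk⇔ eq₁ eq₂
        where
        p₁ = nth-map proj₁ l {i} pi
        p₂ = nth-map proj₂ l {i} pi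
        q₁ = nth-map proj₁ l {j} qj
        q₂ = nth-map proj₂ l {j} qj
        same : {A : Set} {x : Maybe A} {a b : A} → x ≡ just a → x ≡ just b → a ≡ b
        same p q = just-injective (trans (sym p) q)
        le₁ : _ → _
        le₁ h with fwd (agree r (leF i j)) (_ , _ , p₁ , q₁ , h)
        ... | a , b , a∈ , b∈ , h' = subst id (cong₂ (_≤_ ⟦ N ⟧) (same a∈ p₂) (same b∈ q₂)) h'
        le₂ : _ → _
        le₂ h with bwd (agree r (leF i j)) (_ , _ , p₂ , q₂ , h)
        ... | a , b , a∈ , b∈ , h' = subst id (cong₂ (_≤_ ⟦ M ⟧) (same a∈ p₁) (same b∈ q₁)) h'
        eq₁ : _ → _
        eq₁ h with fwd (agree r (eqF i j)) (_ , p₁ , trans q₁ (cong just (sym h)))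
        ... | a , a∈ , b∈ = trans (same p₂ a∈) (same b∈ q₂)
        eq₂ : _ → _
        eq₂ h with bwd (agree r (eqF i j)) (_ , p₂ , trans q₂ (cong just (sym h)))
        ... | a , a∈ , b∈ = trans (same p₁ a∈) (same b∈ q₁)

      -- If no b works at all levels, the countably many failures are bounded by one ordinal.
      bound : ∀ {N : Cod} (Q : Ord → ∣ N ∣ → Set) → (∀ {α β b} → α ≤o β → Q β b → Q α b) →
              (∀ α → Σ ∣ N ∣ (Q α)) → Σ ∣ N ∣ λ b → ∀ α → Q α b
      bound {N} Q down h = by-contradiction λ none' → contra none' (h (sup (fails none')))
        where
        module _ (none' : ¬ Σ ∣ N ∣ λ b → ∀ α → Q α b) where
          failure : ∀ b → Σ Ord λ α → ¬ Q α b
          failure b = ¬∀⇒∃¬ λ q → none' (b , q)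
          fails : ℕ → Ord
          fails n with dom N n Bool.≟ true
          ... | yes e = proj₁ (failure (n , e))
          ... | no _  = zero
          fails-≡ : ∀ n e → fails n ≡ proj₁ (failure (n , e))
          fails-≡ n e with dom N n Bool.≟ true
          ... | yes e' = cong (λ b → proj₁ (failure b)) (∣∣-≡ {N} refl)
          ... | no ne  = ⊥-elim (ne e)
          contra : Σ ∣ N ∣ (Q (sup fails)) → ⊥
          contra ((n , e) , q) = proj₂ (failure (n , e))
            (down (<o⇒≤o (proj₁ (failure (n , e))) (sup fails) (n , subst (proj₁ (failure (n ,
                    e)) ≤o_) (sym (fails-≡ n e)) (≤o-refl _))) q)

      -- The class at rank `α` of the tuple extended by `a` is itself a label, and `exF labF` says
      -- that a tuple extends into it. Agreement one rank higher gives a `b` for each `α`, and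
      -- `bound` a single one.
      forth : ∀ {l} → R l → ∀ a → Σ ∣ N ∣ λ b → R ((a , b) ∷ l)
      forth {l} r a = bound {N} (λ α b → E α (M , a ∷ map proj₁ l) (N , b ∷ map proj₂ l)) (λ {α} {β} p →
              E-≤ α β p) λ α →
        let b , h = fwd (proj₂ (r (sup λ _ → α) 0) (M , a ∷ map proj₁ l) M-Mod (exF labF)) (a ,
                E-refl α _) in b , E-sym α h

      back : ∀ {l} → R l → ∀ b → Σ ∣ M ∣ λ a → R ((a , b) ∷ l)
      back {l} r b = bound {M} (λ α a → E α (M , a ∷ map proj₁ l) (N , b ∷ map proj₂ l)) (λ {α} {β} p →
              E-≤ α β p) λ α →
        bwd (proj₂ (r (sup λ _ → α) 0) (N , b ∷ map proj₂ l) N-Mod (exF labF)) (b , E-refl α _)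

    E∞⇒PtIso : ∀ l → (∀ α → E α (M , map proj₁ l) (N , map proj₂ l)) → PtIso (M , map proj₁ l) (N , map proj₂ l)
    E∞⇒PtIso l r = isomorphism , go l (λ p∈ → p∈)
      where
      open BackAndForth M N R piso forth back l r
      go : ∀ l' → (∀ {p} → p ∈ l' → p ∈ l) → map (to isomorphism) (map proj₁ l') ≡ map proj₂ l'
      go []       s = refl
      go (p ∷ l') s = cong₂ _∷_ (isomorphism-extends (s (here refl))) (go l' (λ p∈ → s (there p∈)))

  Stable : Cod → Ord → Set
  Stable M α = ∀ u w → length u ≡ length w → E α (M , u) (M , w) → PtIso (M , u) (M , w)

  module _ {M : Cod} (M-Mod : Mod M) where

    private
      elements : Enum ∣ M ∣
      elements = enum-∣∣ M (Mod-inhabited M-Mod)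

      tuples : Enum (List ∣ M ∣ × List ∣ M ∣)
      tuples = enum-× (enum-List elements) (enum-List elements)

      split : List ∣ M ∣ × List ∣ M ∣ → Ord
      split (u , w) with em {Σ Ord λ α → ¬ E α (M , u) (M , w)}
      ... | yes (α , _) = α
      ... | no _        = zero

      split-E : ∀ u w → E (split (u , w)) (M , u) (M , w) → ∀ α → E α (M , u) (M , w)
      split-E u w h α with em {Σ Ord λ α → ¬ E α (M , u) (M , w)}
      ... | yes (_ , n) = ⊥-elim (n h)
      ... | no n        = by-contradiction λ ne → n (α , ne)

    -- A form of Scott rank: a countable model has countably many pairs of tuples, and the supremum
    -- lies above an ordinal splitting each pair that is split at all.
    stable : Σ Ord (Stable M)
    stable = sup (λ n → split (proj₁ tuples n)) , λ u w len h →
      let n , ≡e = proj₂ tuples (u , w)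
          l , p , q = pairs u w len
          all = split-E u w (E-≤ (split (u , w)) _ (<o⇒≤o _ (sup _)
                  (n , subst (λ z → split (u , w) ≤o split z) (sym ≡e) (≤o-refl (split (u , w))))) h)
          iso = E∞⇒PtIso M-Mod M-Mod l (λ α → subst (λ z → E α (M , z) (M , map proj₂ l)) (sym p)
                                            (subst (λ z → E α (M , u) (M , z)) (sym q) (all α)))
      in subst (λ z → PtIso (M , u) (M , z)) q (subst (λ z → PtIso (M , z) (M , map proj₂ l)) p iso)

  module FinalChoice (not-perfect : ¬ Perfect) (v₀ : Pt) (m₀ : ModPt v₀) where

    open Choice not-perfect v₀ m₀

    Separates : (Pt → Set) → Ord → Set
    Separates P α = ∀ v w → P v → P w → E α v w → PtIso v w

    -- The rank is not fixed in advance: taking the least one at which classes within `P` are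
    -- isomorphism types makes it depend on `P` alone.
    finalγ : Raw Pt
    finalγ P v = Σ Ord λ α → ordγ (Separates P) α × Γ α (<o-acc α) P v

    final-sub : ∀ P v → finalγ P v → P v
    final-sub P v (α , _ , h) = Γ-sub α (<o-acc α) h

    final-pick : ∀ P → (∀ {v} → P v → ModPt v) → ∀ α → Separates P α → ∀ v → P v → Σ Pt (finalγ P)
    final-pick P P⊆S α s v p =
      let β , h = ord-least (Separates P) α s
          w , g = Chooser.pick (Γ-Chooser β (<o-acc β)) P P⊆S v p
      in w , β , h , g

    final-uniq : ∀ P P' → (∀ {v} → P v → ModPt v) → (∀ v → P v ⇔ P' v) → ∀ {v w} → finalγ P v → finalγ P' w →
            PtIso v w
    final-uniq P P' P⊆S P⇔ {v} {w} (α , (s , min) , g) (α' , (s' , min') , g') =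
      s v w (Γ-sub α (<o-acc α) g) (bwd (P⇔ w) (Γ-sub α' (<o-acc α') g'))
        (Chooser.uniq (Γ-Chooser α (<o-acc α)) P P⊆S g
          (Γ-Ext α' (<o-acc α') α (<o-acc α) (min' α (transport (λ v → P⇔ v) s) , min α' (transport (λ v →
                  ⇔-sym (P⇔ v)) s'))
            P' P (λ p → P⊆S (bwd (P⇔ _) p)) (λ v → ⇔-sym (P⇔ v)) g'))
      where
      transport : ∀ {P P' α} → (∀ v → P v ⇔ P' v) → Separates P α → Separates P' α
      transport P⇔ s v w p q = s v w (bwd (P⇔ v) p) (bwd (P⇔ w) q)

  𝟚^ω : Set
  𝟚^ω = ℕ → Bool

  column : ℕ → 𝟚^ω → 𝟚^ω
  column n g m = g (pair n m)

  abstract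
    -- König: if every n failed for some f n, interleaving the f n would give a g that fails at n = idx g.
    column-onto : (idx : 𝟚^ω → ℕ) (c : 𝟚^ω → 𝟚^ω) →
                  Σ ℕ λ n → ∀ f → Σ 𝟚^ω λ g → (idx g ≡ n) × (∀ m → column n g m ≡ c f m)
    column-onto idx c = by-contradiction λ none' →
      let bad : ∀ n → Σ 𝟚^ω λ f → ¬ Σ 𝟚^ω λ g → (idx g ≡ n) × (∀ m → column n g m ≡ c f m)
          bad n = ¬∀⇒∃¬ λ h → none' (n , h)
          g : 𝟚^ω
          g k = c (proj₁ (bad (proj₁ (unpair k)))) (proj₂ (unpair k))
      in proj₂ (bad (idx g)) (g , refl , λ m → cong (λ z →
              c (proj₁ (bad (proj₁ z))) (proj₂ z)) (unpair-pair (idx g) m))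

  module _ (A : 𝟚^ω → Pt) (A-Mod : ∀ f → ModPt (A f)) (k : ℕ) (A-length : ∀ f → length (proj₂ (A f)) ≡ k)
    (A-injective : ∀ f g → PtIso (A f) (A g) → f ≡ g)
    (c : 𝟚^ω → 𝟚^ω) (c-injective : ∀ f g → (∀ n → c f n ≡ c g n) → f ≡ g) where

    private
      𝔐 : 𝟚^ω → Structure
      𝔐 f = ⟦ proj₁ (A f) ⟧

      asModel : (M : Cod) → Mod M → CountableModel X
      asModel M mod = ⟦ M ⟧ , code-↣ M , mod

      Mod-iso : ∀ {M N} → ⟦ M ⟧ ≃ ⟦ N ⟧ → Mod M → Mod N
      Mod-iso e m = ModelOfTh-≃ {X} e m

      module NotPerfect (not-perfect : ¬ Perfect) where

        open FinalChoice not-perfect (A (λ _ → true)) (A-Mod (λ _ → true))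

        -- The pointed structures of the family over the model of `f`, up to isomorphism. As a
        -- predicate this depends only on the isomorphism type of that model.
        Copy : 𝟚^ω → Pt → Set
        Copy f v = Σ 𝟚^ω λ g → PtIso (A g) v × (𝔐 g ≃ 𝔐 f)

        Copy-Mod : ∀ f {v} → Copy f v → ModPt v
        Copy-Mod f (g , (e , _) , _) = Mod-iso e (A-Mod g)

        Copy-⇔ : ∀ {f f'} → 𝔐 f ≃ 𝔐 f' → ∀ v → Copy f v ⇔ Copy f' v
        Copy-⇔ e v = mk⇔ (λ (g , i , h) → g , i , ≃-trans h e) (λ (g , i , h) → g , i , ≃-trans h (≃-sym e))

        -- Both points are moved into the one model `𝔐 f`, where stability applies.
        Copy-Separates : ∀ f → Σ Ord (Separates (Copy f))
        Copy-Separates f = let α , st = stable (A-Mod f) in α , λ v w (g , i , h) (g' , i' , h') e →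
          let p : PtIso v (proj₁ (A f) , map (to h) (proj₂ (A g)))
              p = PtIso-trans (PtIso-sym i) (h , refl)
              q : PtIso w (proj₁ (A f) , map (to h') (proj₂ (A g')))
              q = PtIso-trans (PtIso-sym i') (h' , refl)
              len : ∀ g (h : 𝔐 g ≃ 𝔐 f) → length (map (to h) (proj₂ (A g))) ≡ k
              len g h = trans (length-map (to h) (proj₂ (A g))) (A-length g)
          in PtIso-trans p (PtIso-trans (st _ _ (trans (len g h) (sym (len g' h')))
               (E-trans α (E-sym α (PtIso⇒E α p)) (E-trans α e (PtIso⇒E α q)))) (PtIso-sym q))

        chosen : ∀ f → Σ Pt (finalγ (Copy f))
        chosen f = let α , s = Copy-Separates f in
          final-pick (Copy f) (Copy-Mod f) α s (A f) (f , (iso-refl , map-id _) , iso-refl)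
          where
          iso-refl : ∀ {S} → S ≃ S
          iso-refl = record { to = id ; from = id ; to∘from = λ _ → refl ; from∘to = λ _ → refl ; mono =
                  λ _ _ → ⇔-refl }

        chosen-Copy : ∀ f → Copy f (proj₁ (chosen f))
        chosen-Copy f = final-sub (Copy f) _ (proj₂ (chosen f))

        r : 𝟚^ω → 𝟚^ω
        r f = proj₁ (chosen-Copy f)

        r-iso : ∀ f → 𝔐 (r f) ≃ 𝔐 f
        r-iso f = proj₂ (proj₂ (chosen-Copy f))

        -- The chosen points agree only up to isomorphism, but `A` is injective up to isomorphism,
        -- and this gives equality.
        r-canonical : ∀ f f' → 𝔐 f ≃ 𝔐 f' → r f ≡ r f'
        r-canonical f f' e = A-injective (r f) (r f')
          (PtIso-trans (proj₁ (proj₂ (chosen-Copy f)))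
            (PtIso-trans (final-uniq (Copy f) (Copy f') (Copy-Mod f) (Copy-⇔ {f} {f'} e) (proj₂ (chosen f))
                    (proj₂ (chosen f')))
              (PtIso-sym (proj₁ (proj₂ (chosen-Copy f'))))))

        -- The distinguished tuple of `A f` transported to the model of `h`. Once that model is
        -- fixed, this list of naturals determines `f`.
        numbers : ∀ f h → 𝔐 h ≃ 𝔐 f → List ℕ
        numbers f h e = map proj₁ (map (from e) (proj₂ (A f)))

        same-numbers : ∀ f f' h h' → h ≡ h' → (e : 𝔐 h ≃ 𝔐 f) (e' : 𝔐 h' ≃ 𝔐 f') →
                       numbers f h e ≡ numbers f' h' e' → f ≡ f'
        same-numbers f f' h h refl e e' ≡e = A-injective f f' (PtIso-trans (≃-sym e ,
                refl) (PtIso-sym (≃-sym e' , sym tuples)))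
          where
          tuples : map (from e) (proj₂ (A f)) ≡ map (from e') (proj₂ (A f'))
          tuples = map-injective (∣∣-≡ {proj₁ (A h)}) ≡e

        codes : Enum (List ℕ)
        codes = enum-List enum-ℕ

        abstract
          idx : 𝟚^ω → ℕ
          idx f = proj₁ (proj₂ codes (numbers f (r f) (r-iso f)))

          idx-injective : ∀ f f' → 𝔐 f ≃ 𝔐 f' → idx f ≡ idx f' → f ≡ f'
          idx-injective f f' e ≡e = same-numbers f f' (r f) (r f') (r-canonical f f' e) (r-iso f) (r-iso f')
            (trans (sym (proj₂ (proj₂ codes (numbers f (r f) (r-iso f)))))
              (trans (cong (proj₁ codes) ≡e) (proj₂ (proj₂ codes (numbers f' (r f') (r-iso f'))))))

        s : 𝟚^ω → 𝟚^ω
        s f = proj₁ (proj₂ (column-onto idx c) f)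

        -- All values of `s` share one value of `idx`, so isomorphic models come from equal values
        -- of `s`, whose common column returns `c f`.
        s-injective : ∀ f f' → 𝔐 (s f) ≃ 𝔐 (s f') → f ≡ f'
        s-injective f f' e = c-injective f f' λ m →
          let n , h = column-onto idx c
              _ , i , col = h f
              _ , i' , col' = h f'
          in trans (sym (col m)) (trans (cong (λ g → column n g m) (idx-injective (s f) (s f') e (trans i (sym
                  i')))) (col' m))

        continuum : I≡𝔠 X
        continuum = (λ f → asModel (proj₁ (A (s f))) (A-Mod (s f))) , λ f g e → s-injective f g (≅⇒≃ e)

    -- A perfect set is reparametrised by `c`, because its members are separated only pointwise.
    I≡𝔠-from-family : I≡𝔠 X
    I≡𝔠-from-family with em {Perfect}
    ... | yes (p , mods , dist) = (λ f → asModel (p (c f)) (mods (c f))) , λ f g e →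
            c-injective f g (dist (c f) (c g) (≅⇒≃ e))
    ... | no np = NotPerfect.continuum np

-- Finitely many types: isomorphism of models and types in sums.

SameType-sym : ∀ {A B u v} → SameType A B u v → SameType B A v u
SameType-sym h φ = ⇔-sym (h φ)

SameType-trans : ∀ {A B C u v w} → SameType A B u v → SameType B C v w → SameType A C u w
SameType-trans h h' φ = ⇔-trans (h φ) (h' φ)

SameType-iso : ∀ {A B} (e : A ≃ B) u → SameType A B u (map (to e) u)
SameType-iso e u φ = sat-iso e (λ _ → ⇔-refl) φ u

FinTypes : Structure → ℕ → Set
FinTypes S n = Σ (List (List (Carrier S))) λ reps →
  ∀ u → length u ≡ n → Σ (List (Carrier S)) λ w → (w ∈ reps) × SameType S S u w

FinTypes-iso : ∀ {S T n} → S ≃ T → FinTypes S n → FinTypes T n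
FinTypes-iso {S} {T} e (reps , h) = map (map (to e)) reps , λ u len →
  let w , w∈ , s = h (map (from e) u) (trans (length-map (from e) u) len) in
  map (to e) w , ∈-map⁺ (map (to e)) w∈ ,
  SameType-trans {T} {S} {T} (SameType-iso (≃-sym e) u) (SameType-trans {S} {S} {T} s (SameType-iso e w))

select : {k : ℕ} {F : Fin k → Set} → ∀ i → List (Σ (Fin k) F) → List (F i)
select i [] = []
select i ((j , x) ∷ l) with i Fin.≟ j
... | yes refl = x ∷ select i l
... | no _     = select i l

select-map : {k : ℕ} {F G : Fin k → Set} (f : ∀ {i} → F i → G i) → ∀ i l →
             select i (map (λ (j , x) → j , f x) l) ≡ map f (select {F = F} i l)
select-map f i [] = refl
select-map f i ((j , x) ∷ l) with i Fin.≟ j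
... | yes refl = cong (f x ∷_) (select-map f i l)
... | no _     = select-map f i l

select-length : {k : ℕ} {F : Fin k → Set} → ∀ i l → length (select {F = F} i l) ≤ℕ length l
select-length i [] = z≤n
select-length i ((j , x) ∷ l) with i Fin.≟ j
... | yes refl = s≤s (select-length i l)
... | no _     = ≤-trans (select-length i l) (n≤1+n _)

select-∈ : {k : ℕ} {F : Fin k → Set} → ∀ {i x} l → (i , x) ∈ l → x ∈ select {F = F} i l
select-∈ {i = i} ((j , y) ∷ l) (here refl) with i Fin.≟ i
... | yes refl = here refl
... | no n     = ⊥-elim (n refl)
select-∈ {i = i} ((j , y) ∷ l) (there x∈) with i Fin.≟ j
... | yes refl = there (select-∈ l x∈)
... | no _     = select-∈ l x∈

matching : {k : ℕ} {F G : Fin k → Set} (a : List (Σ (Fin k) F)) (b : List (Σ (Fin k) G)) → map proj₁ a ≡ map proj₁ b →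
           Σ (List (Σ (Fin k) λ i → F i × G i)) λ t →
             (map (λ (i , p) → i , proj₁ p) t ≡ a) × (map (λ (i , p) → i , proj₂ p) t ≡ b)
matching [] [] e = [] , refl , refl
matching ((i , x) ∷ a) ((j , y) ∷ b) e with matching a b (∷-injectiveʳ e) | ∷-injectiveˡ e
... | t , p , q | refl = (i , (x , y)) ∷ t , cong (_ ∷_) p , cong (_ ∷_) q

lists : {A : Set} → List A → ℕ → List (List A)
lists l zero    = [] ∷ []
lists l (suc n) = cartesianProductWith _∷_ l (lists l n)

∈-lists : {A : Set} {l : List A} → (∀ a → a ∈ l) → ∀ u {n} → length u ≡ n → u ∈ lists l n
∈-lists h []      refl = here refl
∈-lists h (a ∷ u) refl = ∈-cartesianProductWith⁺ _∷_ (h a) (∈-lists h u refl)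

consΠ : ∀ {k} {A : Fin (suc k) → Set} → A Fin.zero → (∀ i → A (Fin.suc i)) → ∀ i → A i
consΠ a f Fin.zero    = a
consΠ a f (Fin.suc i) = f i

cover-Π : ∀ k (A : Fin k → Set) (Q : ∀ i → A i → Set) (R : ∀ i → A i → A i → Set) →
          (∀ i → Σ (List (A i)) λ reps → ∀ a → Q i a → Σ (A i) λ b → (b ∈ reps) × R i a b) →
          Σ (List (∀ i → A i)) λ gs → ∀ (f : ∀ i → A i) → (∀ i → Q i (f i)) → Σ (∀ i → A i) λ g → (g ∈ gs) ×
                  (∀ i → R i (f i) (g i))
cover-Π zero A Q R h = (λ ()) ∷ [] , λ f q → (λ ()) , here refl , λ ()
cover-Π (suc k) A Q R h with h Fin.zero | cover-Π k (λ i → A (Fin.suc i)) (λ i → Q (Fin.suc i)) (λ i →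
        R (Fin.suc i)) (λ i → h (Fin.suc i))
... | reps , c | gs , d = cartesianProductWith consΠ reps gs , λ f q →
  let b , b∈ , r = c (f Fin.zero) (q Fin.zero)
      g , g∈ , rs = d (λ i → f (Fin.suc i)) (λ i → q (Fin.suc i))
  in consΠ b g , ∈-cartesianProductWith⁺ consΠ b∈ g∈ , λ { Fin.zero → r ; (Fin.suc i) → rs i }

module Categorical (em : ExcludedMiddle 0ℓ) where

  open Henkin em

  separating : ∀ {A B u v} → ¬ SameType A B u v → Σ Fm λ φ → sat A blank u φ × ¬ sat B blank v φ
  separating n with ¬∀⇒∃¬ n
  ... | φ , nφ with ¬⇔ nφ
  ...   | inj₁ (p , q) = φ , p , q
  ...   | inj₂ (p , q) = notF φ , p , λ h → h q

  -- When `reps` represents all types of the given length, the resulting formula isolates the type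
  -- of `u`.
  separating-all : ∀ {A B u} (reps : List (List (Carrier B))) →
    Σ Fm λ ψ → sat A blank u ψ × (∀ {w} → w ∈ reps → ¬ SameType A B u w → ¬ sat B blank w ψ)
  separating-all [] = notF (andF labF (notF labF)) , (λ (p , n) → n p) , λ ()
  separating-all {A} {B} {u} (w ∷ reps) with separating-all {A} {B} {u} reps | em {SameType A B u w}
  ... | ψ , s , h | yes t = ψ , s , λ where
      (here refl) n → ⊥-elim (n t)
      (there w∈)  → h w∈
  ... | ψ , s , h | no nt with separating {A} {B} nt
  ...   | φ , p , q = andF φ ψ , (p , s) , λ where
            (here refl) n (a , _) → q a
            (there w∈) n (_ , b)  → h w∈ n b

  module _ (M N : Cod) (fin : ∀ n → FinTypes ⟦ N ⟧ n) where

    private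
      R : List (∣ M ∣ × ∣ N ∣) → Set
      R l = SameType ⟦ M ⟧ ⟦ N ⟧ (map proj₁ l) (map proj₂ l)

      forth : ∀ {l} → R l → ∀ a → Σ ∣ N ∣ λ b → R ((a , b) ∷ l)
      forth {l} r a with fin (suc (length l))
      ... | reps , cov with separating-all {⟦ M ⟧} {⟦ N ⟧} {a ∷ map proj₁ l} reps
      ...   | ψ , s , h with fwd (r (exF ψ)) (a , s)
      ...     | b , t with cov (b ∷ map proj₂ l) (cong suc (length-map proj₂ l))
      ...       | w , w∈ , st = b , by-contradiction λ n →
                    h w∈ (λ st' → n (SameType-trans {⟦ M ⟧} {⟦ N ⟧} {⟦ N ⟧} st' (SameType-sym {⟦ N ⟧} {⟦ N ⟧}
                            st))) (fwd (st ψ) t)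

      -- Only `N` is known to have finitely many types, so this is not symmetric to `forth`. Here
      -- `ψ` isolates the type of the extended tuple in `N`; if `a` satisfied `ψ` but differed from
      -- `b` on some formula, elementary equivalence would give such an element in `N`.
      back : ∀ {l} → R l → ∀ b → Σ ∣ M ∣ λ a → R ((a , b) ∷ l)
      back {l} r b with fin (suc (length l))
      ... | reps , cov with separating-all {⟦ N ⟧} {⟦ N ⟧} {b ∷ map proj₂ l} reps
      ...   | ψ , s , h with bwd (r (exF ψ)) (b , s)
      ...     | a , t = a , λ φ → mk⇔
                  (λ p → by-contradiction λ nq → bwd (¬-cong (r (exF (andF ψ (notF (notF φ)))))) (none-with
                          (notF φ) nq) (a , t , λ np → np p))
                  (λ q → by-contradiction λ np → bwd (¬-cong (r (exF (andF ψ (notF φ))))) (none-with φ q) (a ,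
                          t , np))
        where
        alike : ∀ b' → sat ⟦ N ⟧ blank (b' ∷ map proj₂ l) ψ →
                SameType ⟦ N ⟧ ⟦ N ⟧ (b ∷ map proj₂ l) (b' ∷ map proj₂ l)
        alike b' t' with cov (b' ∷ map proj₂ l) (cong suc (length-map proj₂ l))
        ... | w , w∈ , st = by-contradiction λ n →
              h w∈ (λ st' → n (SameType-trans {⟦ N ⟧} {⟦ N ⟧} {⟦ N ⟧} st' (SameType-sym {⟦ N ⟧} {⟦ N ⟧} st)))
                      (fwd (st ψ) t')
        none-with : ∀ χ → sat ⟦ N ⟧ blank (b ∷ map proj₂ l) χ →
                ¬ sat ⟦ N ⟧ blank (map proj₂ l) (exF (andF ψ (notF χ)))
        none-with χ q (b' , t' , n) = n (fwd (alike b' t' χ) q)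

    finTypes⇒≃ : SameType ⟦ M ⟧ ⟦ N ⟧ [] [] → ⟦ M ⟧ ≃ ⟦ N ⟧
    finTypes⇒≃ r = BackAndForth.isomorphism M N R (λ {l} r → BF⇒PIso 0 (SameType⇒BF l r 0)) forth back [] r

  collect : {Z A : Set} (R : Z → A → Set) (zs : List Z) →
            Σ (List A) λ reps → ∀ {z} → z ∈ zs → ∀ a → R z a → Σ A λ a' → (a' ∈ reps) × R z a'
  collect R [] = [] , λ ()
  collect {Z} {A} R (z ∷ zs) with collect R zs | em {Σ A (R z)}
  ... | reps , h | yes (a , r) = a ∷ reps , λ where
      (here refl) _ _ → a , here refl , r
      (there z∈) b q → let b' , b∈ , q' = h z∈ b q in b' , there b∈ , q'
  ... | reps , h | no n = reps , λ where
      (here refl) a r → ⊥-elim (n (a , r))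
      (there z∈) → h z∈

  -- A tuple of length `n` in the sum leaves anything up to `n` entries in a block.
  FinTypesUpTo : ∀ {S} → (∀ n → FinTypes S n) → ∀ n → Σ (List (List (Carrier S))) λ reps →
    ∀ u → length u ≤ℕ n → Σ (List (Carrier S)) λ w → (w ∈ reps) × SameType S S u w
  FinTypesUpTo fin zero = proj₁ (fin 0) , λ { [] _ → proj₂ (fin 0) [] refl }
  FinTypesUpTo {S} fin (suc n) with fin (suc n) | FinTypesUpTo {S} fin n
  ... | reps , h | reps' , h' = reps ++ reps' , cov
    where
    cov : ∀ u → length u ≤ℕ suc n → Σ (List (Carrier S)) λ w → (w ∈ reps ++ reps') × SameType S S u w
    cov u len with m≤n⇒m<n∨m≡n len
    ... | inj₂ e = let w , w∈ , s = h u e in w , ∈-++⁺ˡ w∈ , s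
    ... | inj₁ (s≤s l) = let w , w∈ , s = h' u l in w , ∈-++⁺ʳ reps w∈ , s

  module _ (𝕀 : FinPO) (Y : Fin (size 𝕀) → Structure) where

    private
      S = Lex 𝕀 Y

    -- The block indices and the types of the parts determine the type, by composing games of every
    -- finite length.
    Lex-SameType : ∀ a b → map proj₁ a ≡ map proj₁ b → (∀ i → SameType (Y i) (Y i) (select i a) (select i b)) →
            SameType S S a b
    Lex-SameType a b e h with matching a b e
    ... | t , refl , refl = subst₂' (map-∘ t) (map-∘ t)
          (BF⇒SameType (map both t) (λ r → Lex-BF 𝕀 Y Y r {λ i → select i t} fits (λ i → SameType⇒BF (select i t)
            (subst₂ (λ u v → SameType (Y i) (Y i) u v) (select-map proj₁ i t) (select-map proj₂ i t) (h i)) r)))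
      where
      both : (Σ (Fin (size 𝕀)) λ i → Carrier (Y i) × Carrier (Y i)) → Carrier S × Carrier S
      both (i , (x , y)) = (i , x) , (i , y)
      subst₂ : ∀ {A B : Set} (P : A → B → Set) {a a' b b'} → a ≡ a' → b ≡ b' → P a b → P a' b'
      subst₂ P refl refl p = p
      subst₂' : ∀ {u u' v v'} → u ≡ u' → v ≡ v' → SameType S S u' v' → SameType S S u v
      subst₂' refl refl p = p
      fits : Fits 𝕀 Y Y (λ i → select i t) (map both t)
      fits p∈ with ∈-map⁻ both p∈
      ... | (i , (x , y)) , t∈ , refl = i , x , y , refl , select-∈ t t∈

    Lex-FinTypes : (∀ i n → FinTypes (Y i) n) → ∀ n → FinTypes S n
    Lex-FinTypes fin n =
      let gs , cov = cover-Π (size 𝕀) (λ i → List (Carrier (Y i))) (λ i u → length u ≤ℕ n)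
                       (λ i → SameType (Y i) (Y i)) (λ i → FinTypesUpTo {Y i} (fin i) n)
          Z = List (Fin (size 𝕀)) × (∀ i → List (Carrier (Y i)))
          R : Z → List (Carrier S) → Set
          R (p , g) a = (map proj₁ a ≡ p) × (∀ i → SameType (Y i) (Y i) (select i a) (g i))
          reps , col = collect R (cartesianProductWith _,_ (lists (allFin (size 𝕀)) n) gs)
      in reps , λ u len →
        let g , g∈ , same = cov (λ i → select i u) (λ i → subst (length (select i u) ≤ℕ_) len (select-length i u))
            a , a∈ , (e , same') = col (∈-cartesianProductWith⁺ _,_ (∈-lists ∈-allFin (map proj₁ u) (trans
                    (length-map proj₁ u) len)) g∈) u (refl , same)
        in a , a∈ , Lex-SameType u a (sym e) (λ i →
                SameType-trans {Y i} {Y i} {Y i} (same i) (SameType-sym {Y i} {Y i} (same' i)))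

-- The theorem of Ryll-Nardzewski, by omitting and realising types.

module RyllNardzewski (em : ExcludedMiddle 0ℓ) (B : Structure) (N : Cod) (d : ∣ N ∣)
  (N-Mod : ModelOfTh B ⟦ N ⟧) (unique : ∀ M → ModelOfTh B ⟦ M ⟧ → ⟦ M ⟧ ≃ ⟦ N ⟧) where

  open Henkin em
  open Theory B {⊤} (λ _ _ _ → ⊤) tt (λ _ _ → tt)
  open Categorical em using (separating)

  private
    enum-⊤ : Enum ⊤
    enum-⊤ = (λ _ → tt) , λ _ → 0 , refl

    I = Inst ⊤

    satN : List ∣ N ∣ → Fm → Set
    satN = sat ⟦ N ⟧ blank

    _∼_ : List ∣ N ∣ → List ∣ N ∣ → Set
    _∼_ = SameType ⟦ N ⟧ ⟦ N ⟧

    BFN = BF ⟦ N ⟧ ⟦ N ⟧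

    -- Spends `m` rounds on the values of the constants below `m`, keeping `r` rounds for the
    -- formulas.
    moves : ∀ m r L (ρ : ℕ → ∣ N ∣) → BFN (m + r) L →
            Σ (ℕ → ∣ N ∣) λ ρ' → Σ (List (∣ N ∣ × ∣ N ∣)) λ L' →
              (∀ {p} → p ∈ L → p ∈ L') × BFN r L' × (∀ j → j <ℕ m → (ρ j , ρ' j) ∈ L')
    moves zero    r L ρ h = ρ , L , id , h , λ _ ()
    moves (suc m) r L ρ (_ , forth , _) with forth (ρ m)
    ... | b , h with moves m r ((ρ m , b) ∷ L) ρ h
    ...   | ρ' , L' , sub , h' , mem = update ρ' m b , L' , (λ p∈ → sub (there p∈)) , h' , mem'
      where
      mem' : ∀ j → j <ℕ suc m → (ρ j , update ρ' m b j) ∈ L'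
      mem' j (s≤s j≤m) with j ≟ m
      ... | yes refl = sub (here refl)
      ... | no j≢m with m≤n⇒m<n∨m≡n j≤m
      ...   | inj₁ j<m = mem j j<m
      ...   | inj₂ e   = ⊥-elim (j≢m e)

    depths : List I → ℕ
    depths []                = 0
    depths ((_ , φ , _) ∷ l) = depth φ ⊔ depths l

    depths-≤ : ∀ {k φ e} l → (k , φ , e) ∈ l → depth φ ≤ℕ depths l
    depths-≤ (_ ∷ l) (here refl) = m≤m⊔n _ (depths l)
    depths-≤ ((_ , φ , _) ∷ l) (there i∈) = ≤-trans (depths-≤ l i∈) (m≤n⊔m (depth φ) (depths l))

    rounds : List I → List ℕ → ℕ
    rounds l e = fresh (e ++ constants l) + depths l

    -- When `e` is moved along a game with enough rounds left, the other constants can follow so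
    -- that all of `l` stays true.
    reassign : ∀ ρ l e L → map proj₁ L ≡ map ρ e → BFN (rounds l e) L → Holds N ρ l →
               Σ (ℕ → ∣ N ∣) λ ρ' → Holds N ρ' l × (map ρ' e ≡ map proj₂ L)
    reassign ρ l e L ≡e bf hs with moves (fresh (e ++ constants l)) (depths l) L ρ bf
    ... | ρ' , L' , sub , bf' , mem = ρ' , holds' , go e L (λ j∈ → fresh-> _ (∈-++⁺ˡ j∈)) sub ≡e
      where
      m = fresh (e ++ constants l)
      go : ∀ e L → (∀ {j} → j ∈ e → j <ℕ m) → (∀ {p} → p ∈ L → p ∈ L') → map proj₁ L ≡ map ρ e → map ρ' e ≡
              map proj₂ L
      go []      []      b s q = refl
      go (j ∷ e) (p ∷ L) b s q = cong₂ _∷_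
        (fwd (proj₂ (BF⇒PIso (depths l) bf' (mem j (b (here refl))) (s (here refl)))) (sym (∷-injectiveˡ q)))
        (go e L (λ j∈ → b (there j∈)) (λ p∈ → s (there p∈)) (∷-injectiveʳ q))
      holds' : Holds N ρ' l
      holds' {_ , φ , e'} i∈ = subst (λ z → satN z φ) (sym (map-∘ e'))
        (fwd (BF-sat φ q (BF-≤ (depths-≤ l i∈) (BF-⊆ (depths l) q⊆ bf'))) (subst (λ z → satN z φ) (map-∘ e') (hs i∈)))
        where
        q = map (λ j → ρ j , ρ' j) e'
        q⊆ : ∀ {p} → p ∈ q → p ∈ L'
        q⊆ p∈ with ∈-map⁻ (λ j → ρ j , ρ' j) p∈
        ... | j , j∈ , refl = mem j (fresh-> _ (∈-++⁺ʳ e (constants-∈ i∈ j∈)))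

    toFun : ∀ {A : Set} n (v : List A) → length v ≡ n → Σ (Fin n → A) λ ρ → tabulate ρ ≡ v
    toFun _ v refl = lookup v , tabulate-lookup v

    round-formula : ∀ n v → length v ≡ n → ∀ r → Σ Fm λ θ → satN v θ ×
      (∀ w → length w ≡ n → satN w θ → Σ (List (∣ N ∣ × ∣ N ∣)) λ L → (map proj₁ L ≡ v) × (map proj₂ L ≡ w) × BFN r L)
    round-formula n v len r with toFun n v len
    ... | ρ , refl with pattern-of ⟦ N ⟧ ⟦ N ⟧ ρ (hintikka n r)
    ...   | π , _ , s , agree = translate π , bwd (translate-sat ⟦ N ⟧ blank π ρ) s , game
      where
      game : ∀ w → length w ≡ n → satN w (translate π) →
             Σ (List (∣ N ∣ × ∣ N ∣)) λ L → (map proj₁ L ≡ tabulate ρ) × (map proj₂ L ≡ w) × BFN r L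
      game w len' t with toFun n w len'
      ... | σ , refl = tabulate (λ i → ρ i , σ i) , map-tabulate _ proj₁ , map-tabulate _ proj₂ ,
              agree⇒BF ⟦ N ⟧ ⟦ N ⟧ r ρ σ (agree σ (fwd (translate-sat ⟦ N ⟧ blank π σ) t))

    -- N itself, with its elements named by the constants of a generic Henkin set.
    record Naming (T : ℕ → List I → Set) : Set₁ where
      field
        G       : I → Set
        G-T     : ∀ n → Σ (List I) λ l → T n l × (∀ {i} → i ∈ l → G i)
        name    : ℕ → ∣ N ∣
        G⇔N     : ∀ φ e → G (tt , φ , e) ⇔ satN (map name e) φ
        code    : ∣ N ∣ → ℕ
        code-ok : ∀ b → name (code b) ≡ b

    module _ (T : ℕ → List I → Set)
      (T-up : ∀ {n l l'} → (∀ {i} → i ∈ l → i ∈ l') → T n l → T n l')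
      {Big : List I → Set} (C : Consistency Big) (big₀ : Big [])
      (T-dense : ∀ n l → Big l → Σ (List I) λ l' → Big l' × (∀ {i} → i ∈ l → i ∈ l') × T n l') where

      private
        family : GenericFamily T (λ _ _ _ → ⊤)
        family = Generic.family enum-⊤ C T T-up T-dense (λ _ _ _ → ⊤) (λ _ _ _ → tt)
          (λ n l m b c → l , m , b , c , id , id , tt) [] big₀

        H : HenkinSet (GenericFamily.Gen family (λ _ → true))
        H = GenericFamily.Gen-Henkin family (λ _ → true)

        module TM {G : I → Set} (H : HenkinSet G) where
          open TermModel H
          iso : ⟦ L ⟧ ≃ ⟦ N ⟧
          iso = unique L L-Mod
          name : ℕ → ∣ N ∣
          name j = to iso (rep j)
          G⇔N : ∀ φ e → G (tt , φ , e) ⇔ satN (map name e) φ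
          G⇔N φ e = ⇔-trans (⇔-sym (truthLemma tt k₀-truth φ e))
            (subst (λ z → sat ⟦ L ⟧ blank (map rep e) φ ⇔ satN z φ) (sym (map-∘ e)) (sat-iso iso (λ _ →
                    ⇔-refl) φ (map rep e)))
          code-ok : ∀ b → name (proj₁ (from iso b)) ≡ b
          code-ok b = trans (cong (to iso) (rep-onto (from iso b))) (to∘from iso b)

      abstract
        naming : Naming T
        naming = record
          { G = GenericFamily.Gen family (λ _ → true) ; G-T = GenericFamily.Gen-T family (λ _ → true)
          ; name = TM.name H ; G⇔N = TM.G⇔N H ; code = λ b → proj₁ (from (TM.iso H) b) ; code-ok = TM.code-ok H }

    module _ (n : ℕ) where

      Isolated : List ∣ N ∣ → Set
      Isolated u = Σ Fm λ θ → satN u θ × (∀ w → length w ≡ n → satN w θ → u ∼ w)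

      -- Omitting types: a generic model omitting the type of `u` would be isomorphic to `N`, which
      -- realises it.
      module Omit (u : List ∣ N ∣) (len : length u ≡ n) (non-isolated : ¬ Isolated u) where

        Big : List I → Set
        Big l = Σ (ℕ → ∣ N ∣) λ ρ → Holds N ρ l

        consistency : Consistency Big
        consistency = record { big-sat = λ (ρ , hs) → N , N-Mod , ρ , hs ; big-dec = dec' ; big-wit = wit' }
          where
          dec' : ∀ {l} → Big l → ∀ k φ e → Big ((k , φ , e) ∷ l) ⊎ Big ((k , notF φ , e) ∷ l)
          dec' (ρ , hs) k φ e with em {holds N ρ (k , φ , e)}
          ... | yes h = inj₁ (ρ , Holds-∷ h hs)
          ... | no nh = inj₂ (ρ , Holds-∷ nh hs)
          wit' : ∀ {l} → Big l → ∀ k φ e → Big ((k , notF (exF φ) , e) ∷ l) ⊎ Σ ℕ λ j → Big ((k , φ , j ∷ e) ∷ l)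
          wit' (ρ , hs) k φ e with em {holds N ρ (k , exF φ , e)}
          ... | no nh = inj₁ (ρ , Holds-∷ nh hs)
          ... | yes (a , s) = let ρ' , hs' , _ = fresh-witness hs [] k φ e a s in inj₂ (_ , ρ' , hs')

        tuples : Enum (List ℕ)
        tuples = enum-List enum-ℕ

        Omitted : List ℕ → List I → Set
        Omitted e l = length e ≡ n → Σ Fm λ ψ → satN u ψ × ((tt , notF ψ , e) ∈ l)

        omit : ∀ e l → Big l → Σ (List I) λ l' → Big l' × (∀ {i} → i ∈ l → i ∈ l') × Omitted e l'
        omit e l (ρ , hs) with length e ≟ n
        ... | no ne = l , (ρ , hs) , id , λ len' → ⊥-elim (ne len')
        ... | yes len' = finish differing
          where
          Differing : Set
          Differing = Σ (ℕ → ∣ N ∣) λ ρ' → Holds N ρ' l × ¬ (u ∼ map ρ' e)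
          differing : Differing
          differing with em {u ∼ map ρ e}
          ... | no nt = ρ , hs , nt
          ... | yes t with round-formula n (map ρ e) (trans (length-map ρ e) len') (rounds l e)
          -- `θ` leaves enough rounds to preserve `l`. If every tuple satisfying `θ` had the type of
          -- `u`, then `θ` would isolate that type.
          ...   | θ , s , game = by-contradiction {Differing} λ none' → non-isolated (θ , bwd (t θ) s , λ w lw sw →
                  by-contradiction λ nw →
                    let L , p , q , bf = game w lw sw
                        ρ' , hs' , r = reassign ρ l e L p bf hs
                    in none' (ρ' , (λ i∈ → hs' i∈) , λ t' → nw (subst (u ∼_) (trans r q) t')))
          finish : Differing →
                   Σ (List I) λ l' → Big l' × (∀ {i} → i ∈ l → i ∈ l') × Omitted e l'
          finish (ρ' , hs' , nt) with separating {⟦ N ⟧} {⟦ N ⟧} nt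
          ... | ψ , p , q = (tt , notF ψ , e) ∷ l , (ρ' , Holds-∷ q hs') , there , λ _ → ψ , p , here refl

        omitting : Naming (λ m → Omitted (proj₁ tuples m))
        omitting = naming (λ m → Omitted (proj₁ tuples m))
          (λ s h len' → let ψ , p , q = h len' in ψ , p , s q) consistency ((λ _ → d) , λ ()) (λ m →
                  omit (proj₁ tuples m))

        open Naming omitting

        named : map name (map code u) ≡ u
        named = trans (sym (map-∘ u)) (trans (map-cong code-ok u) (map-id u))

        impossible : ⊥
        impossible =
          let m , ≡e = proj₂ tuples (map code u)
              l , t , l⊆ = G-T m
              ψ , p , i∈ = subst (λ e → Omitted e l) ≡e t (trans (length-map code u) len)
          in subst (λ z → ¬ satN z ψ) named (fwd (G⇔N (notF ψ) (map code u)) (l⊆ i∈)) p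

      -- Infinitely many isolated types accumulate at a type realised in some model but not in N.
      module Realise (isolated : ∀ u → length u ≡ n → Isolated u) (infinite : ¬ FinTypes ⟦ N ⟧ n) where

        c̄ : List ℕ
        c̄ = upTo n

        Covered : (List ∣ N ∣ → Set) → Set
        Covered Q = Σ (List (List ∣ N ∣)) λ reps → ∀ u → Q u → Σ (List ∣ N ∣) λ w → (w ∈ reps) × (u ∼ w)

        Sat-l : List I → List ∣ N ∣ → Set
        Sat-l l u = Σ (ℕ → ∣ N ∣) λ ρ → Holds N ρ l × (map ρ c̄ ≡ u)

        -- Conditions compatible with infinitely many types of the named tuple; splitting such a
        -- condition leaves one half of the same kind.
        Big : List I → Set
        Big l = ¬ Covered (Sat-l l)

        dec' : ∀ {l} → Big l → ∀ k φ e → Big ((k , φ , e) ∷ l) ⊎ Big ((k , notF φ , e) ∷ l)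
        dec' {l} b k φ e with em {Covered (Sat-l ((k , φ , e) ∷ l))} | em {Covered (Sat-l ((k , notF φ , e) ∷ l))}
        ... | no n₁ | _ = inj₁ n₁
        ... | yes _ | no n₂ = inj₂ n₂
        ... | yes (r₁ , c₁) | yes (r₂ , c₂) = ⊥-elim (b (r₁ ++ r₂ , both))
          where
          both : ∀ u → Sat-l l u → Σ (List ∣ N ∣) λ w → (w ∈ r₁ ++ r₂) × (u ∼ w)
          both u (ρ , hs , ≡e) with em {holds N ρ (k , φ , e)}
          ... | yes h = let w , w∈ , s = c₁ u (ρ , Holds-∷ h hs , ≡e) in w , ∈-++⁺ˡ w∈ , s
          ... | no nh = let w , w∈ , s = c₂ u (ρ , Holds-∷ nh hs , ≡e) in w , ∈-++⁺ʳ r₁ w∈ , s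

        wit' : ∀ {l} → Big l → ∀ k φ e → Big ((k , notF (exF φ) , e) ∷ l) ⊎ Σ ℕ λ j → Big ((k , φ , j ∷ e) ∷ l)
        wit' {l} b k φ e with dec' b k (exF φ) e
        ... | inj₂ b' = inj₁ b'
        ... | inj₁ b' = inj₂ (freshFor c̄ e l , λ (reps , cov) → b' (reps , λ u (ρ , hs , ≡e) →
              let a , s = hs (here refl)
                  ρ' , hs' , ≡e' = fresh-witness (λ i∈ → hs (there i∈)) c̄ k φ e a s
              in cov u (ρ' , (λ i∈ → hs' i∈) , trans ≡e' ≡e)))

        big-sat' : ∀ {l} → Big l → Satisfiable l
        big-sat' {l} b = by-contradiction {Satisfiable l} λ none' → b ([] , λ u (ρ , hs , _) →
                ⊥-elim (none' (N , N-Mod , ρ , hs)))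

        tuples : Enum (List ∣ N ∣)
        tuples = enum-List (enum-∣∣ N d)

        Avoided : List ∣ N ∣ → List I → Set
        Avoided u l = length u ≡ n → Σ Fm λ ψ → ¬ satN u ψ × ((tt , ψ , c̄) ∈ l)

        avoid : ∀ u l → Big l → Σ (List I) λ l' → Big l' × (∀ {i} → i ∈ l → i ∈ l') × Avoided u l'
        avoid u l b with length u ≟ n
        ... | no ne = l , b , id , λ len → ⊥-elim (ne len)
        ... | yes len with isolated u len
        ...   | θ , s , iso with dec' b tt θ c̄
        ...     | inj₂ b' = _ , b' , there , λ _ → notF θ , (λ h → h s) , here refl
        -- This half is impossible: with `θ` added only the type of `u` remains.
        ...     | inj₁ b' = ⊥-elim (b' (u ∷ [] , λ w (ρ , hs , ≡e) → u , here refl , SameType-sym {⟦ N ⟧} {⟦ N ⟧}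
                    (iso w (trans (cong length (sym ≡e)) (trans (length-map ρ c̄) (length-upTo n)))
                         (subst (λ z → satN z θ) ≡e (hs (here refl))))))

        big₀ : Big []
        big₀ (reps , cov) = infinite (reps , λ u len → cov u (assign d u , (λ ()) ,
          subst (λ m → map (assign d u) (upTo m) ≡ u) len (map-assign d u)))

        consistency : Consistency Big
        consistency = record { big-sat = λ {l} → big-sat' {l} ; big-dec = λ {l} → dec' {l} ; big-wit = λ {l} →
                wit' {l} }

        avoiding : Naming (λ m → Avoided (proj₁ tuples m))
        avoiding = naming (λ m → Avoided (proj₁ tuples m))
          (λ s h len' → let ψ , p , q = h len' in ψ , p , s q) consistency big₀ (λ m → avoid (proj₁ tuples m))

        open Naming avoiding

        impossible : ⊥
        impossible =
          let m , ≡e = proj₂ tuples (map name c̄)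
              l , t , l⊆ = G-T m
              ψ , p , i∈ = subst (λ u → Avoided u l) ≡e t (trans (length-map name c̄) (length-upTo n))
          in p (fwd (G⇔N ψ c̄) (l⊆ i∈))

  abstract
    finTypes : ∀ n → FinTypes ⟦ N ⟧ n
    finTypes n = by-contradiction λ infinite → Realise.impossible n
      (λ u len → by-contradiction λ ni → Omit.impossible n u len ni) infinite

-- Blocks, their largest elements and the two cases of the theorem.

all-or-some : ∀ {k} {A B : Fin k → Set₁} → (∀ i → A i ⊎ B i) → (∀ i → A i) ⊎ Σ (Fin k) B
all-or-some {zero}  h = inj₁ λ ()
all-or-some {suc k} {A} {B} h with h Fin.zero | all-or-some {k} {λ i → A (Fin.suc i)} {λ i →
        B (Fin.suc i)} (λ i → h (Fin.suc i))
... | inj₂ b | _ = inj₂ (Fin.zero , b)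
... | inj₁ _ | inj₂ (i , b) = inj₂ (Fin.suc i , b)
... | inj₁ a | inj₁ as = inj₁ λ { Fin.zero → a ; (Fin.suc i) → as i }

map-≡-∈ : {A B : Set} {f g : A → B} (l : List A) → map f l ≡ map g l → ∀ {a} → a ∈ l → f a ≡ g a
map-≡-∈ (x ∷ l) e (here refl) = ∷-injectiveˡ e
map-≡-∈ (x ∷ l) e (there a∈)  = map-≡-∈ l (∷-injectiveʳ e) a∈

Lex-Block : ∀ {X} (𝕀 : FinPO) p → IsLexSum X 𝕀 p → X ≃ Lex 𝕀 (Block X p)
Lex-Block {X} 𝕀 p lex = record
  { to = λ x → p x , x , refl
  ; from = λ (_ , x , _) → x
  ; to∘from = λ { (_ , x , refl) → refl }
  ; from∘to = λ _ → refl
  ; mono = λ x y → ⇔-trans (lex x y) (mk⇔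
      (λ { (inj₁ (e , r)) → inj₁ (e , subst (λ z → _≤_ X z y) (sym (proj₁-subst e (x , refl))) r) ; (inj₂ r) →
              inj₂ r })
      (λ { (inj₁ (e , r)) → inj₁ (e , subst (λ z → _≤_ X z y) (proj₁-subst e (x , refl)) r) ; (inj₂ r) → inj₂ r })) }
  where
  proj₁-subst : ∀ {i j} (e : i ≡ j) (x : Carrier (Block X p i)) →
                proj₁ (subst (λ k → Carrier (Block X p k)) e x) ≡ proj₁ x
  proj₁-subst refl x = refl

Lex-↣ : ∀ 𝕀 {Y : Fin (size 𝕀) → Structure} → (∀ i → Carrier (Y i) ↣ ℕ) → Carrier (Lex 𝕀 Y) ↣ ℕ
Lex-↣ 𝕀 {Y} ι = mk↣ {to = λ (i , x) → pair (toℕ i) (Injection.to (ι i) x)} λ {a} {b} e → inj a b (pair-injective e)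
  where
  inj : ∀ (a b : Carrier (Lex 𝕀 Y)) → (toℕ (proj₁ a) ≡ toℕ (proj₁ b)) ×
        (Injection.to (ι (proj₁ a)) (proj₂ a) ≡ Injection.to (ι (proj₁ b)) (proj₂ b)) → a ≡ b
  inj (i , x) (j , y) (p , q) with toℕ-injective p
  ... | refl = cong (i ,_) (Injection.injective (ι i) q)

Lex-same : ∀ 𝕀 {Y : Fin (size 𝕀) → Structure} i x y → _≤_ (Lex 𝕀 Y) (i , x) (i , y) ⇔ _≤_ (Y i) x y
Lex-same 𝕀 i x y = mk⇔ (λ { (inj₁ (refl , r)) → r ; (inj₂ (_ , n)) → ⊥-elim (n refl) }) (λ r → inj₁ (refl , r))

Tops : ∀ {k} → (Fin k → Structure) → Set
Tops Y = ∀ i → HasLargest (Y i)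

top : ∀ 𝕀 {Y : Fin (size 𝕀) → Structure} → Tops Y → Fin (size 𝕀) → Carrier (Lex 𝕀 Y)
top 𝕀 t i = i , proj₁ (t i)

module _ (𝕀 : FinPO) where

  private
    antisym = IsPartialOrder.antisym (isPO 𝕀)

  -- The blocks are definable from their largest elements.
  InBlock : ∀ {Y : Fin (size 𝕀) → Structure} → Tops Y → Fin (size 𝕀) → Carrier (Lex 𝕀 Y) → Set
  InBlock {Y} t i z = _≤_ (Lex 𝕀 Y) z (top 𝕀 {Y} t i) ×
                      (∀ j → _≤I_ 𝕀 j i → j ≢ i → ¬ _≤_ (Lex 𝕀 Y) z (top 𝕀 {Y} t j))

  InBlock⇔ : ∀ {Y} (t : Tops Y) i z → InBlock {Y} t i z ⇔ (proj₁ z ≡ i)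
  InBlock⇔ {Y} t i (j , x) = mk⇔ one two
    where
    one : InBlock {Y} t i (j , x) → j ≡ i
    one (inj₁ (e , _) , _) = e
    one (inj₂ (j≤i , j≢i) , below) = ⊥-elim (below j j≤i j≢i (inj₁ (refl , proj₂ (t j) x)))
    two : j ≡ i → InBlock {Y} t i (j , x)
    two refl = inj₁ (refl , proj₂ (t j) x) , λ where
      j' j'≤j j'≢j (inj₁ (e , _)) → j'≢j (sym e)
      j' j'≤j j'≢j (inj₂ (j≤j' , _)) → j'≢j (antisym j'≤j j≤j')

  module _ {Y Z : Fin (size 𝕀) → Structure} (t : Tops Y) (s : Tops Z) where

    Lex-block : (e : Lex 𝕀 Y ≃ Lex 𝕀 Z) → (∀ j → to e (top 𝕀 {Y} t j) ≡ top 𝕀 {Z} s j) →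
                ∀ i x → proj₁ (to e (i , x)) ≡ i
    Lex-block e tops i x = fwd (InBlock⇔ {Z} s i (to e (i , x))) (fwd (≤⇔ i) (proj₁ inY) , λ j j≤i j≢i h →
      proj₂ inY j j≤i j≢i (bwd (≤⇔ j) h))
      where
      inY = bwd (InBlock⇔ {Y} t i (i , x)) refl
      ≤⇔ : ∀ j → _≤_ (Lex 𝕀 Y) (i , x) (top 𝕀 {Y} t j) ⇔ _≤_ (Lex 𝕀 Z) (to e (i , x)) (top 𝕀 {Z} s j)
      ≤⇔ j = subst (λ z → _≤_ (Lex 𝕀 Y) (i , x) (top 𝕀 {Y} t j) ⇔ _≤_ (Lex 𝕀 Z) (to e (i , x)) z) (tops j)
               (mono e (i , x) (top 𝕀 {Y} t j))

  Lex-block-≃ : ∀ {Y Z : Fin (size 𝕀) → Structure} (t : Tops Y) (s : Tops Z) (e : Lex 𝕀 Y ≃ Lex 𝕀 Z) →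
                (∀ j → to e (top 𝕀 {Y} t j) ≡ top 𝕀 {Z} s j) → ∀ i → Y i ≃ Z i
  Lex-block-≃ {Y} {Z} t s e tops i = record
    { to = λ x → proj₁ (there' x) ; from = λ y → proj₁ (back' y)
    ; to∘from = λ y → injᵢ {Z} (trans (proj₂ (there' (proj₁ (back' y)))) (trans (cong (to e) (proj₂ (back' y)))
            (to∘from e (i , y))))
    ; from∘to = λ x → injᵢ {Y} (trans (proj₂ (back' (proj₁ (there' x)))) (trans (cong (from e) (proj₂ (there'
            x))) (from∘to e (i , x))))
    ; mono = λ x y → ⇔-trans (⇔-sym (Lex-same 𝕀 {Y} i x y)) (⇔-trans (mono e (i , x) (i , y))
        (subst (_⇔ _≤_ (Z i) (proj₁ (there' x)) (proj₁ (there' y)))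
          (cong₂ (_≤_ (Lex 𝕀 Z)) (proj₂ (there' x)) (proj₂ (there' y)))
          (Lex-same 𝕀 {Z} i (proj₁ (there' x)) (proj₁ (there' y))))) }
    where
    place : ∀ {W : Fin (size 𝕀) → Structure} (z : Carrier (Lex 𝕀 W)) → proj₁ z ≡ i → Σ (Carrier (W i)) λ x →
            (i , x) ≡ z
    place (_ , x) refl = x , refl
    injᵢ : ∀ {W : Fin (size 𝕀) → Structure} {x y : Carrier (W i)} → _≡_ {A = Carrier (Lex 𝕀 W)} (i , x) (i ,
            y) → x ≡ y
    injᵢ refl = refl
    tops' : ∀ j → from e (top 𝕀 {Z} s j) ≡ top 𝕀 {Y} t j
    tops' j = trans (cong (from e) (sym (tops j))) (from∘to e (top 𝕀 {Y} t j))
    there' : ∀ x → Σ (Carrier (Z i)) λ y → (i , y) ≡ to e (i , x)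
    there' x = place {Z} (to e (i , x)) (Lex-block {Y} {Z} t s e tops i x)
    back' : ∀ y → Σ (Carrier (Y i)) λ x → (i , x) ≡ from e (i , y)
    back' y = place {Y} (from e (i , y)) (Lex-block {Z} {Y} s t (≃-sym e) tops' i y)

module Decomposition (em : ExcludedMiddle 0ℓ) (X : Structure) (𝕀 : FinPO) (p : Carrier X → Fin (size 𝕀))
  (lex : IsLexSum X 𝕀 p) (largest : ∀ i → HasLargest (Block X p i)) where

  open Games em

  B : Fin (size 𝕀) → Structure
  B = Block X p

  Lex-model : ∀ {Y : Fin (size 𝕀) → Structure} → (∀ i → ModelOfTh (B i) (Y i)) → ModelOfTh X (Lex 𝕀 Y)
  Lex-model {Y} m = ModelOfTh-trans {X} {Lex 𝕀 B} {Lex 𝕀 Y} (ModelOfTh-iso (Lex-Block {X} 𝕀 p lex))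
    (BF⇒ModelOfTh λ r → Lex-BF 𝕀 Y B r {λ _ → []} (λ ()) (λ i → ModelOfTh⇒BF (m i) r))

  -- Having a largest element is expressed by a single sentence, so it passes to every model of the
  -- theory of the block.
  HasLargest-model : ∀ {i Y} → ModelOfTh (B i) Y → HasLargest Y
  HasLargest-model {i} m = bwd (m (∃f (∀f (le Fin.zero (Fin.suc Fin.zero))))) (largest i)

  cod : ∀ {Z} → CountableModel Z → Cod
  cod (Y , ι , _) = encode Y ι

  cod-≃ : ∀ {Z} (M : CountableModel Z) → ⟦ cod M ⟧ ≃ model M
  cod-≃ (Y , ι , _) = encode-≃ Y ι

  cod-Mod : ∀ {Z} (M : CountableModel Z) → ModelOfTh Z ⟦ cod M ⟧
  cod-Mod {Z} (Y , ι , m) = ModelOfTh-≃ {Z} (≃-sym (encode-≃ Y ι)) m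

  module AllCategorical (cat : ∀ i → I≡1 (B i)) where

    private
      N : ∀ i → Cod
      N i = cod (proj₁ (cat i))

      fin : ∀ i n → FinTypes ⟦ N i ⟧ n
      fin i = RyllNardzewski.finTypes em (B i) (N i) (proj₁ (HasLargest-model {i} (cod-Mod (proj₁ (cat i)))))
        (cod-Mod (proj₁ (cat i)))
        (λ M mod → ≅⇒≃ (proj₂ (cat i) (⟦ M ⟧ , code-↣ M , mod) (⟦ N i ⟧ , code-↣ (N i) , cod-Mod (proj₁ (cat i)))))

      S : CountableModel X
      S = Lex 𝕀 (λ i → ⟦ N i ⟧) , Lex-↣ 𝕀 {λ i → ⟦ N i ⟧} (λ i → code-↣ (N i)) , Lex-model (λ i →
              cod-Mod (proj₁ (cat i)))

      toS : (M : CountableModel X) → model M ≃ ⟦ cod S ⟧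
      toS M = ≃-trans (≃-sym (cod-≃ M)) (Categorical.finTypes⇒≃ em (cod M) (cod S)
        (λ n → FinTypes-iso (≃-sym (cod-≃ S)) (Categorical.Lex-FinTypes em 𝕀 (λ i → ⟦ N i ⟧) fin n))
        (SameType-trans {⟦ cod M ⟧} {X} {⟦ cod S ⟧} (ModelOfTh⇒SameType (cod-Mod M))
          (SameType-sym {⟦ cod S ⟧} {X} (ModelOfTh⇒SameType (cod-Mod S)))))

    categorical : I≡1 X
    categorical = S , λ M N → ≃⇒≅ (≃-trans (toS M) (≃-sym (toS N)))

  module SomeContinuum (N : ∀ i → CountableModel (B i)) (i₀ : Fin (size 𝕀)) (F : (ℕ → Bool) → CountableModel (B i₀))
    (F-injective : ∀ f g → model (F f) ≅ model (F g) → f ≡ g) where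

    open Continuum em X (proj₁ (proj₁ (largest i₀)))

    private
      Y : (ℕ → Bool) → ∀ i → CountableModel (B i)
      Y f i with i Fin.≟ i₀
      ... | yes refl = F f
      ... | no _     = N i

      Y-≡ : ∀ f → model (Y f i₀) ≡ model (F f)
      Y-≡ f with i₀ Fin.≟ i₀
      ... | yes refl = refl
      ... | no n     = ⊥-elim (n refl)

      𝕐 : (ℕ → Bool) → Fin (size 𝕀) → Structure
      𝕐 f i = model (Y f i)

      tops : ∀ f → Tops (𝕐 f)
      tops f i = HasLargest-model {i} (proj₂ (proj₂ (Y f i)))

      S : (ℕ → Bool) → CountableModel X
      S f = Lex 𝕀 (𝕐 f) , Lex-↣ 𝕀 {𝕐 f} (λ i → proj₁ (proj₂ (Y f i))) , Lex-model (λ i → proj₂ (proj₂ (Y f i)))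

      point : ∀ f → Fin (size 𝕀) → ∣ cod (S f) ∣
      point f i = from (cod-≃ (S f)) (top 𝕀 {𝕐 f} (tops f) i)

      A : (ℕ → Bool) → Σ Cod λ M → List ∣ M ∣
      A f = cod (S f) , map (point f) (allFin (size 𝕀))

      A-injective : ∀ f g → PtIso (A f) (A g) → f ≡ g
      A-injective f g (e , ≡e) = F-injective f g (≃⇒≅ (subst id (cong₂ _≃_ (Y-≡ f) (Y-≡ g))
        (Lex-block-≃ 𝕀 {𝕐 f} {𝕐 g} (tops f) (tops g) h h-tops i₀)))
        where
        h : Lex 𝕀 (𝕐 f) ≃ Lex 𝕀 (𝕐 g)
        h = ≃-trans (≃-sym (cod-≃ (S f))) (≃-trans e (cod-≃ (S g)))
        points : ∀ j → to e (point f j) ≡ point g j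
        points j = map-≡-∈ (allFin (size 𝕀)) (trans (map-∘ (allFin (size 𝕀))) ≡e) (∈-allFin j)
        h-tops : ∀ j → to h (top 𝕀 {𝕐 f} (tops f) j) ≡ top 𝕀 {𝕐 g} (tops g) j
        h-tops j = trans (cong (to (cod-≃ (S g))) (points j)) (to∘from (cod-≃ (S g)) (top 𝕀 {𝕐 g} (tops g) j))

      -- The diagram of a code as one real: tag 0 carries the domain, and the relation is read off
      -- at tag 1.
      flatten : Cod → ℕ → Bool
      flatten M n with unpair n
      ... | zero  , m = dom M m
      ... | suc _ , m = rel M (proj₁ (unpair m)) (proj₂ (unpair m))

      flatten-dom : ∀ M m → flatten M (pair 0 m) ≡ dom M m
      flatten-dom M m rewrite unpair-pair 0 m = refl

      flatten-rel : ∀ M m n → flatten M (pair 1 (pair m n)) ≡ rel M m n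
      flatten-rel M m n rewrite unpair-pair 1 (pair m n) | unpair-pair m n = refl

      flatten-≃ : ∀ M N → (∀ n → flatten M n ≡ flatten N n) → ⟦ M ⟧ ≃ ⟦ N ⟧
      flatten-≃ M N h = record
        { to = λ (n , e) → n , trans (sym (same-dom n)) e ; from = λ (n , e) → n , trans (same-dom n) e
        ; to∘from = λ _ → ∣∣-≡ {N} refl ; from∘to = λ _ → ∣∣-≡ {M} refl
        ; mono = λ (m , _) (n , _) → mk⇔ (trans (sym (same-rel m n))) (trans (same-rel m n)) }
        where
        same-dom : ∀ n → dom M n ≡ dom N n
        same-dom n = trans (sym (flatten-dom M n)) (trans (h (pair 0 n)) (flatten-dom N n))
        same-rel : ∀ m n → rel M m n ≡ rel N m n
        same-rel m n = trans (sym (flatten-rel M m n)) (trans (h (pair 1 (pair m n))) (flatten-rel N m n))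

      c-injective : ∀ f g → (∀ n → flatten (cod (F f)) n ≡ flatten (cod (F g)) n) → f ≡ g
      c-injective f g h = F-injective f g (≃⇒≅ (≃-trans (≃-sym (cod-≃ (F f)))
        (≃-trans (flatten-≃ (cod (F f)) (cod (F g)) h) (cod-≃ (F g)))))

    continuum : I≡𝔠 X
    continuum = I≡𝔠-from-family A (λ f → cod-Mod (S f)) (size 𝕀)
      (λ f → trans (length-map (point f) (allFin (size 𝕀))) (length-tabulate id)) A-injective
      (λ f → flatten (cod (F f))) c-injective

theorem4p2 : ExcludedMiddle 0ℓ → ExcludedMiddle (Level.suc 0ℓ) →
    (X : Structure) → IsPO X → VC♯Decomposition X → VC♯ X
theorem4p2 em _ X _ (𝕀 , p , lex , blocks) with all-or-some (λ i → proj₂ (blocks i))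
... | inj₁ cat = inj₁ (Decomposition.AllCategorical.categorical em X 𝕀 p lex (λ i → proj₁ (blocks i)) cat)
... | inj₂ (i₀ , F , F-injective) =
  inj₂ (Decomposition.SomeContinuum.continuum em X 𝕀 p lex (λ i → proj₁ (blocks i)) (λ i →
          someModel (proj₂ (blocks i))) i₀ F F-injective)
  where
  someModel : ∀ {Y} → VC♯ Y → CountableModel Y
  someModel (inj₁ (M , _)) = M
  -- A block that is kept needs just some countable model, so any member of its family serves.
  someModel (inj₂ (F , _)) = F (λ _ → true)
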